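{- Let $q$ be a positive integer and let $\mathscr{B}\colon X\to^? q$ be a Borel CSP on a standard Borel space $X$. Suppose that \[ \mathsf{p}(\mathscr{B})\,(\mathsf{d}(\mathscr{B})+1)^{2}\,\leq\, e^{ -2}. \] If $\tau$ is a compatible Polish topology on $X$, then $\mathscr{B}$ has a $\tau$-Baire-measurable solution.
   Context: $q\in\mathbb{N}$ is identified with $\{0,\dots,q-1\}$. CSPs. Let $X$ be a set and $q$ a positive integer. An $(X,q)$-constraint with domain a finite set $D\subseteq X$ is a set $B\subseteq q^D$ of functions $D\to q$; write $\mathrm{dom}(B)=D$. A function $f\colon X\to q$ violates $B$ if $f|_{\mathrm{dom}(B)}\in B$, and satisfies $B$ otherwise. A constraint satisfaction problem (CSP) $\mathscr{B}\colon X\to^? q$ is a set of $(X,q)$-constraints; a solution to it is a function $f\colon X\to q$ satisfying every $B\in\mathscr{B}$. Put $\mathbb{P}[B]=|B|/q^{|\mathrm{dom}(B)|}$, $\mathsf{p}(\mathscr{B})=\sup_{B\in\mathscr{B}}\mathbb{P}[B]$, and $\mathsf{d}(\mathscr{B})=\sup_{B\in\mathscr{B}}|\{B'\in\mathscr{B}: B'\neq B,\ \mathrm{dom}(B')\cap\mathrm{dom}(B)\neq\varnothing\}|$. Inequalities involving $\mathsf{d}(\mathscr{B})$ are understood to include $\mathsf{d}(\mathscr{B})<\infty$. Borel CSPs. For a standard Borel space $X$, the set $[X]^k$ of $k$-element subsets carries the quotient standard Borel structure from the $k$-tuples of distinct points, and the set $[X]^{<\infty}=\bigsqcup_k[X]^k$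 of finite subsets carries the disjoint union structure. The set of finite partial functions $X\rightharpoonup q$ (identified with their graphs) is a Borel subset of $[X\times q]^{<\infty}$. The set $\mathrm{Const}(X,q)$ of all $(X,q)$-constraints, viewed as finite sets of finite partial functions $X\rightharpoonup q$ with a common domain, is a Borel subset of the space of finite subsets of that space, hence is standard Borel. A CSP $\mathscr{B}\colon X\to^? q$ is Borel if it is a Borel subset of $\mathrm{Const}(X,q)$. A Polish topology on $X$ is compatible if it generates the Borel $\sigma$-algebra of $X$. A function $f\colon X\to q$ is $\tau$-Baire-measurable if each $f^{ -1}(i)$, $0\le i<q$, has the Baire property with respect to $\tau$. -}

module Defs where

open import Data.Fin.Base using (Fin)
open import Data.Integer.Base using (+_)
open import Data.List.Base using (List; length)
import Data.List.Membership.Setoid as Membership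
import Data.List.Relation.Binary.Subset.Setoid as Subset
import Data.List.Relation.Unary.Unique.Setoid as Unique
open import Data.Maybe.Base using (Maybe; just)
open import Data.Nat.Base as ℕ using (ℕ; zero; suc; _!; _^_)
import Data.Nat.Properties as ℕₚ
open import Data.Product.Base using (Σ-syntax; ∃-syntax; _×_; _,_; proj₁; proj₂)
open import Data.Rational.Base as ℚ
  using (ℚ; 0ℚ; 1ℚ; _/_; 1/_; NonNegative; Positive)
import Data.Rational.Properties as ℚₚ
open import Data.Vec.Base using (Vec; lookup; toList)
open import Function.Base using (_∘_)
open import Function.Bundles using (_⇔_; mk⇔; Equivalence)
open import Level using (Level; 0ℓ) renaming (suc to lsuc)
open import Relation.Binary.Bundles using (Setoid)
open import Relation.Binary.Core using (Rel)
open import Relation.Binary.Definitions using (_Respects_)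
open import Relation.Binary.PropositionalEquality
  using (_≡_; subst; setoid)
open import Relation.Nullary.Negation using (¬_)
open import Relation.Unary
  using (Pred; _∈_; _⊆_; _≐_; _∩_; _∪_; _∖_; ∁; ∅; U; ⋃; _≬_; Satisfiable; Empty)

private
  variable
    a ℓ : Level

------------------------------------------------------------------------
-- Nonnegative real numbers

-- A real x ≥ 0 is the set of rationals s with x < s (a right Dedekind cut).
-- Read classically, one-sided cuts are exactly the nonnegative reals.

record ℝ≥0 : Set₁ where
  field
    Above     : Pred ℚ 0ℓ
    inhabited : Satisfiable Above
    positive  : ∀ {s} → Above s → 0ℚ ℚ.< s
    upward    : ∀ {s t} → Above s → s ℚ.≤ t → Above t
    open′     : ∀ {s} → Above s → ∃[ r ] r ℚ.< s × Above r

open ℝ≥0 public using (Above)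

infix 4 _≤ᵣ_ _≃ᵣ_ _<ℚ_

_≤ᵣ_ : Rel ℝ≥0 0ℓ
x ≤ᵣ y = Above y ⊆ Above x

_≃ᵣ_ : Rel ℝ≥0 0ℓ
x ≃ᵣ y = x ≤ᵣ y × y ≤ᵣ x

_<ℚ_ : ℝ≥0 → ℚ → Set
x <ℚ s = Above x s

private
  +1-bound : ∀ r → r ℚ.< r ℚ.+ 1ℚ
  +1-bound r = subst (ℚ._< r ℚ.+ 1ℚ) (ℚₚ.+-identityʳ r)
                 (ℚₚ.+-mono-≤-< (ℚₚ.≤-refl {r}) (ℚₚ.positive⁻¹ 1ℚ))

infimum : (u : ℕ → ℚ) → (∀ n → NonNegative (u n)) → ℝ≥0
infimum u nonneg = record
  { Above     = λ s → ∃[ n ] u n ℚ.< s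
  ; inhabited = u 0 ℚ.+ 1ℚ , 0 , +1-bound (u 0)
  ; positive  = λ { (n , p) →
      ℚₚ.≤-<-trans (ℚₚ.nonNegative⁻¹ (u n) {{nonneg n}}) p }
  ; upward    = λ { (n , p) s≤t → n , ℚₚ.<-≤-trans p s≤t }
  ; open′     = λ { (n , p) → let (r , u<r , r<s) = ℚₚ.<-dense p in
                              r , r<s , n , u<r }
  }

fromℚ : (r : ℚ) → NonNegative r → ℝ≥0
fromℚ r nonneg = infimum (λ _ → r) (λ _ → nonneg)

infixl 7 _/ᵣ_
_/ᵣ_ : (m n : ℕ) → .{{ℕ.NonZero n}} → ℝ≥0
m /ᵣ n = fromℚ (+ m / n) (ℚₚ.normalize-nonNeg m n)

fromℕ : ℕ → ℝ≥0
fromℕ n = n /ᵣ 1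

infixl 6 _+ᵣ_
infixl 7 _*ᵣ_

_+ᵣ_ : ℝ≥0 → ℝ≥0 → ℝ≥0
x +ᵣ y = record
  { Above     = λ s → ∃[ b ] ∃[ c ] Above x b × Above y c × b ℚ.+ c ℚ.≤ s
  ; inhabited = let (b , xb) = X.inhabited ; (c , yc) = Y.inhabited in
                b ℚ.+ c , b , c , xb , yc , ℚₚ.≤-refl
  ; positive  = λ { (b , c , xb , yc , le) →
      ℚₚ.<-≤-trans (ℚₚ.+-mono-< (X.positive xb) (Y.positive yc)) le }
  ; upward    = λ { (b , c , xb , yc , le) s≤t →
      b , c , xb , yc , ℚₚ.≤-trans le s≤t }
  ; open′     = λ { (b , c , xb , yc , le) →
      let (b′ , b′<b , xb′) = X.open′ xb in
      b′ ℚ.+ c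
      , ℚₚ.<-≤-trans (ℚₚ.+-mono-<-≤ b′<b (ℚₚ.≤-refl {c})) le
      , b′ , c , xb′ , yc , ℚₚ.≤-refl }
  }
  where module X = ℝ≥0 x
        module Y = ℝ≥0 y

_*ᵣ_ : ℝ≥0 → ℝ≥0 → ℝ≥0
x *ᵣ y = record
  { Above     = λ s → ∃[ b ] ∃[ c ] Above x b × Above y c × b ℚ.* c ℚ.≤ s
  ; inhabited = let (b , xb) = X.inhabited ; (c , yc) = Y.inhabited in
                b ℚ.* c , b , c , xb , yc , ℚₚ.≤-refl
  ; positive  = λ { (b , c , xb , yc , le) →
      ℚₚ.<-≤-trans
        (subst (ℚ._< b ℚ.* c) (ℚₚ.*-zeroˡ c) (*-monoˡ yc (X.positive xb)))
        le }
  ; upward    = λ { (b , c , xb , yc , le) s≤t →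
      b , c , xb , yc , ℚₚ.≤-trans le s≤t }
  ; open′     = λ { (b , c , xb , yc , le) →
      let (b′ , b′<b , xb′) = X.open′ xb in
      b′ ℚ.* c , ℚₚ.<-≤-trans (*-monoˡ yc b′<b) le
      , b′ , c , xb′ , yc , ℚₚ.≤-refl }
  }
  where
    module X = ℝ≥0 x
    module Y = ℝ≥0 y
    *-monoˡ : ∀ {b b′ c} → Above y c → b′ ℚ.< b → b′ ℚ.* c ℚ.< b ℚ.* c
    *-monoˡ {c = c} yc = ℚₚ.*-monoˡ-<-pos c {{ℚ.positive (Y.positive yc)}}

infixr 8 _^ᵣ_
_^ᵣ_ : ℝ≥0 → ℕ → ℝ≥0
x ^ᵣ zero  = fromℕ 1
x ^ᵣ suc n = x *ᵣ x ^ᵣ n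

-- eSum n = Σ_{k ≤ n} 1/k!
eSum : ℕ → ℚ
eSum zero    = 1ℚ
eSum (suc n) = eSum n ℚ.+ (+ 1 / (suc n !)) {{ℕₚ._!≢0 (suc n)}}

eSum-pos : ∀ n → Positive (eSum n)
eSum-pos zero    = _
eSum-pos (suc n) =
  ℚₚ.pos+pos⇒pos (eSum n) {{eSum-pos n}} _
    {{ℚₚ.normalize-pos 1 (suc n !) {{ℕₚ._!≢0 (suc n)}}}}

-- The partial sums of e = Σ 1/k! increase to e, so their reciprocals
-- decrease to 1/e.
e⁻¹ : ℝ≥0
e⁻¹ = infimum recip (λ n → ℚₚ.pos⇒nonNeg (recip n) {{ℚₚ.1/pos⇒pos (eSum n) {{eSum-pos n}}}})
  where
    recip : ℕ → ℚ
    recip n = (1/ eSum n) {{ℚₚ.pos⇒nonZero (eSum n) {{eSum-pos n}}}}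

IsSup : {A : Set a} {r : Level} → Rel A r → Pred A ℓ → A → Set _
IsSup _≤_ P s =
  (∀ x → P x → x ≤ s) × (∀ t → (∀ x → P x → x ≤ t) → s ≤ t)

------------------------------------------------------------------------
-- Topology and Baire category

record Topology (X : Set) : Set₂ where
  field
    Open       : Pred (Pred X 0ℓ) (lsuc 0ℓ)
    resp       : ∀ {A B} → A ≐ B → Open A → Open B
    open-U     : Open U
    open-∩     : ∀ {A B} → Open A → Open B → Open (A ∩ B)
    open-⋃     : (I : Set) (A : I → Pred X 0ℓ) →
                 (∀ i → Open (A i)) → Open (⋃ I A)

record Metric (X : Set) : Set₁ where
  field
    dist       : X → X → ℝ≥0
    dist≃0     : ∀ x y → dist x y ≃ᵣ fromℕ 0 ⇔ x ≡ y
    dist-sym   : ∀ x y → dist x y ≃ᵣ dist y x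
    dist-tri   : ∀ x y z → dist x z ≤ᵣ dist x y +ᵣ dist y z

  Cauchy : Pred (ℕ → X) 0ℓ
  Cauchy s = ∀ ε → 0ℚ ℚ.< ε →
    ∃[ N ] ∀ m n → N ℕ.≤ m → N ℕ.≤ n → dist (s m) (s n) <ℚ ε

  _ConvergesTo_ : (ℕ → X) → X → Set
  s ConvergesTo x = ∀ ε → 0ℚ ℚ.< ε →
    ∃[ N ] ∀ n → N ℕ.≤ n → dist (s n) x <ℚ ε

  Complete : Set
  Complete = ∀ s → Cauchy s → ∃[ x ] s ConvergesTo x

  MetricOpen : Pred (Pred X 0ℓ) 0ℓ
  MetricOpen A = ∀ x → x ∈ A →
    ∃[ ε ] 0ℚ ℚ.< ε × (∀ y → dist x y <ℚ ε → y ∈ A)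

module _ {X : Set} (τ : Topology X) where
  open Topology τ

  Closure : Pred X 0ℓ → Pred X (lsuc 0ℓ)
  Closure A x = ∀ V → Open V → x ∈ V → V ≬ A

  Dense : Pred X 0ℓ → Set₁
  Dense A = ∀ x → x ∈ Closure A

  NowhereDense : Pred X 0ℓ → Set₁
  NowhereDense A = ∀ V → Open V → V ⊆ Closure A → Empty V

  Meager : Pred X 0ℓ → Set₁
  Meager A = Σ[ N ∈ (ℕ → Pred X 0ℓ) ] (∀ n → NowhereDense (N n)) × A ≐ ⋃ ℕ N

  BaireProperty : Pred X 0ℓ → Set₁
  BaireProperty A =
    Σ[ V ∈ Pred X 0ℓ ] Open V × Meager ((A ∖ V) ∪ (V ∖ A))

  BaireMeasurable : {q : ℕ} → (X → Fin q) → Set₁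
  BaireMeasurable f = ∀ i → BaireProperty (λ x → f x ≡ i)

  -- A countable set is the range of some ℕ → Maybe X, so that ∅ is allowed.
  Separable : Set₁
  Separable = Σ[ s ∈ (ℕ → Maybe X) ] Dense (λ x → ∃[ n ] s n ≡ just x)

  CompletelyMetrizable : Set₁
  CompletelyMetrizable =
    Σ[ d ∈ Metric X ] Metric.Complete d × (∀ A → Open A ⇔ Metric.MetricOpen d A)

  Polish : Set₁
  Polish = Separable × CompletelyMetrizable

------------------------------------------------------------------------
-- σ-algebras

data Generated {Y : Set} (𝒢 : Pred (Pred Y 0ℓ) (lsuc 0ℓ)) :
     Pred (Pred Y 0ℓ) (lsuc 0ℓ) where
  gen   : ∀ {A} → 𝒢 A → Generated 𝒢 A
  gen-∅ : Generated 𝒢 ∅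
  gen-∁ : ∀ {A} → Generated 𝒢 A → Generated 𝒢 (∁ A)
  gen-⋃ : (A : ℕ → Pred Y 0ℓ) → (∀ n → Generated 𝒢 (A n)) → Generated 𝒢 (⋃ ℕ A)
  resp  : ∀ {A B} → A ≐ B → Generated 𝒢 A → Generated 𝒢 B

-- Spaces of finite sets are quotients, so σ-algebras live on setoids; the
-- measurable sets are subsets of the quotient, i.e. respect the equality.

record σ-Algebra (S : Setoid 0ℓ 0ℓ) : Set₂ where
  open Setoid S
  field
    Measurable : Pred (Pred Carrier 0ℓ) (lsuc 0ℓ)
    respects   : ∀ {A} → Measurable A → A Respects _≈_
    resp-≐     : ∀ {A B} → A ≐ B → Measurable A → Measurable B
    meas-∅     : Measurable ∅
    meas-∁     : ∀ {A} → Measurable A → Measurable (∁ A)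
    meas-⋃     : (A : ℕ → Pred Carrier 0ℓ) →
                 (∀ n → Measurable (A n)) → Measurable (⋃ ℕ A)

open σ-Algebra public using (Measurable)

generatedσ : {Y : Set} → Pred (Pred Y 0ℓ) (lsuc 0ℓ) → σ-Algebra (setoid Y)
generatedσ 𝒢 = record
  { Measurable = Generated 𝒢
  ; respects   = λ {A} _ → subst A
  ; resp-≐     = resp
  ; meas-∅     = gen-∅
  ; meas-∁     = gen-∁
  ; meas-⋃     = gen-⋃
  }

-- Product of Y with a finite discrete space.
_×σ_ : {Y : Set} → σ-Algebra (setoid Y) → (q : ℕ) → σ-Algebra (setoid (Y × Fin q))
_×σ_ {Y} 𝔐 q = generatedσ λ P →
  Σ[ A ∈ Pred Y 0ℓ ] Σ[ I ∈ Pred (Fin q) 0ℓ ]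
    Measurable 𝔐 A × P ≐ (λ z → proj₁ z ∈ A × proj₂ z ∈ I)

-- The product σ-algebra on Y^k.
Powerσ : {S : Setoid 0ℓ 0ℓ} → σ-Algebra S → (k : ℕ) →
         Pred (Pred (Vec (Setoid.Carrier S) k) 0ℓ) (lsuc 0ℓ)
Powerσ {S} 𝔐 k = Generated λ P →
  Σ[ i ∈ Fin k ] Σ[ A ∈ Pred (Setoid.Carrier S) 0ℓ ]
    Measurable 𝔐 A × P ≐ (λ v → lookup v i ∈ A)

------------------------------------------------------------------------
-- Finite sets and cardinality

-- Finite subsets of S: lists, equal when they have the same elements.
FinSets : Setoid 0ℓ 0ℓ → Setoid 0ℓ 0ℓ
FinSets S = record
  { Carrier       = List (Setoid.Carrier S)
  ; _≈_           = λ xs ys → xs ⊑ ys × ys ⊑ xs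
  ; isEquivalence = record
    { refl  = (λ p → p) , (λ p → p)
    ; sym   = λ { (f , g) → g , f }
    ; trans = λ { (f , g) (f′ , g′) → (λ p → f′ (f p)) , (λ p → g (g′ p)) }
    }
  }
  where open Subset S using () renaming (_⊆_ to _⊑_)

module _ (S : Setoid 0ℓ 0ℓ) where
  open Setoid S using (Carrier)
  open Membership S using () renaming (_∈_ to _∈ₗ_)

  HasCardinality : Pred Carrier ℓ → ℕ → Set ℓ
  HasCardinality P n =
    Σ[ xs ∈ List Carrier ]
      Unique.Unique S xs × length xs ≡ n × (∀ x → x ∈ P ⇔ x ∈ₗ xs)

-- [Y]^{<∞} is the disjoint union of the quotients [Y]^k of the spaces of
-- k-tuples of distinct points, these being subspaces of Y^k.  Hence 𝒜 is
-- measurable iff, for every k, its preimage in the distinct k-tuples is the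
-- trace of a measurable subset of Y^k.
FinSetsσ : {S : Setoid 0ℓ 0ℓ} → σ-Algebra S → σ-Algebra (FinSets S)
FinSetsσ {S} 𝔐 = record
  { Measurable = λ 𝒜 → 𝒜 Respects _≈_ × (∀ k → TraceMeasurable k 𝒜)
  ; respects   = proj₁
  ; resp-≐     = λ { (f , g) (r , t) →
      (λ e b → f (r e (g b))) ,
      λ k → let (M , m , h) = t k in
            M , m , λ v u → mk⇔ (f ∘ to (h v u)) (from (h v u) ∘ g) }
  ; meas-∅     = (λ _ ()) , λ k → ∅ , gen-∅ , λ _ _ → mk⇔ (λ ()) (λ ())
  ; meas-∁     = λ { (r , t) →
      (λ e ¬a a → ¬a (r (≈-sym e) a)) ,
      λ k → let (M , m , h) = t k in
            ∁ M , gen-∁ m , λ v u →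
              mk⇔ (λ ¬m a → ¬m (from (h v u) a)) (λ ¬a m → ¬a (to (h v u) m)) }
  ; meas-⋃     = λ A t →
      (λ { e (n , a) → n , proj₁ (t n) e a }) ,
      λ k → ⋃ ℕ (λ n → proj₁ (proj₂ (t n) k)) ,
            gen-⋃ _ (λ n → proj₁ (proj₂ (proj₂ (t n) k))) ,
            λ v u → mk⇔
              (λ { (n , m) → n , to   (proj₂ (proj₂ (proj₂ (t n) k)) v u) m })
              (λ { (n , a) → n , from (proj₂ (proj₂ (proj₂ (t n) k)) v u) a })
  }
  where
    open Setoid (FinSets S) using (_≈_) renaming (sym to ≈-sym)
    open Equivalence using (to; from)
    TraceMeasurable : ℕ → Pred (List (Setoid.Carrier S)) 0ℓ → Set₁
    TraceMeasurable k 𝒜 =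
      Σ[ M ∈ Pred (Vec (Setoid.Carrier S) k) 0ℓ ]
        Powerσ 𝔐 k M ×
        (∀ v → Unique.Unique S (toList v) → v ∈ M ⇔ toList v ∈ 𝒜)

------------------------------------------------------------------------
-- Standard Borel spaces

Compatible : {X : Set} → Topology X → σ-Algebra (setoid X) → Set₁
Compatible τ 𝔅 = ∀ A → Measurable 𝔅 A ⇔ Generated (Topology.Open τ) A

record IsStandardBorel {X : Set} (𝔅 : σ-Algebra (setoid X)) : Set₂ where
  field
    topology   : Topology X
    polish     : Polish topology
    compatible : Compatible topology 𝔅

------------------------------------------------------------------------
-- Constraint satisfaction problems

module CSP (X : Set) (q : ℕ) where

  -- Finite partial functions are given by their graphs, constraints by finite
  -- sets of such graphs.
  Graphs : Setoid 0ℓ 0ℓ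
  Graphs = FinSets (setoid (X × Fin q))

  GraphSets : Setoid 0ℓ 0ℓ
  GraphSets = FinSets Graphs

  Graph Constraint : Set
  Graph      = Setoid.Carrier Graphs
  Constraint = Setoid.Carrier GraphSets

  open Setoid GraphSets using () renaming (_≈_ to _≈ᶜ_)
  open Membership (setoid (X × Fin q)) using () renaming (_∈_ to _∈ᵍ_)
  open Membership Graphs using () renaming (_∈_ to _∈ᶜ_)

  Functional : Graph → Set
  Functional φ = ∀ x i j → (x , i) ∈ᵍ φ → (x , j) ∈ᵍ φ → i ≡ j

  domain : Graph → Pred X 0ℓ
  domain φ x = ∃[ i ] (x , i) ∈ᵍ φ

  IsConstraint : Pred Constraint 0ℓ
  IsConstraint B =
    (∀ φ → φ ∈ᶜ B → Functional φ) ×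
    (∀ φ ψ → φ ∈ᶜ B → ψ ∈ᶜ B → domain φ ≐ domain ψ)

  -- The common domain of the members of B; by convention dom ∅ = ∅.
  dom : Constraint → Pred X 0ℓ
  dom B x = ∃[ φ ] φ ∈ᶜ B × x ∈ domain φ

  IsRestriction : (X → Fin q) → Pred X 0ℓ → Graph → Set
  IsRestriction f D φ = ∀ x i → (x , i) ∈ᵍ φ ⇔ (x ∈ D × f x ≡ i)

  Violates : (X → Fin q) → Constraint → Set
  Violates f B = ∃[ φ ] φ ∈ᶜ B × IsRestriction f (dom B) φ

  Satisfies : (X → Fin q) → Constraint → Set
  Satisfies f B = ¬ Violates f B

  record IsCSP (ℬ : Pred Constraint 0ℓ) : Set where
    field
      respects    : ℬ Respects _≈ᶜ_
      constraints : ℬ ⊆ IsConstraint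

  Solution : Pred Constraint 0ℓ → (X → Fin q) → Set
  Solution ℬ f = ∀ B → B ∈ ℬ → Satisfies f B

  -- r = ℙ[B] = |B| / q^|dom B|
  IsProbability : .{{ℕ.NonZero q}} → Constraint → ℝ≥0 → Set
  IsProbability B r =
    ∃[ m ] ∃[ n ] HasCardinality Graphs (_∈ᶜ B) m ×
                  HasCardinality (setoid X) (dom B) n ×
                  r ≃ᵣ (m /ᵣ (q ^ n)) {{ℕₚ.m^n≢0 q n}}

  -- p = 𝗉(ℬ), the supremum being taken in [0,∞), so that 𝗉(∅) = 0.
  Is𝗉 : .{{ℕ.NonZero q}} → Pred Constraint 0ℓ → ℝ≥0 → Set₁
  Is𝗉 ℬ = IsSup _≤ᵣ_ (λ r → ∃[ B ] B ∈ ℬ × IsProbability B r)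

  Neighbours : Pred Constraint 0ℓ → Constraint → Pred Constraint 0ℓ
  Neighbours ℬ B B′ = B′ ∈ ℬ × ¬ (B′ ≈ᶜ B) × dom B′ ≬ dom B

  -- d = 𝖽(ℬ), including the assertion that 𝖽(ℬ) is finite.
  Is𝖽 : Pred Constraint 0ℓ → ℕ → Set
  Is𝖽 ℬ d =
    (∀ B → B ∈ ℬ → ∃[ n ] HasCardinality GraphSets (Neighbours ℬ B) n) ×
    IsSup ℕ._≤_
      (λ n → ∃[ B ] B ∈ ℬ × HasCardinality GraphSets (Neighbours ℬ B) n) d

  IsBorelCSP : σ-Algebra (setoid X) → Pred Constraint 0ℓ → Set₁
  IsBorelCSP 𝔅 ℬ = IsCSP ℬ × Measurable (FinSetsσ (FinSetsσ (𝔅 ×σ q))) ℬ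

{-# OPTIONS --safe #-}
-- Let G join two points that lie in a common domain.  If X = X₀ ⊔ X₁ and the
-- G-components of X₀ and of X₁ are finite, the CSP is solved in two stages.  With
-- L = x(1-x)^d for a suitable x, the hypothesis gives P[B] ≤ L².  The first stage
-- colours X₀ so that no constraint keeps a conditional probability above L: by
-- Markov's inequality each of these failures has probability at most L, so the
-- symmetric local lemma applies on every component.  The second stage colours X₁,
-- again by the local lemma.  On each component one takes the first successful
-- colouring from a fixed countable list, which keeps the solution in the σ-algebra
-- generated by the analytic sets; its members have the Baire property, and it is
-- closed under quantification over finite sections.
--
-- A definable X₀ is the union of the rings of a toast whose centres are isolated
-- points of basic open sets.  These basic sets are chosen one after the other so
-- that a comeager set of points are centres infinitely often, and on the orbits of
-- such points the components are finite.  The other orbits form a meager set, on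
-- which measurability is no issue: there X₀ consists of the points at even distance
-- from a root of the orbit, and the components lie in spheres, hence are finite.
module Submission where

open import Defs
open import Axiom.ExcludedMiddle using (ExcludedMiddle)
open import Axiom.Extensionality.Propositional using (Extensionality)
import Algebra.Properties.CommutativeMonoid.Sum as CommutativeMonoidSum
import Algebra.Properties.Semiring.Sum as SemiringSum
open import Algebra.Bundles using (CommutativeRing)
open import Data.Empty using (⊥)
open import Data.Fin.Base as Fin using (Fin; toℕ)
import Data.Fin.Properties as Finₚ
open import Data.Integer.Base as ℤ using (+_)
import Data.Integer.Properties as ℤₚ
open import Data.List.Base as List using (List; []; _∷_; _++_; length)
import Data.List.Properties as Listₚ
open import Data.List.Relation.Unary.All as All using (All; []; _∷_)
import Data.List.Relation.Unary.All.Properties as Allₚ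
open import Data.List.Relation.Unary.AllPairs as AllPairs using (AllPairs; []; _∷_)
import Data.List.Relation.Unary.AllPairs.Properties as AllPairsₚ
open import Data.List.Relation.Unary.Any as Any using (Any; here; there)
import Data.List.Relation.Unary.Any.Properties as Anyₚ
import Data.List.Membership.Setoid as Membership
import Data.List.Relation.Unary.Unique.Setoid as Unique
open import Data.Maybe.Base using (Maybe; just; nothing)
open import Data.Nat.Base as ℕ using (ℕ; zero; suc; NonZero; z≤n; s≤s)
import Data.Nat.Properties as ℕₚ
open import Data.Product.Base using (Σ; Σ-syntax; ∃; ∃-syntax; _×_; _,_; proj₁; proj₂; uncurry)
open import Data.Rational.Base as ℚ using (ℚ; 0ℚ; 1ℚ; ½)
import Data.Rational.Properties as ℚₚ
import Data.Rational.Solver as ℚ-Solver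
import Data.Rational.Unnormalised.Base as ℚᵘ
import Data.Rational.Unnormalised.Properties as ℚᵘₚ
open import Data.Sum.Base as Sum using (_⊎_; inj₁; inj₂)
open import Data.Unit.Base using (⊤; tt)
open import Data.Vec.Base as Vec using (Vec; []; _∷_; lookup; tabulate; toList)
import Data.Vec.Properties as Vecₚ
open import Function.Base using (_∘_; id; case_of_)
open import Function.Bundles using (_⇔_; mk⇔; Equivalence)
open import Level using (0ℓ) renaming (suc to lsuc)
open import Relation.Binary.Bundles using (Setoid)
open import Relation.Binary.Definitions using (tri<; tri≈; tri>; _Respects_)
open import Relation.Binary.PropositionalEquality
  using (_≡_; _≢_; refl; sym; trans; cong; cong₂; subst; setoid; module ≡-Reasoning)
open import Relation.Nullary.Decidable using (yes; no; True; toWitness; fromWitness; decidable-stable)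
open import Relation.Nullary.Negation using (¬_; contradiction)
open import Relation.Unary using (Pred; _∈_; _⊆_; _≐_; _∩_; _∪_; _∖_; ∁; ∅; U; ⋃; _≬_)

-- The square in the hypothesis is the price of two stages. One can choose x with (d+1)L > 1/e, so
-- p(d+1)^2 ≤ e^-2 gives P[B] ≤ L^2: one factor L pays for the first stage, the other is left as
-- conditional probability for the second. Stages on finite pieces are needed because orbits of G
-- may be infinite: there the local lemma solves only finite subproblems, and a choice of limits
-- along the orbits need not be measurable. G quantifies over the remaining variables of a
-- constraint, which range over X, so it appears as a projection and is analytic. This is why the
-- σ-algebra generated by the analytic sets takes the place of the Borel sets. It need not be closed
-- under projections, so later quantifiers are confined to orbits, which are countable unions of
-- finite balls. Category enters the construction of the toast at one point: the points that are no
-- centre from some stage on form a set with the Baire property; were it not meager, it would be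
-- comeager in a nonmeager basic open set, and a later stage that targets this set has nonmeagerly
-- many centres there.

-- Classical logic and indicator functions.

module Classical (em : ∀ {ℓ} → ExcludedMiddle ℓ) where

  dne : ∀ {ℓ} {P : Set ℓ} → ¬ ¬ P → P
  dne = decidable-stable em

  lem : ∀ {ℓ} (P : Set ℓ) → P ⊎ ¬ P
  lem P with em {P = P}
  ... | yes p = inj₁ p
  ... | no ¬p = inj₂ ¬p

  ¬∀⇒∃¬ : ∀ {a ℓ} {A : Set a} {P : A → Set ℓ} → ¬ (∀ x → P x) → ∃[ x ] ¬ P x
  ¬∀⇒∃¬ h = dne λ ne → h λ x → dne λ ¬p → ne (x , ¬p)

  least : ∀ {ℓ} (P : ℕ → Set ℓ) → ∃ P → ∃[ n ] P n × (∀ m → m ℕ.< n → ¬ P m)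
  least {ℓ} P (n , p) = go n P p
    where
    go : ∀ n (P : ℕ → Set ℓ) → P n → ∃[ n ] P n × (∀ m → m ℕ.< n → ¬ P m)
    go n P p with em {P = P 0}
    ... | yes p₀ = 0 , p₀ , λ _ ()
    go zero    P p | no ¬p₀ = contradiction p ¬p₀
    go (suc n) P p | no ¬p₀ =
      let (m , pm , min) = go n (P ∘ suc) p
      in suc m , pm , λ { zero _ → ¬p₀ ; (suc k) (s≤s k<m) → min k k<m }

  𝟙 : ∀ {ℓ} → Set ℓ → ℚ
  𝟙 P with em {P = P}
  ... | yes _ = 1ℚ
  ... | no  _ = 0ℚ

  𝟙-yes : ∀ {ℓ} {P : Set ℓ} → P → 𝟙 P ≡ 1ℚ
  𝟙-yes {P = P} p with em {P = P}
  ... | yes _ = refl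
  ... | no ¬p = contradiction p ¬p

  𝟙-no : ∀ {ℓ} {P : Set ℓ} → ¬ P → 𝟙 P ≡ 0ℚ
  𝟙-no {P = P} ¬p with em {P = P}
  ... | yes p = contradiction p ¬p
  ... | no _  = refl

  0≤𝟙 : ∀ {ℓ} (P : Set ℓ) → 0ℚ ℚ.≤ 𝟙 P
  0≤𝟙 P with em {P = P}
  ... | yes _ = ℚₚ.nonNegative⁻¹ 1ℚ
  ... | no  _ = ℚₚ.≤-refl

  𝟙≤1 : ∀ {ℓ} (P : Set ℓ) → 𝟙 P ℚ.≤ 1ℚ
  𝟙≤1 P with em {P = P}
  ... | yes _ = ℚₚ.≤-refl
  ... | no  _ = ℚₚ.nonNegative⁻¹ 1ℚ

  𝟙-mono : ∀ {ℓ m} {P : Set ℓ} {Q : Set m} → (P → Q) → 𝟙 P ℚ.≤ 𝟙 Q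
  𝟙-mono {P = P} {Q} P⇒Q with em {P = P}
  ... | yes p = ℚₚ.≤-reflexive (sym (𝟙-yes (P⇒Q p)))
  ... | no  _ = 0≤𝟙 Q

  𝟙-cong : ∀ {ℓ m} {P : Set ℓ} {Q : Set m} → (P → Q) → (Q → P) → 𝟙 P ≡ 𝟙 Q
  𝟙-cong f g = ℚₚ.≤-antisym (𝟙-mono f) (𝟙-mono g)

-- Rational arithmetic.

module ℚ-Order where
  open import Data.Rational.Base using (_≤_; _<_; _+_; _*_; _-_)
  open ℚ-Solver.+-*-Solver

  *-monoˡ : ∀ {a b c} → 0ℚ ≤ a → b ≤ c → a * b ≤ a * c
  *-monoˡ {a} 0≤a = ℚₚ.*-monoˡ-≤-nonNeg a {{ℚ.nonNegative 0≤a}}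

  *-monoʳ : ∀ {a b c} → 0ℚ ≤ a → b ≤ c → b * a ≤ c * a
  *-monoʳ {a} 0≤a = ℚₚ.*-monoʳ-≤-nonNeg a {{ℚ.nonNegative 0≤a}}

  *-mono : ∀ {a b c d} → 0ℚ ≤ a → a ≤ b → 0ℚ ≤ c → c ≤ d → a * c ≤ b * d
  *-mono 0≤a a≤b 0≤c c≤d = ℚₚ.≤-trans (*-monoʳ 0≤c a≤b) (*-monoˡ (ℚₚ.≤-trans 0≤a a≤b) c≤d)

  0≤* : ∀ {a b} → 0ℚ ≤ a → 0ℚ ≤ b → 0ℚ ≤ a * b
  0≤* {a} {b} 0≤a 0≤b = subst (_≤ a * b) (ℚₚ.*-zeroʳ a) (*-monoˡ 0≤a 0≤b)

  0<* : ∀ {a b} → 0ℚ < a → 0ℚ < b → 0ℚ < a * b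
  0<* {a} {b} 0<a 0<b =
    ℚₚ.positive⁻¹ (a * b) {{ℚₚ.pos*pos⇒pos a {{ℚ.positive 0<a}} b {{ℚ.positive 0<b}}}}

  0≤1 : 0ℚ ≤ 1ℚ
  0≤1 = ℚₚ.nonNegative⁻¹ 1ℚ

  *-≤-ʳ : ∀ {a b} → 0ℚ ≤ b → a ≤ 1ℚ → a * b ≤ b
  *-≤-ʳ {b = b} 0≤b a≤1 = ℚₚ.≤-trans (*-monoʳ 0≤b a≤1) (ℚₚ.≤-reflexive (ℚₚ.*-identityˡ b))

  *-≤-ˡ : ∀ {a b} → 0ℚ ≤ a → b ≤ 1ℚ → a * b ≤ a
  *-≤-ˡ {a} 0≤a b≤1 = ℚₚ.≤-trans (*-monoˡ 0≤a b≤1) (ℚₚ.≤-reflexive (ℚₚ.*-identityʳ a))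

  p≤q⇒0≤q-p : ∀ {p q} → p ≤ q → 0ℚ ≤ q - p
  p≤q⇒0≤q-p {p} {q} p≤q = subst (_≤ q - p) (ℚₚ.+-inverseʳ p) (ℚₚ.+-monoˡ-≤ (ℚ.- p) p≤q)

  pow : ℚ → ℕ → ℚ
  pow x zero    = 1ℚ
  pow x (suc n) = x * pow x n

  0<pow : ∀ {x} n → 0ℚ < x → 0ℚ < pow x n
  0<pow zero    0<x = ℚₚ.positive⁻¹ 1ℚ
  0<pow (suc n) 0<x = 0<* 0<x (0<pow n 0<x)

  pow-anti : ∀ {x m n} → 0ℚ < x → x ≤ 1ℚ → m ℕ.≤ n → pow x n ≤ pow x m
  pow-anti {n = zero} 0<x x≤1 z≤n = ℚₚ.≤-refl
  pow-anti {n = suc n} 0<x x≤1 z≤n =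
    ℚₚ.≤-trans (*-≤-ʳ (ℚₚ.<⇒≤ (0<pow n 0<x)) x≤1) (pow-anti {n = n} 0<x x≤1 z≤n)
  pow-anti 0<x x≤1 (s≤s m≤n) = *-monoˡ (ℚₚ.<⇒≤ 0<x) (pow-anti 0<x x≤1 m≤n)

  fromℕℚ : ℕ → ℚ
  fromℕℚ n = + n ℚ./ 1

  toℚᵘ-/ : ∀ m n .{{_ : NonZero n}} → ℚ.toℚᵘ (+ m ℚ./ n) ℚᵘ.≃ + m ℚᵘ./ n
  toℚᵘ-/ m (suc n) = ℚₚ.toℚᵘ-fromℚᵘ (+ m ℚᵘ./ suc n)

  fromℕℚ-suc : ∀ n → fromℕℚ (suc n) ≡ 1ℚ + fromℕℚ n
  fromℕℚ-suc n = ℚₚ.toℚᵘ-injective (begin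
    ℚ.toℚᵘ (fromℕℚ (suc n))            ≈⟨ toℚᵘ-/ (suc n) 1 ⟩
    + suc n ℚᵘ./ 1                     ≈⟨ ℚᵘ.*≡* (cong (λ z → (+ 1 ℤ.+ z) ℤ.* + 1) (sym (ℤₚ.*-identityʳ (+ n)))) ⟩
    ℚᵘ.1ℚᵘ ℚᵘ.+ (+ n ℚᵘ./ 1)           ≈⟨ ℚᵘₚ.+-congʳ ℚᵘ.1ℚᵘ (ℚᵘₚ.≃-sym (toℚᵘ-/ n 1)) ⟩
    ℚ.toℚᵘ 1ℚ ℚᵘ.+ ℚ.toℚᵘ (fromℕℚ n)   ≈⟨ ℚₚ.toℚᵘ-homo-+ 1ℚ (fromℕℚ n) ⟨
    ℚ.toℚᵘ (1ℚ + fromℕℚ n)             ∎)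
    where open ℚᵘₚ.≃-Reasoning

  m/n≡m*1/n : ∀ m n .{{_ : NonZero n}} → + m ℚ./ n ≡ fromℕℚ m * (+ 1 ℚ./ n)
  m/n≡m*1/n m n@(suc k) = ℚₚ.toℚᵘ-injective (begin
    ℚ.toℚᵘ (+ m ℚ./ n)                         ≈⟨ toℚᵘ-/ m n ⟩
    + m ℚᵘ./ n                                 ≈⟨ ℚᵘ.*≡* (cong₂ ℤ._*_ (sym (ℤₚ.*-identityʳ (+ m))) (cong (λ k → + suc k) (ℕₚ.+-identityʳ k))) ⟩
    (+ m ℚᵘ./ 1) ℚᵘ.* (+ 1 ℚᵘ./ n)             ≈⟨ ℚᵘₚ.*-cong (toℚᵘ-/ m 1) (toℚᵘ-/ 1 n) ⟨
    ℚ.toℚᵘ (fromℕℚ m) ℚᵘ.* ℚ.toℚᵘ (+ 1 ℚ./ n)  ≈⟨ ℚₚ.toℚᵘ-homo-* (fromℕℚ m) (+ 1 ℚ./ n) ⟨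
    ℚ.toℚᵘ (fromℕℚ m * (+ 1 ℚ./ n))            ∎)
    where open ℚᵘₚ.≃-Reasoning

  n/n≡1 : ∀ n .{{_ : NonZero n}} → + n ℚ./ n ≡ 1ℚ
  n/n≡1 n@(suc k) = ℚₚ.toℚᵘ-injective (begin
    ℚ.toℚᵘ (+ n ℚ./ n)  ≈⟨ toℚᵘ-/ n n ⟩
    + n ℚᵘ./ n          ≈⟨ ℚᵘ.*≡* (ℤₚ.*-comm (+ n) (+ 1)) ⟩
    ℚᵘ.1ℚᵘ              ∎)
    where open ℚᵘₚ.≃-Reasoning

  1/n*n≡1 : ∀ n .{{_ : NonZero n}} → (+ 1 ℚ./ n) * fromℕℚ n ≡ 1ℚ
  1/n*n≡1 n = trans (ℚₚ.*-comm _ (fromℕℚ n)) (trans (sym (m/n≡m*1/n n n)) (n/n≡1 n))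

-- Expectations over random colours of finitely many points.

module Averaging (em : ∀ {ℓ} → ExcludedMiddle ℓ) (ext : ∀ {a b} → Extensionality a b)
                 (V : Set) (q : ℕ) .{{_ : NonZero q}} where
  open Classical em
  open ℚ-Order
  open import Data.Rational.Base using (_≤_; _<_; _+_; _*_)
  open CommutativeMonoidSum ℚₚ.+-0-commutativeMonoid using (sum; ∑-distrib-+; ∑-comm; sum-cong-≗)
  open SemiringSum (CommutativeRing.semiring ℚₚ.+-*-commutativeRing) using (*-distribˡ-sum)
  open import Data.List.Membership.Propositional renaming (_∈_ to _∈ₗ_)

  Colouring : Set
  Colouring = V → Fin q

  weight : ℚ
  weight = + 1 ℚ./ q

  0<weight : 0ℚ < weight
  0<weight = ℚₚ.positive⁻¹ weight {{ℚₚ.normalize-pos 1 q}}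

  avg : (Fin q → ℚ) → ℚ
  avg h = weight * sum h

  sum-mono : ∀ {n} {h k : Fin n → ℚ} → (∀ i → h i ≤ k i) → sum h ≤ sum k
  sum-mono {zero}  h≤k = ℚₚ.≤-refl
  sum-mono {suc n} h≤k = ℚₚ.+-mono-≤ (h≤k Fin.zero) (sum-mono (h≤k ∘ Fin.suc))

  sum-const : ∀ n c → sum {n} (λ _ → c) ≡ fromℕℚ n * c
  sum-const zero    c = sym (ℚₚ.*-zeroˡ c)
  sum-const (suc n) c = begin
    c + sum {n} (λ _ → c)     ≡⟨ cong₂ _+_ (sym (ℚₚ.*-identityˡ c)) (sum-const n c) ⟩
    1ℚ * c + fromℕℚ n * c     ≡⟨ ℚₚ.*-distribʳ-+ c 1ℚ (fromℕℚ n) ⟨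
    (1ℚ + fromℕℚ n) * c       ≡⟨ cong (_* c) (fromℕℚ-suc n) ⟨
    fromℕℚ (suc n) * c        ∎
    where open ≡-Reasoning

  sum-𝟙≡ : ∀ {n} (c : Fin n) → sum (λ i → 𝟙 (i ≡ c)) ≡ 1ℚ
  sum-𝟙≡ {suc n} Fin.zero = begin
    𝟙 (Fin.zero {n} ≡ Fin.zero) + sum {n} (λ i → 𝟙 (Fin.suc i ≡ Fin.zero))
      ≡⟨ cong₂ _+_ (𝟙-yes refl) (trans (sum-cong-≗ {n} λ i → 𝟙-no {P = Fin.suc i ≡ Fin.zero} λ ()) (trans (sum-const n 0ℚ) (ℚₚ.*-zeroʳ (fromℕℚ n)))) ⟩
    1ℚ + 0ℚ ≡⟨ ℚₚ.+-identityʳ 1ℚ ⟩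
    1ℚ ∎
    where open ≡-Reasoning
  sum-𝟙≡ {suc n} (Fin.suc c) = begin
    𝟙 (Fin.zero ≡ Fin.suc c) + sum {n} (λ i → 𝟙 (Fin.suc i ≡ Fin.suc c))
      ≡⟨ cong₂ _+_ (𝟙-no λ ()) (sum-cong-≗ {n} λ i → 𝟙-cong Finₚ.suc-injective (cong Fin.suc)) ⟩
    0ℚ + sum {n} (λ i → 𝟙 (i ≡ c)) ≡⟨ ℚₚ.+-identityˡ _ ⟩
    sum {n} (λ i → 𝟙 (i ≡ c)) ≡⟨ sum-𝟙≡ c ⟩
    1ℚ ∎
    where open ≡-Reasoning

  avg-cong : ∀ {h k} → (∀ i → h i ≡ k i) → avg h ≡ avg k
  avg-cong h≡k = cong (weight *_) (sum-cong-≗ {q} h≡k)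

  avg-mono : ∀ {h k} → (∀ i → h i ≤ k i) → avg h ≤ avg k
  avg-mono h≤k = *-monoˡ (ℚₚ.<⇒≤ 0<weight) (sum-mono h≤k)

  avg-const : ∀ c → avg (λ _ → c) ≡ c
  avg-const c = begin
    weight * sum {q} (λ _ → c)  ≡⟨ cong (weight *_) (sum-const q c) ⟩
    weight * (fromℕℚ q * c)     ≡⟨ ℚₚ.*-assoc weight (fromℕℚ q) c ⟨
    weight * fromℕℚ q * c       ≡⟨ cong (_* c) (1/n*n≡1 q) ⟩
    1ℚ * c                      ≡⟨ ℚₚ.*-identityˡ c ⟩
    c                           ∎
    where open ≡-Reasoning

  avg-+ : ∀ h k → avg (λ i → h i + k i) ≡ avg h + avg k
  avg-+ h k = trans (cong (weight *_) (∑-distrib-+ h k)) (ℚₚ.*-distribˡ-+ weight _ _)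

  avg-* : ∀ c h → avg (λ i → c * h i) ≡ c * avg h
  avg-* c h = begin
    weight * sum (λ i → c * h i)  ≡⟨ cong (weight *_) (*-distribˡ-sum c h) ⟨
    weight * (c * sum h)          ≡⟨ solve 3 (λ w c s → w :* (c :* s) := c :* (w :* s)) refl weight c (sum h) ⟩
    c * (weight * sum h)          ∎
    where open ≡-Reasoning
          open ℚ-Solver.+-*-Solver

  avg-swap : ∀ (h : Fin q → Fin q → ℚ) → avg (λ i → avg (h i)) ≡ avg (λ j → avg (λ i → h i j))
  avg-swap h = cong (weight *_) (begin
    sum (λ i → weight * sum (h i))          ≡⟨ *-distribˡ-sum weight (λ i → sum (h i)) ⟨
    weight * sum (λ i → sum (h i))          ≡⟨ cong (weight *_) (∑-comm h) ⟩
    weight * sum (λ j → sum (λ i → h i j))  ≡⟨ *-distribˡ-sum weight (λ j → sum (λ i → h i j)) ⟩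
    sum (λ j → weight * sum (λ i → h i j))  ∎)
    where open ≡-Reasoning

  avg-𝟙≡ : ∀ c → avg (λ i → 𝟙 (i ≡ c)) ≡ weight
  avg-𝟙≡ c = trans (cong (weight *_) (sum-𝟙≡ c)) (ℚₚ.*-identityʳ weight)

  update : Colouring → V → Fin q → Colouring
  update f x i y with em {P = y ≡ x}
  ... | yes _ = i
  ... | no  _ = f y

  update-≡ : ∀ f x i → update f x i x ≡ i
  update-≡ f x i with em {P = x ≡ x}
  ... | yes _  = refl
  ... | no x≢x = contradiction refl x≢x

  update-≢ : ∀ f {x y} i → y ≢ x → update f x i y ≡ f y
  update-≢ f {x} {y} i y≢x with em {P = y ≡ x}
  ... | yes y≡x = contradiction y≡x y≢x
  ... | no _    = refl

  update-update : ∀ f x i j → update (update f x i) x j ≡ update f x j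
  update-update f x i j = ext go
    where
    go : ∀ y → update (update f x i) x j y ≡ update f x j y
    go y with em {P = y ≡ x}
    ... | yes _  = refl
    ... | no y≢x = update-≢ f i y≢x

  update-comm : ∀ f {x y} i j → x ≢ y → update (update f x i) y j ≡ update (update f y j) x i
  update-comm f {x} {y} i j x≢y = ext go
    where
    go : ∀ z → update (update f x i) y j z ≡ update (update f y j) x i z
    go z with em {P = z ≡ y}
    ... | yes refl = sym (trans (update-≢ _ i (x≢y ∘ sym)) (update-≡ f y j))
    ... | no z≢y with em {P = z ≡ x}
    ...   | yes _ = refl
    ...   | no  _ = sym (update-≢ f j z≢y)

  -- The expectation of `g` when the points of `xs` receive independent uniform colours and all
  -- others keep those of `f`; it thus doubles as a conditional expectation. Repetitions in `xs` do
  -- no harm, since the later update overwrites the earlier one.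
  E : List V → (Colouring → ℚ) → Colouring → ℚ
  E []       g f = g f
  E (x ∷ xs) g f = avg λ i → E xs g (update f x i)

  E-cong : ∀ xs {g h} → (∀ f → g f ≡ h f) → ∀ f → E xs g f ≡ E xs h f
  E-cong []       g≡h f = g≡h f
  E-cong (x ∷ xs) g≡h f = avg-cong λ i → E-cong xs g≡h (update f x i)

  E-mono : ∀ xs {g h} → (∀ f → g f ≤ h f) → ∀ f → E xs g f ≤ E xs h f
  E-mono []       g≤h f = g≤h f
  E-mono (x ∷ xs) g≤h f = avg-mono λ i → E-mono xs g≤h (update f x i)

  E-const : ∀ xs c f → E xs (λ _ → c) f ≡ c
  E-const []       c f = refl
  E-const (x ∷ xs) c f = trans (avg-cong λ i → E-const xs c (update f x i)) (avg-const c)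

  E-+ : ∀ xs g h f → E xs (λ f → g f + h f) f ≡ E xs g f + E xs h f
  E-+ []       g h f = refl
  E-+ (x ∷ xs) g h f = trans (avg-cong λ i → E-+ xs g h (update f x i)) (avg-+ _ _)

  E-* : ∀ xs c g f → E xs (λ f → c * g f) f ≡ c * E xs g f
  E-* []       c g f = refl
  E-* (x ∷ xs) c g f = trans (avg-cong λ i → E-* xs c g (update f x i)) (avg-* c _)

  E-++ : ∀ xs ys g f → E (xs ++ ys) g f ≡ E xs (E ys g) f
  E-++ []       ys g f = refl
  E-++ (x ∷ xs) ys g f = avg-cong λ i → E-++ xs ys g (update f x i)

  Ind : ∀ {a} {A : Set a} → V → (Colouring → A) → Set a
  Ind x g = ∀ f i → g (update f x i) ≡ g f

  E-Ind : ∀ {x} xs {g} → Ind x g → Ind x (E xs g)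
  E-Ind     []       ind f i = ind f i
  E-Ind {x} (y ∷ ys) {g} ind f i with em {P = x ≡ y}
  ... | yes refl = avg-cong λ j → cong (E ys g) (update-update f x i j)
  ... | no x≢y   = avg-cong λ j → trans (cong (E ys g) (update-comm f i j x≢y))
                                        (E-Ind ys ind (update f y j) i)

  E-Ind-∈ : ∀ {x xs} g → x ∈ₗ xs → Ind x (E xs g)
  E-Ind-∈ {x} {y ∷ ys} g x∈ f i with em {P = x ≡ y}
  ... | yes refl = avg-cong λ j → cong (E ys g) (update-update f x i j)
  E-Ind-∈ {x} {y ∷ ys} g (here x≡y)   f i | no x≢y = contradiction x≡y x≢y
  E-Ind-∈ {x} {y ∷ ys} g (there x∈ys) f i | no x≢y =
    avg-cong λ j → trans (cong (E ys g) (update-comm f i j x≢y))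
                         (E-Ind-∈ g x∈ys (update f y j) i)

  E-Ind-all : ∀ xs {g} → (∀ x → x ∈ₗ xs → Ind x g) → ∀ f → E xs g f ≡ g f
  E-Ind-all []       ind f = refl
  E-Ind-all (x ∷ xs) {g} ind f =
    trans (avg-cong λ i → trans (E-Ind-all xs (λ y → ind y ∘ there) (update f x i)) (ind x (here refl) f i))
          (avg-const (g f))

  -- Fubini. If a point occurs in both lists, only the inner of its two updates survives in either
  -- order, and the outer average is that of a constant.
  E-comm : ∀ xs ys g f → E xs (E ys g) f ≡ E ys (E xs g) f
  E-comm []       ys g f = refl
  E-comm (x ∷ xs) ys g f = trans (avg-cong λ i → E-comm xs ys g (update f x i)) (pull x ys (E xs g) f)
    where
    pull : ∀ x ys g f → avg (λ i → E ys g (update f x i)) ≡ E ys (λ f → avg λ i → g (update f x i)) f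
    pull x []       g f = refl
    pull x (y ∷ ys) g f with em {P = x ≡ y}
    ... | yes refl = trans
          (trans (avg-cong λ i → avg-cong λ j → cong (E ys g) (update-update f x i j)) (avg-const _))
          (sym (trans (avg-cong λ j → trans (sym (pull x ys g (update f x j)))
                                            (avg-cong λ i → cong (E ys g) (update-update f x j i)))
                      (avg-const _)))
    ... | no x≢y = trans (avg-swap λ i j → E ys g (update (update f x i) y j))
          (avg-cong λ j → trans (avg-cong λ i → cong (E ys g) (update-comm f i j x≢y))
                                (pull x ys g (update f y j)))

  -- Independence: no coordinate of `xs` influences both factors, so in each average one of them is
  -- constant and comes out.
  E-mult : ∀ xs g h → (∀ x → x ∈ₗ xs → Ind x g ⊎ Ind x h) →
           ∀ f → E xs (λ f → g f * h f) f ≡ E xs g f * E xs h f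
  E-mult []       g h ind f = refl
  E-mult (x ∷ xs) g h ind f = trans (avg-cong λ i → E-mult xs g h (λ y → ind y ∘ there) (update f x i)) step
    where
    pullˡ : ∀ g h → Ind x g → avg (λ i → E xs g (update f x i) * E xs h (update f x i))
                            ≡ avg (λ i → E xs g (update f x i)) * avg (λ i → E xs h (update f x i))
    pullˡ g h indᵍ = trans
      (trans (avg-cong λ i → cong (_* E xs h (update f x i)) (E-Ind xs indᵍ f i)) (avg-* (E xs g f) _))
      (cong (_* avg _) (sym (trans (avg-cong (E-Ind xs indᵍ f)) (avg-const _))))
    step : avg (λ i → E xs g (update f x i) * E xs h (update f x i))
         ≡ avg (λ i → E xs g (update f x i)) * avg (λ i → E xs h (update f x i))
    step with ind x (here refl)
    ... | inj₁ indᵍ = pullˡ g h indᵍ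
    ... | inj₂ indʰ = trans (avg-cong λ i → ℚₚ.*-comm (E xs g (update f x i)) _)
                            (trans (pullˡ h g indʰ) (ℚₚ.*-comm (avg λ i → E xs h (update f x i)) _))

  -- `E ys` does nothing to `E xs g`, whose coordinates in `ys` are averaged out already; after the
  -- exchange, `E xs` does nothing to `E ys g`. Expectations therefore depend on the relevant
  -- coordinates and not on the list that presents them.
  E-absorb : ∀ {xs ys g} → (∀ x → x ∈ₗ ys → x ∈ₗ xs) → (∀ x → x ∈ₗ xs → x ∈ₗ ys ⊎ Ind x g) →
             ∀ f → E xs g f ≡ E ys g f
  E-absorb {xs} {ys} {g} ys⊆xs cover f = begin
    E xs g f         ≡⟨ E-Ind-all ys (λ x x∈ys → E-Ind-∈ g (ys⊆xs x x∈ys)) f ⟨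
    E ys (E xs g) f  ≡⟨ E-comm ys xs g f ⟩
    E xs (E ys g) f  ≡⟨ E-Ind-all xs (λ x x∈xs → Sum.[ E-Ind-∈ g , E-Ind ys ]′ (cover x x∈xs)) f ⟩
    E ys g f         ∎
    where open ≡-Reasoning

  E>0⇒∃>0 : ∀ xs g f → 0ℚ < E xs g f → ∃[ f′ ] 0ℚ < g f′
  E>0⇒∃>0 xs g f 0<E = dne λ none →
    ℚₚ.<-irrefl refl (ℚₚ.<-≤-trans 0<E (ℚₚ.≤-trans
      (E-mono xs (λ f′ → ℚₚ.≮⇒≥ λ 0<g → none (f′ , 0<g)) f)
      (ℚₚ.≤-reflexive (E-const xs 0ℚ f))))

  cylinder : List V → Colouring → Colouring → ℚ
  cylinder []       w f = 1ℚ
  cylinder (x ∷ xs) w f = 𝟙 (f x ≡ w x) * cylinder xs w f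

  cylinder-Ind : ∀ {y} xs w → All (y ≢_) xs → Ind y (cylinder xs w)
  cylinder-Ind []       w []          f i = refl
  cylinder-Ind (x ∷ xs) w (y≢x ∷ y∉xs) f i =
    cong₂ _*_ (cong (λ j → 𝟙 (j ≡ w x)) (update-≢ f i (y≢x ∘ sym))) (cylinder-Ind xs w y∉xs f i)

  0≤cylinder : ∀ xs w f → 0ℚ ≤ cylinder xs w f
  0≤cylinder []       w f = 0≤1
  0≤cylinder (x ∷ xs) w f = 0≤* (0≤𝟙 (f x ≡ w x)) (0≤cylinder xs w f)

  cylinder-yes : ∀ xs w f → All (λ x → f x ≡ w x) xs → cylinder xs w f ≡ 1ℚ
  cylinder-yes []       w f []       = refl
  cylinder-yes (x ∷ xs) w f (e ∷ es) =
    trans (cong₂ _*_ (𝟙-yes e) (cylinder-yes xs w f es)) (ℚₚ.*-identityˡ 1ℚ)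

  -- Each coordinate splits off as an independent factor of probability 1/q. A repeated point would
  -- be counted twice, hence the distinctness of `xs`.
  E-cylinder : ∀ {zs} xs w → AllPairs _≢_ xs → All (_∈ₗ zs) xs →
               ∀ f → E zs (cylinder xs w) f ≡ pow weight (length xs)
  E-cylinder {zs} []       w _ _ f = E-const zs 1ℚ f
  E-cylinder {zs} (x ∷ xs) w (x∉xs ∷ uniq) (x∈zs ∷ xs⊆zs) f =
    trans (E-mult zs point (cylinder xs w) independent f)
          (cong₂ _*_ single (E-cylinder xs w uniq xs⊆zs f))
    where
    point : Colouring → ℚ
    point f = 𝟙 (f x ≡ w x)
    point-Ind : ∀ {y} → x ≢ y → Ind y point
    point-Ind x≢y f i = cong (λ j → 𝟙 (j ≡ w x)) (update-≢ f i x≢y)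
    independent : ∀ y → y ∈ₗ zs → Ind y point ⊎ Ind y (cylinder xs w)
    independent y _ with lem (x ≡ y)
    ... | inj₁ refl = inj₂ (cylinder-Ind xs w x∉xs)
    ... | inj₂ x≢y = inj₁ (point-Ind x≢y)
    cover : ∀ y → y ∈ₗ zs → y ∈ₗ (x ∷ []) ⊎ Ind y point
    cover y _ with lem (x ≡ y)
    ... | inj₁ refl = inj₁ (here refl)
    ... | inj₂ x≢y = inj₂ (point-Ind x≢y)
    single : E zs point f ≡ weight
    single = begin
      E zs point f                            ≡⟨ E-absorb {zs} {x ∷ []} {point} (λ { _ (here refl) → x∈zs }) cover f ⟩
      avg (λ i → 𝟙 (update f x i x ≡ w x))    ≡⟨ avg-cong (λ i → cong (λ j → 𝟙 (j ≡ w x)) (update-≡ f x i)) ⟩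
      avg (λ i → 𝟙 (i ≡ w x))                 ≡⟨ avg-𝟙≡ (w x) ⟩
      weight                                  ∎
      where open ≡-Reasoning

  -- For a constraint B the numbers of cylinders and of fixed points will be |B| and |dom(B)|, so
  -- that the bound becomes P[B].
  E-union-bound : ∀ {zs xs} (P : Colouring → Set) ws → AllPairs _≢_ xs → All (_∈ₗ zs) xs →
                  (∀ f → P f → Any (λ w → All (λ x → f x ≡ w x) xs) ws) →
                  ∀ f → E zs (𝟙 ∘ P) f ≤ fromℕℚ (length ws) * pow weight (length xs)
  E-union-bound {zs} {xs} P ws uniq xs⊆zs cover f = ℚₚ.≤-trans (E-mono zs (λ f → bound f ws (cover f)) f) (total ws)
    where
    cylinders : List Colouring → Colouring → ℚ
    cylinders []       f = 0ℚ
    cylinders (w ∷ ws) f = cylinder xs w f + cylinders ws f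
    0≤cylinders : ∀ ws f → 0ℚ ≤ cylinders ws f
    0≤cylinders []       f = ℚₚ.≤-refl
    0≤cylinders (w ∷ ws) f = ℚₚ.+-mono-≤ (0≤cylinder xs w f) (0≤cylinders ws f)
    covered : ∀ f ws → Any (λ w → All (λ x → f x ≡ w x) xs) ws → 1ℚ ≤ cylinders ws f
    covered f (w ∷ ws) (here e)  = ℚₚ.+-mono-≤ (ℚₚ.≤-reflexive (sym (cylinder-yes xs w f e))) (0≤cylinders ws f)
    covered f (w ∷ ws) (there a) = ℚₚ.+-mono-≤ (0≤cylinder xs w f) (covered f ws a)
    bound : ∀ f ws → (P f → Any (λ w → All (λ x → f x ≡ w x) xs) ws) → 𝟙 (P f) ≤ cylinders ws f
    bound f ws c with em {P = P f}
    ... | yes p = covered f ws (c p)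
    ... | no  _ = 0≤cylinders ws f
    ρ : ℚ
    ρ = pow weight (length xs)
    total : ∀ ws → E zs (cylinders ws) f ≤ fromℕℚ (length ws) * ρ
    total []       = ℚₚ.≤-reflexive (trans (E-const zs 0ℚ f) (sym (ℚₚ.*-zeroˡ ρ)))
    total (w ∷ ws) = begin
      E zs (λ f → cylinder xs w f + cylinders ws f) f  ≡⟨ E-+ zs (cylinder xs w) (cylinders ws) f ⟩
      E zs (cylinder xs w) f + E zs (cylinders ws) f   ≤⟨ ℚₚ.+-mono-≤ (ℚₚ.≤-reflexive (E-cylinder xs w uniq xs⊆zs f)) (total ws) ⟩
      ρ + fromℕℚ (length ws) * ρ                       ≡⟨ cong (_+ fromℕℚ (length ws) * ρ) (ℚₚ.*-identityˡ ρ) ⟨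
      1ℚ * ρ + fromℕℚ (length ws) * ρ                  ≡⟨ ℚₚ.*-distribʳ-+ ρ 1ℚ (fromℕℚ (length ws)) ⟨
      (1ℚ + fromℕℚ (length ws)) * ρ                    ≡⟨ cong (_* ρ) (fromℕℚ-suc (length ws)) ⟨
      fromℕℚ (suc (length ws)) * ρ                     ∎
      where open ℚₚ.≤-Reasoning


-- The symmetric local lemma.

module LocalLemma (em : ∀ {ℓ} → ExcludedMiddle ℓ) (ext : ∀ {a b} → Extensionality a b)
                  (V : Set) (q : ℕ) .{{_ : NonZero q}} where
  open Classical em
  open ℚ-Order
  open Averaging em ext V q
  open import Data.Rational.Base using (_≤_; _<_; _+_; _*_; _-_)
  open import Data.List.Membership.Propositional renaming (_∈_ to _∈ₗ_)

  -- Scopes may extend beyond K; only their traces on K create dependencies.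
  record Family (K : List V) (x : ℚ) (d : ℕ) : Set₁ where
    field
      Index    : Set
      -- Several indices may stand for one event; degrees are counted over pairwise unrelated
      -- indices.
      _~_      : Index → Index → Set
      ~-sym    : ∀ {i j} → i ~ j → j ~ i
      Scope    : Index → V → Set
      Event    : Index → Colouring → Set
      event-Ind : ∀ i v → v ∈ₗ K → ¬ Scope i v → ∀ f c →
                  (Event i (update f v c) → Event i f) × (Event i f → Event i (update f v c))
    Adjacent : Index → Index → Set
    Adjacent i j = ∃[ v ] v ∈ₗ K × Scope i v × Scope j v
    _≁_ : Index → Index → Set
    i ≁ j = ¬ i ~ j
    field
      degree   : ∀ i js → AllPairs _≁_ (i ∷ js) → All (Adjacent i) js → length js ℕ.≤ d
      small    : ∀ i f → E K (𝟙 ∘ Event i) f ≤ x * pow (1ℚ - x) d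

  module _ {K : List V} {x : ℚ} {d : ℕ} (𝓕 : Family K x d)
           (0<x : 0ℚ < x) (x<1 : x < 1ℚ) (f₀ : Colouring) where
    open Family 𝓕

    private
      y : ℚ
      y = 1ℚ - x
      0<y : 0ℚ < y
      0<y = subst (_< y) (ℚₚ.+-inverseʳ x) (ℚₚ.+-monoˡ-< (ℚ.- x) x<1)
      y≤1 : y ≤ 1ℚ
      y≤1 = subst (y ≤_) (ℚₚ.+-identityʳ 1ℚ) (ℚₚ.+-monoʳ-≤ 1ℚ (ℚₚ.neg-antimono-≤ (ℚₚ.<⇒≤ 0<x)))

      μ : (Colouring → ℚ) → ℚ
      μ g = E K g f₀

      occ : Index → Colouring → ℚ
      occ i = 𝟙 ∘ Event i

    avoid : List Index → Colouring → ℚ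
    avoid []       f = 1ℚ
    avoid (j ∷ js) f = (1ℚ - occ j f) * avoid js f

    private
      0≤1-occ : ∀ j f → 0ℚ ≤ 1ℚ - occ j f
      0≤1-occ j f = p≤q⇒0≤q-p (𝟙≤1 (Event j f))

      1-occ≤1 : ∀ j f → 1ℚ - occ j f ≤ 1ℚ
      1-occ≤1 j f = subst (1ℚ - occ j f ≤_) (ℚₚ.+-identityʳ 1ℚ)
        (ℚₚ.+-monoʳ-≤ 1ℚ (ℚₚ.neg-antimono-≤ (0≤𝟙 (Event j f))))

      0≤avoid : ∀ js f → 0ℚ ≤ avoid js f
      0≤avoid []       f = 0≤1
      0≤avoid (j ∷ js) f = 0≤* (0≤1-occ j f) (0≤avoid js f)

      0≤μ-avoid : ∀ js → 0ℚ ≤ μ (avoid js)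
      0≤μ-avoid js = subst (_≤ μ (avoid js)) (E-const K 0ℚ f₀) (E-mono K (0≤avoid js) f₀)

      avoid-++-≤ : ∀ is js f → avoid (is ++ js) f ≤ avoid js f
      avoid-++-≤ []       js f = ℚₚ.≤-refl
      avoid-++-≤ (i ∷ is) js f =
        ℚₚ.≤-trans (*-≤-ʳ (0≤avoid (is ++ js) f) (1-occ≤1 i f)) (avoid-++-≤ is js f)

      occ-Ind : ∀ {i v} → v ∈ₗ K → ¬ Scope i v → Ind v (occ i)
      occ-Ind {i} {v} v∈K ¬s f c = uncurry 𝟙-cong (event-Ind i v v∈K ¬s f c)

      avoid-Ind : ∀ {v} js → v ∈ₗ K → All (λ j → ¬ Scope j v) js → Ind v (avoid js)
      avoid-Ind []       v∈K []         f c = refl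
      avoid-Ind (j ∷ js) v∈K (¬s ∷ ¬ss) f c =
        cong₂ (λ a b → (1ℚ - a) * b) (occ-Ind v∈K ¬s f c) (avoid-Ind js v∈K ¬ss f c)

    -- The events dependent on `i` come first because `chain` strips a list from the front. `from`
    -- carries a property of all members of `js` to both parts; this is how pairwise inequivalence
    -- survives the recursion.
    record Split (i : Index) (js : List Index) : Set₁ where
      field
        near far  : List Index
        near-adj  : All (Adjacent i) near
        far-adj   : All (λ j → ¬ Adjacent i j) far
        pairs-near : AllPairs _≁_ near
        pairs-far  : AllPairs _≁_ far
        cross     : All (λ a → All (a ≁_) far) near
        from      : ∀ {Q : Index → Set} → All Q js → All Q near × All Q far
        size      : length (near ++ far) ≡ length js
        avoid-≡   : ∀ f → avoid js f ≡ avoid (near ++ far) f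

    split : ∀ i js → AllPairs _≁_ js → Split i js
    split i [] [] = record
      { near = [] ; far = [] ; near-adj = [] ; far-adj = [] ; pairs-near = [] ; pairs-far = []
      ; cross = [] ; from = λ _ → [] , [] ; size = refl ; avoid-≡ = λ _ → refl }
    split i (j ∷ js) (j≁js ∷ pairs) with em {P = Adjacent i j}
    ... | yes adj = record
      { near = j ∷ near ; far = far ; near-adj = adj ∷ near-adj ; far-adj = far-adj
      ; pairs-near = proj₁ (from j≁js) ∷ pairs-near ; pairs-far = pairs-far
      ; cross = proj₂ (from j≁js) ∷ cross
      ; from = λ { (q ∷ qs) → q ∷ proj₁ (from qs) , proj₂ (from qs) }
      ; size = cong suc size ; avoid-≡ = λ f → cong ((1ℚ - occ j f) *_) (avoid-≡ f) }
      where open Split (split i js pairs)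
    ... | no ¬adj = record
      { near = near ; far = j ∷ far ; near-adj = near-adj ; far-adj = ¬adj ∷ far-adj
      ; pairs-near = pairs-near ; pairs-far = proj₂ (from j≁js) ∷ pairs-far
      ; cross = All.zipWith (λ { (j≁a , as) → (j≁a ∘ ~-sym) ∷ as }) (proj₁ (from j≁js) , cross)
      ; from = λ { (q ∷ qs) → proj₁ (from qs) , q ∷ proj₂ (from qs) }
      ; size = trans (length-insert near far) (cong suc size)
      ; avoid-≡ = λ f → trans (cong ((1ℚ - occ j f) *_) (avoid-≡ f)) (avoid-insert near far f) }
      where
      open Split (split i js pairs)
      length-insert : ∀ (as bs : List Index) → length (as ++ j ∷ bs) ≡ suc (length (as ++ bs))
      length-insert []       bs = refl
      length-insert (a ∷ as) bs = cong suc (length-insert as bs)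
      avoid-insert : ∀ as bs f → (1ℚ - occ j f) * avoid (as ++ bs) f ≡ avoid (as ++ j ∷ bs) f
      avoid-insert []       bs f = refl
      avoid-insert (a ∷ as) bs f = trans
        (solve 3 (λ p r s → p :* (r :* s) := r :* (p :* s)) refl (1ℚ - occ j f) (1ℚ - occ a f) (avoid (as ++ bs) f))
        (cong ((1ℚ - occ a f) *_) (avoid-insert as bs f))
        where open ℚ-Solver.+-*-Solver

    -- The conditional probability of `i`, given that `js` is avoided, is at most `x`. It is
    -- multiplied out because the condition is not yet known to have positive probability.
    Conditional : ℕ → Set
    Conditional n = ∀ i js → length js ℕ.≤ n → AllPairs _≁_ (i ∷ js) →
                    μ (λ f → occ i f * avoid js f) ≤ x * μ (avoid js)

    -- By the induction hypothesis, avoiding one more event removes at most the share `x` of the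
    -- mass, so each member of `as` costs at most a factor `y`. The list may be longer by one than
    -- the hypothesis allows, since its head is split off first.
    chain : ∀ n → Conditional n → ∀ as bs → length (as ++ bs) ℕ.≤ suc n → AllPairs _≁_ (as ++ bs) →
            pow y (length as) * μ (avoid bs) ≤ μ (avoid (as ++ bs))
    chain n ih []       bs len pairs = ℚₚ.≤-reflexive (ℚₚ.*-identityˡ _)
    chain n ih (a ∷ as) bs (s≤s len) (a≁ ∷ pairs) = begin
      y * pow y (length as) * μ (avoid bs)                   ≡⟨ ℚₚ.*-assoc y _ _ ⟩
      y * (pow y (length as) * μ (avoid bs))                 ≤⟨ *-monoˡ (ℚₚ.<⇒≤ 0<y) (chain n ih as bs (ℕₚ.m≤n⇒m≤1+n len) pairs) ⟩
      y * M                                                  ≡⟨ solve 2 (λ x M → (con 1ℚ :- x) :* M := M :+ con (ℚ.- 1ℚ) :* (x :* M)) refl x M ⟩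
      M + (ℚ.- 1ℚ) * (x * M)                                 ≤⟨ ℚₚ.+-monoʳ-≤ M (ℚₚ.*-monoˡ-≤-nonPos (ℚ.- 1ℚ) (ih a (as ++ bs) len (a≁ ∷ pairs))) ⟩
      M + (ℚ.- 1ℚ) * μ (λ f → occ a f * avoid (as ++ bs) f)  ≡⟨ cong (λ z → M + z) (E-* K (ℚ.- 1ℚ) _ f₀) ⟨
      M + μ (λ f → (ℚ.- 1ℚ) * (occ a f * avoid (as ++ bs) f)) ≡⟨ E-+ K _ _ f₀ ⟨
      μ (λ f → avoid (as ++ bs) f + (ℚ.- 1ℚ) * (occ a f * avoid (as ++ bs) f))
        ≡⟨ E-cong K (λ f → solve 2 (λ o m → m :+ con (ℚ.- 1ℚ) :* (o :* m) := (con 1ℚ :- o) :* m) refl (occ a f) (avoid (as ++ bs) f)) f₀ ⟩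
      μ (avoid (a ∷ as ++ bs))                               ∎
      where
      open ℚₚ.≤-Reasoning
      open ℚ-Solver.+-*-Solver
      M : ℚ
      M = μ (avoid (as ++ bs))

    -- Forgetting the near events enlarges the left side, which then factors by independence from
    -- the far ones. On the right, restoring the near events costs at most `pow y d` by `chain`, and
    -- `small` contains exactly this factor.
    conditional : ∀ n → Conditional n
    conditional n i js len (i≁js ∷ pairs) = begin
      μ (λ f → occ i f * avoid js f)             ≤⟨ E-mono K drop-near f₀ ⟩
      μ (λ f → occ i f * avoid far f)            ≡⟨ E-mult K (occ i) (avoid far) independent f₀ ⟩
      μ (occ i) * μ (avoid far)                  ≤⟨ *-monoʳ (0≤μ-avoid far) (small i f₀) ⟩
      x * pow y d * μ (avoid far)                ≤⟨ *-monoʳ (0≤μ-avoid far) (*-monoˡ (ℚₚ.<⇒≤ 0<x) (pow-anti 0<y y≤1 near≤d)) ⟩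
      x * pow y (length near) * μ (avoid far)    ≡⟨ ℚₚ.*-assoc x _ _ ⟩
      x * (pow y (length near) * μ (avoid far))  ≤⟨ *-monoˡ (ℚₚ.<⇒≤ 0<x) (chained n len) ⟩
      x * μ (avoid (near ++ far))                ≡⟨ cong (x *_) (E-cong K avoid-≡ f₀) ⟨
      x * μ (avoid js)                           ∎
      where
      open ℚₚ.≤-Reasoning
      open Split (split i js pairs)
      drop-near : ∀ f → occ i f * avoid js f ≤ occ i f * avoid far f
      drop-near f = *-monoˡ (0≤𝟙 (Event i f))
        (ℚₚ.≤-trans (ℚₚ.≤-reflexive (avoid-≡ f)) (avoid-++-≤ near far f))
      independent : ∀ v → v ∈ₗ K → Ind v (occ i) ⊎ Ind v (avoid far)
      independent v v∈K with em {P = Scope i v}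
      ... | yes s = inj₂ (avoid-Ind far v∈K (All.map (λ ¬adj s′ → ¬adj (v , v∈K , s , s′)) far-adj))
      ... | no ¬s = inj₁ (occ-Ind v∈K ¬s)
      near≤d : length near ℕ.≤ d
      near≤d = degree i near (proj₁ (from i≁js) ∷ pairs-near) near-adj
      chained : ∀ n → length js ℕ.≤ n → pow y (length near) * μ (avoid far) ≤ μ (avoid (near ++ far))
      chained zero    len′ = short near (ℕₚ.≤-trans (ℕₚ.≤-reflexive size) len′)
        where
        short : ∀ as → length (as ++ far) ℕ.≤ 0 → pow y (length as) * μ (avoid far) ≤ μ (avoid (as ++ far))
        short [] _ = ℚₚ.≤-reflexive (ℚₚ.*-identityˡ _)
      chained (suc n) len′ = chain n (conditional n) near far
        (ℕₚ.≤-trans (ℕₚ.≤-reflexive size) len′) (AllPairsₚ.++⁺ pairs-near pairs-far cross)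

    -- A chain with nothing behind `js` bounds the probability of avoiding all of `js` below by a
    -- power of `y`, and a positive expectation is positive at some colouring.
    avoidable : ∀ js → AllPairs _≁_ js → ∃[ f ] All (λ j → ¬ Event j f) js
    avoidable js pairs =
      let (f , 0<avoid) = E>0⇒∃>0 K (avoid js) f₀ positive in f , none js f 0<avoid
      where
      positive : 0ℚ < μ (avoid js)
      positive = ℚₚ.<-≤-trans (0<pow (length js) 0<y)
        (ℚₚ.≤-trans (ℚₚ.≤-reflexive (sym (trans (cong (pow y (length js) *_) (E-const K 1ℚ f₀)) (ℚₚ.*-identityʳ _))))
          (subst (λ is → pow y (length js) * μ (avoid []) ≤ μ (avoid is)) (Listₚ.++-identityʳ js)
            (chain (length js) (conditional (length js)) js []
              (ℕₚ.m≤n⇒m≤1+n (ℕₚ.≤-reflexive (cong length (Listₚ.++-identityʳ js))))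
              (subst (AllPairs _≁_) (sym (Listₚ.++-identityʳ js)) pairs))))
      none : ∀ js f → 0ℚ < avoid js f → All (λ j → ¬ Event j f) js
      none []       f _ = []
      none (j ∷ js) f 0<a with em {P = Event j f}
      ... | yes _ = contradiction 0<a (ℚₚ.<-irrefl (sym (ℚₚ.*-zeroˡ (avoid js f))))
      ... | no ¬e = ¬e ∷ none js f (subst (0ℚ <_) (ℚₚ.*-identityˡ (avoid js f)) 0<a)

-- Finite subsets.

module FiniteSets (em : ∀ {ℓ} → ExcludedMiddle ℓ) where
  open Classical em
  open import Data.List.Membership.Propositional renaming (_∈_ to _∈ₗ_)

  Finite : ∀ {A : Set} → Pred A 0ℓ → Set
  Finite P = ∃[ xs ] ∀ y → P y → y ∈ₗ xs

  exact : ∀ {A : Set} {P : Pred A 0ℓ} → Finite P → ∃[ ys ] (∀ y → P y → y ∈ₗ ys) × (∀ y → y ∈ₗ ys → P y)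
  exact {A} {P} (xs , cover) = go xs .proj₁ , (λ y p → go xs .proj₂ .proj₁ y p (cover y p)) , go xs .proj₂ .proj₂
    where
    go : ∀ xs → ∃[ ys ] (∀ y → P y → y ∈ₗ xs → y ∈ₗ ys) × (∀ y → y ∈ₗ ys → P y)
    go [] = [] , (λ _ _ ()) , λ _ ()
    go (x ∷ xs) with go xs | lem (P x)
    ... | ys , f , g | inj₁ p = x ∷ ys
          , (λ { _ _ (here e) → here e ; y q (there e) → there (f y q e) })
          , λ { _ (here refl) → p ; y (there e) → g y e }
    ... | ys , f , g | inj₂ ¬p = ys
          , (λ { _ q (here refl) → contradiction q ¬p ; y q (there e) → f y q e }) , g

  finite-⋃ : ∀ {A B : Set} {P : Pred A 0ℓ} {R : A → Pred B 0ℓ} → Finite P → (∀ x → P x → Finite (R x)) →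
             Finite (λ y → ∃[ x ] P x × R x y)
  finite-⋃ {A} {B} {P} {R} fin finR = let (xs , cover , _) = exact {P = P} fin in
    concat xs , λ { y (x , p , r) → inside xs (cover x p) p r }
    where
    row : A → List B
    row x with lem (P x)
    ... | inj₁ p = proj₁ (finR x p)
    ... | inj₂ _ = []
    row-∈ : ∀ {x y} → P x → R x y → y ∈ₗ row x
    row-∈ {x} {y} p r with lem (P x)
    ... | inj₁ p′ = proj₂ (finR x p′) y r
    ... | inj₂ ¬p = contradiction p ¬p
    concat : List A → List B
    concat []       = []
    concat (x ∷ xs) = row x ++ concat xs
    inside : ∀ {x y} xs → x ∈ₗ xs → P x → R x y → y ∈ₗ concat xs
    inside (x ∷ xs) (here refl) p r = Anyₚ.++⁺ˡ (row-∈ p r)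
    inside (x ∷ xs) (there e)   p r = Anyₚ.++⁺ʳ (row x) (inside xs e p r)

  finite-⊆ : ∀ {A : Set} {P Q : Pred A 0ℓ} → (∀ x → P x → Q x) → Finite Q → Finite P
  finite-⊆ P⊆Q (xs , cover) = xs , λ y p → cover y (P⊆Q y p)

  finite-∪ : ∀ {A : Set} {P Q : Pred A 0ℓ} → Finite P → Finite Q → Finite (P ∪ Q)
  finite-∪ (xs , p) (ys , q) = xs ++ ys , λ { y (inj₁ e) → Anyₚ.++⁺ˡ (p y e) ; y (inj₂ e) → Anyₚ.++⁺ʳ xs (q y e) }

-- Connectedness inside a set of vertices.

module Components (X : Set) (G : X → X → Set) (G-sym : ∀ {x y} → G x y → G y x) where
  Path : Pred X 0ℓ → ℕ → X → X → Set
  Path Y zero    x y = x ≡ y × Y x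
  Path Y (suc k) x y = ∃[ z ] Path Y k x z × G z y × Y y

  Conn : Pred X 0ℓ → X → X → Set
  Conn Y x y = ∃[ k ] Path Y k x y

  module _ {Y : Pred X 0ℓ} where
    conn-refl : ∀ {x} → Y x → Conn Y x x
    conn-refl Yx = 0 , refl , Yx

    conn-step : ∀ {x y z} → Conn Y x y → G y z → Y z → Conn Y x z
    conn-step (k , path) g Yz = suc k , _ , path , g , Yz

    conn-end : ∀ {x y} → Conn Y x y → Y y
    conn-end (zero , refl , Yx)           = Yx
    conn-end (suc k , z , path , g , Yy) = Yy

    conn-trans : ∀ {x y z} → Conn Y x y → Conn Y y z → Conn Y x z
    conn-trans c (zero , refl , _)         = c
    conn-trans c (suc k , w , p , g , Yz) = conn-step (conn-trans c (k , p)) g Yz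

    conn-sym : ∀ {x y} → Conn Y x y → Conn Y y x
    conn-sym (zero , refl , Yx)        = 0 , refl , Yx
    conn-sym (suc k , w , p , g , Yy) =
      conn-trans (conn-step (conn-refl Yy) (G-sym g) (conn-end (k , p))) (conn-sym (k , p))

-- Solving the CSP on finite components in two stages.

module Stages (em : ∀ {ℓ} → ExcludedMiddle ℓ) (ext : ∀ {a b} → Extensionality a b)
              (X : Set) (q : ℕ) .{{_ : NonZero q}} (ℬ : Pred (CSP.Constraint X q) 0ℓ) where
  open Classical em
  open FiniteSets em
  open ℚ-Order
  open Averaging em ext X q
  open LocalLemma em ext X q
  open CSP X q
  open Setoid GraphSets using () renaming (_≈_ to _≈ᶜ_; sym to ≈ᶜ-sym; trans to ≈ᶜ-trans)
  open import Data.Rational.Base using (_≤_; _<_; _*_; _-_)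
  open import Data.List.Membership.Propositional renaming (_∈_ to _∈ₗ_)

  -- Loops are included so that walks may pause and points outside all domains need no separate
  -- treatment.
  G : X → X → Set
  G x y = x ≡ y ⊎ (∃[ B ] B ∈ ℬ × dom B x × dom B y)

  G-sym : ∀ {x y} → G x y → G y x
  G-sym (inj₁ refl) = inj₁ refl
  G-sym (inj₂ (B , b , dx , dy)) = inj₂ (B , b , dy , dx)

  open Components X G G-sym

  dom-resp : ∀ {B B′ x} → B ≈ᶜ B′ → dom B x → dom B′ x
  dom-resp (B⊆B′ , _) (φ , φ∈B , dφ) = φ , B⊆B′ φ∈B , dφ

  violates-resp : ∀ {B B′ f} → B ≈ᶜ B′ → Violates f B → Violates f B′
  violates-resp B≈B′ (φ , φ∈B , r) = φ , proj₁ B≈B′ φ∈B , λ x i → mk⇔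
    (λ e → let (dx , fx) = Equivalence.to (r x i) e in dom-resp B≈B′ dx , fx)
    (λ { (dx , fx) → Equivalence.from (r x i) (dom-resp (≈ᶜ-sym B≈B′) dx , fx) })

  Agree : Pred X 0ℓ → Colouring → Colouring → Set
  Agree D f f′ = ∀ x → D x → f x ≡ f′ x

  violates-dep : ∀ {B f f′} → Agree (dom B) f f′ → Violates f B → Violates f′ B
  violates-dep agree (φ , φ∈B , r) = φ , φ∈B , λ x i → mk⇔
    (λ e → let (dx , fx) = Equivalence.to (r x i) e in dx , trans (sym (agree x dx)) fx)
    (λ { (dx , fx) → Equivalence.from (r x i) (dx , trans (agree x dx) fx) })

  -- The points of `xs` are recoloured anyway, so only colours on the rest of `D` can matter.
  E-dep : ∀ {D : Pred X 0ℓ} {g} → (∀ {f f′} → Agree D f f′ → g f ≡ g f′) →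
          ∀ xs {f f′} → Agree (λ x → D x × ¬ x ∈ₗ xs) f f′ → E xs g f ≡ E xs g f′
  E-dep         dep []       agree = dep λ x Dx → agree x (Dx , λ ())
  E-dep {D} {g} dep (y ∷ xs) {f} {f′} agree = avg-cong λ i → E-dep dep xs (agree′ i)
    where
    agree′ : ∀ i → Agree (λ x → D x × ¬ x ∈ₗ xs) (update f y i) (update f′ y i)
    agree′ i x (Dx , x∉xs) with em {P = x ≡ y}
    ... | yes _  = refl
    ... | no x≢y = agree x (Dx , λ { (here e) → x≢y e ; (there e) → x∉xs e })

  record Sparse (d : ℕ) : Set where
    field
      dom-finite   : ∀ B → B ∈ ℬ → Finite (dom B)
      incident     : ∀ x → ∃[ Bs ] ∀ B → B ∈ ℬ → dom B x → Any (B ≈ᶜ_) Bs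
      degree-bound : ∀ B Bs → B ∈ ℬ → All ℬ Bs → AllPairs (λ B B′ → ¬ B ≈ᶜ B′) (B ∷ Bs) →
                     All (λ B′ → dom B′ ≬ dom B) Bs → length Bs ℕ.≤ d

  -- One constraint has many presentations as a list and may be indexed through many points; the
  -- local lemma wants one index for each. `Bs` has to catch the constraints only up to `≈ᶜ`.
  representatives : ∀ {I : Set} (π : I → Constraint) Bs →
    ∃[ js ] AllPairs (λ i j → ¬ π i ≈ᶜ π j) js × (∀ i → Any (π i ≈ᶜ_) Bs → Any (λ j → π i ≈ᶜ π j) js)
  representatives π [] = [] , [] , λ _ ()
  representatives {I} π (B ∷ Bs) with representatives π Bs | lem (Σ[ i ∈ I ] π i ≈ᶜ B)
  ... | js , pairs , f | inj₂ none = js , pairs , λ { i (here e) → contradiction (i , e) none ; i (there a) → f i a }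
  ... | js , pairs , f | inj₁ (i , i≈B) with lem (Any (λ j → π i ≈ᶜ π j) js)
  ...   | inj₁ a  = js , pairs , λ
        { k (here k≈B) → Any.map (λ {j} → ≈ᶜ-trans {π k} {π i} {π j} (≈ᶜ-trans {π k} {B} {π i} k≈B (≈ᶜ-sym {π i} {B} i≈B))) a
        ; k (there a′) → f k a′ }
  ...   | inj₂ ¬a = i ∷ js , Allₚ.¬Any⇒All¬ js ¬a ∷ pairs , λ
        { k (here k≈B) → here (≈ᶜ-trans {π k} {B} {π i} k≈B (≈ᶜ-sym {π i} {B} i≈B))
        ; k (there a′) → there (f k a′) }

  -- Every code colours all of X at once. A component can therefore select the least successful code
  -- without its points being enumerated, which keeps the selection definable.
  record Codes : Set where
    field
      code    : ℕ → Colouring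
      realise : ∀ xs (f : Colouring) → ∃[ c ] ∀ x → x ∈ₗ xs → code c x ≡ f x

  -- One stage colours `Y` and keeps `f₀` elsewhere. `A B` is the event to be avoided at B: being
  -- risky in the first stage, being violated in the second.
  module Stage (codes : Codes) (Y : Pred X 0ℓ) (f₀ : Colouring) (A : Constraint → Colouring → Set) where
    open Codes codes

    abstract
      merge : Colouring → Colouring
      merge f x with lem (Y x)
      ... | inj₁ _ = f x
      ... | inj₂ _ = f₀ x

      merge-∈ : ∀ f {x} → Y x → merge f x ≡ f x
      merge-∈ f {x} Yx with lem (Y x)
      ... | inj₁ _  = refl
      ... | inj₂ ¬Y = contradiction Yx ¬Y

      merge-∉ : ∀ f {x} → ¬ Y x → merge f x ≡ f₀ x
      merge-∉ f {x} ¬Y with lem (Y x)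
      ... | inj₁ Yx = contradiction Yx ¬Y
      ... | inj₂ _  = refl

      merge-cong : ∀ {f f′} x → (Y x → f x ≡ f′ x) → merge f x ≡ merge f′ x
      merge-cong x e with lem (Y x)
      ... | inj₁ Yx = e Yx
      ... | inj₂ _  = refl

    Bad : ℕ → Pred X 0ℓ
    Bad c y = ∃[ B ] B ∈ ℬ × dom B y × A B (merge (code c))

    Good : ℕ → Pred X 0ℓ
    Good c x = ∀ y → Conn Y x y → ¬ Bad c y

    Least : ℕ → X → Set
    Least c x = Good c x × (∀ c′ → c′ ℕ.< c → ¬ Good c′ x)

    abstract
      result : Colouring
      result x with lem (Y x) | lem (∃[ c ] Good c x)
      ... | inj₁ _ | inj₁ e = code (proj₁ (least (λ c → Good c x) e)) x
      ... | _      | _      = f₀ x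

      result-∉ : ∀ {x} → ¬ Y x → result x ≡ f₀ x
      result-∉ {x} ¬Y with lem (Y x) | lem (∃[ c ] Good c x)
      ... | inj₁ Yx | _ = contradiction Yx ¬Y
      ... | inj₂ _  | _ = refl

      result-∈ : ∀ {x c} → Y x → Least c x → result x ≡ code c x
      result-∈ {x} {c} Yx (good , min) with lem (Y x) | lem (∃[ c ] Good c x)
      ... | inj₂ ¬Y | _       = contradiction Yx ¬Y
      ... | inj₁ _  | inj₂ ne = contradiction (c , good) ne
      ... | inj₁ _  | inj₁ e  with least (λ c → Good c x) e
      ...   | m , goodm , minm with ℕₚ.<-cmp m c
      ...     | tri< m<c _ _ = contradiction goodm (min m m<c)
      ...     | tri≈ _ m≡c _ = cong (λ c → code c x) m≡c
      ...     | tri> _ _ c<m = contradiction good (minm c c<m)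

      result-default : ∀ {x} → ¬ (∃[ c ] Good c x) → result x ≡ f₀ x
      result-default {x} none with lem (Y x) | lem (∃[ c ] Good c x)
      ... | inj₁ _ | inj₁ e = contradiction e none
      ... | inj₁ _ | inj₂ _ = refl
      ... | inj₂ _ | inj₁ _ = refl
      ... | inj₂ _ | inj₂ _ = refl

    good-conn : ∀ {c x y} → Conn Y x y → Good c x → Good c y
    good-conn x~y good z y~z = good z (conn-trans x~y y~z)

    -- Goodness of a code belongs to a whole component, hence so does the least good code: `result`
    -- coincides with a single code on each component that has a good one.
    least-conn : ∀ {c x y} → Conn Y x y → Least c x → Least c y
    least-conn x~y (good , min) = good-conn x~y good , λ c′ lt good′ → min c′ lt (good-conn (conn-sym x~y) good′)

    module Correct {d : ℕ} (sparse : Sparse d) {r : ℚ} (0<r : 0ℚ < r) (r<1 : r < 1ℚ)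
             (A-dep : ∀ {B f f′} → Agree (dom B) f f′ → A B f → A B f′)
             (A-resp : ∀ {B B′ f} → B ≈ᶜ B′ → A B f → A B′ f) where
      open Sparse sparse

      -- The bound required by the local lemma, conditional on the colours `f₀` off `Y`. `K` is any
      -- list of points of `Y` that contains the part of the domain in `Y`, because the list of
      -- points of a component is not canonical.
      Small : Constraint → Set
      Small B = ∀ K → (∀ x → x ∈ₗ K → Y x) → (∀ x → dom B x → Y x → x ∈ₗ K) →
                ∀ f → Agree (∁ Y) f f₀ → E K (𝟙 ∘ A B) f ≤ r * pow (1ℚ - r) d

      E-merge : ∀ K {g : Colouring → ℚ} → (∀ x → x ∈ₗ K → Y x) → ∀ f → E K (g ∘ merge) f ≡ E K g (merge f)
      E-merge []      K⊆Y f = refl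
      E-merge (x ∷ K) {g} K⊆Y f = avg-cong λ i →
        trans (E-merge K (λ y → K⊆Y y ∘ there) (update f x i)) (cong (E K g) (ext (commute i)))
        where
        commute : ∀ i y → merge (update f x i) y ≡ update (merge f) x i y
        commute i y with lem (y ≡ x)
        ... | inj₁ refl = trans (merge-∈ _ (K⊆Y x (here refl))) (trans (update-≡ f x i) (sym (update-≡ (merge f) x i)))
        ... | inj₂ y≢x = trans (merge-cong y λ _ → update-≢ f i y≢x) (sym (update-≢ (merge f) i y≢x))

      incident-all : ∀ K → ∃[ Bs ] ∀ B y → y ∈ₗ K → B ∈ ℬ → dom B y → Any (B ≈ᶜ_) Bs
      incident-all []      = [] , λ _ _ ()
      incident-all (x ∷ K) =
        let (Bs , f) = incident x ; (Bs′ , f′) = incident-all K in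
        Bs ++ Bs′ , λ { B _ (here refl) b D → Anyₚ.++⁺ˡ (f B b D)
                      ; B y (there e) b D → Anyₚ.++⁺ʳ Bs (f′ B y e b D) }

      -- The local lemma on the component of `x`. A constraint touching it meets `Y` nowhere else,
      -- since the points of a domain are pairwise adjacent. So finitely many events remain, all
      -- decided by the colours on `K`, and some code realises the colouring of `K` that avoids
      -- them.
      good-exists : ∀ {x} → Y x → Finite (Conn Y x) → (∀ B y → B ∈ ℬ → Conn Y x y → dom B y → Small B) →
                    ∃[ c ] Good c x
      good-exists {x} Yx fin small = c , good
        where
        K : List X
        K = proj₁ (exact fin)
        K-cover : ∀ y → Conn Y x y → y ∈ₗ K
        K-cover = proj₁ (proj₂ (exact fin))
        K-conn : ∀ y → y ∈ₗ K → Conn Y x y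
        K-conn = proj₂ (proj₂ (exact fin))
        K⊆Y : ∀ y → y ∈ₗ K → Y y
        K⊆Y y = conn-end ∘ K-conn y
        Touching : Set
        Touching = ∃[ B ] B ∈ ℬ × ∃[ y ] y ∈ₗ K × dom B y
        saturated : ∀ ((B , _) : Touching) z → dom B z → Y z → z ∈ₗ K
        saturated (B , b , y , y∈K , Dy) z Dz Yz = K-cover z (conn-step (K-conn y y∈K) (inj₂ (B , b , Dy , Dz)) Yz)
        𝓕 : Family K r d
        𝓕 = record
          { Index     = Touching
          ; _~_       = λ i j → proj₁ i ≈ᶜ proj₁ j
          ; ~-sym     = λ {i} {j} → ≈ᶜ-sym {proj₁ i} {proj₁ j}
          ; Scope     = λ i → dom (proj₁ i)
          -- `merge` puts `f₀` back off `Y`: the local lemma speaks of arbitrary ambient colourings,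
          -- `Small` only of those that agree with `f₀` there.
          ; Event     = λ i f → A (proj₁ i) (merge f)
          ; event-Ind = λ i v v∈K ¬s f c →
              A-dep (λ z Dz → merge-update f c v z (λ { refl → ¬s Dz })) ,
              A-dep (λ z Dz → sym (merge-update f c v z (λ { refl → ¬s Dz })))
          ; degree    = λ i js pairs adj → subst (ℕ._≤ d) (Listₚ.length-map proj₁ js)
              (degree-bound (proj₁ i) (List.map proj₁ js) (proj₁ (proj₂ i))
                (Allₚ.map⁺ (All.universal (λ j → proj₁ (proj₂ j)) js))
                (AllPairsₚ.map⁺ pairs)
                (Allₚ.map⁺ (All.map (λ { (v , _ , s , s′) → v , s′ , s }) adj)))
          ; small     = λ i f → subst (_≤ r * pow (1ℚ - r) d) (sym (E-merge K K⊆Y f))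
              (let (B , b , y , y∈K , Dy) = i in
               small B y b (K-conn y y∈K) Dy K K⊆Y (saturated i) (merge f) (λ z ¬Y → merge-∉ f ¬Y))
          }
          where
          merge-update : ∀ f c v z → z ≢ v → merge (update f v c) z ≡ merge f z
          merge-update f c v z z≢v = merge-cong z λ _ → update-≢ f c z≢v
        Bs : List Constraint
        Bs = proj₁ (incident-all K)
        js : List Touching
        js = proj₁ (representatives proj₁ Bs)
        avoiding : ∃[ f ] All (λ j → ¬ A (proj₁ j) (merge f)) js
        avoiding = avoidable 𝓕 0<r r<1 f₀ js (proj₁ (proj₂ (representatives proj₁ Bs)))
        c : ℕ
        c = proj₁ (realise K (proj₁ avoiding))
        good : Good c x
        good y x~y (B , b , Dy , a) =
          All.lookupAny (proj₂ avoiding) at .proj₁ (A-resp (All.lookupAny (proj₂ avoiding) at .proj₂) (A-dep agree a))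
          where
          i : Touching
          i = B , b , y , K-cover y x~y , Dy
          at : Any (λ j → B ≈ᶜ proj₁ j) js
          at = proj₂ (proj₂ (representatives proj₁ Bs)) i (proj₂ (incident-all K) B y (K-cover y x~y) b Dy)
          agree : Agree (dom B) (merge (code c)) (merge (proj₁ avoiding))
          agree z Dz = merge-cong z λ Yz → proj₂ (realise K (proj₁ avoiding)) z (saturated i z Dz Yz)

      -- The points of `dom B` in `Y` are adjacent to `x` and share its code, so on `dom B` the
      -- result equals a merged code that is good at `x`.
      avoided : ∀ {x} → Y x → Finite (Conn Y x) → (∀ B y → B ∈ ℬ → Conn Y x y → dom B y → Small B) →
                ∀ B → B ∈ ℬ → dom B x → ¬ A B result
      avoided {x} Yx fin small B b Dx a =
        proj₁ leastc x (conn-refl Yx) (B , b , Dx , A-dep agree a)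
        where
        leastc′ : ∃[ c ] Least c x
        leastc′ = least (λ c → Good c x) (good-exists Yx fin small)
        c : ℕ
        c = proj₁ leastc′
        leastc : Least c x
        leastc = proj₂ leastc′
        agree : Agree (dom B) result (merge (code c))
        agree z Dz = Sum.[
            (λ Yz → trans (result-∈ {z} {c} Yz (least-conn {c} {x} {z} (step Yz) leastc)) (sym (merge-∈ (code c) {z} Yz)))
          , (λ ¬Y → trans (result-∉ {z} ¬Y) (sym (merge-∉ (code c) {z} ¬Y))) ]′ (lem (Y z))
          where
          step : Y z → Conn Y x z
          step Yz = conn-step {x = x} {x} {z} (conn-refl Yx) (inj₂ (B , b , Dx , Dz)) Yz

  module TwoStages {d : ℕ} (sparse : Sparse d) {r : ℚ} (0<r : 0ℚ < r) (r<1 : r < 1ℚ)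
                   (unlikely : ∀ B → B ∈ ℬ → ∀ xs → (∀ x → dom B x → x ∈ₗ xs) → ∀ f →
                      E xs (λ f → 𝟙 (Violates f B)) f ≤ (r * pow (1ℚ - r) d) * (r * pow (1ℚ - r) d))
                   (codes : Codes) (f₀ : Colouring) where
    open Sparse sparse

    L : ℚ
    L = r * pow (1ℚ - r) d

    0<L : 0ℚ < L
    0<L = 0<* 0<r (0<pow d (subst (_< 1ℚ - r) (ℚₚ.+-inverseʳ r) (ℚₚ.+-monoˡ-< (ℚ.- r) r<1)))

    L<1 : L < 1ℚ
    L<1 = ℚₚ.≤-<-trans (*-≤-ˡ {r} {pow (1ℚ - r) d} (ℚₚ.<⇒≤ 0<r) (pow-anti {n = d}
            (subst (_< 1ℚ - r) (ℚₚ.+-inverseʳ r) (ℚₚ.+-monoˡ-< (ℚ.- r) r<1))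
            (subst (1ℚ - r ≤_) (ℚₚ.+-identityʳ 1ℚ) (ℚₚ.+-monoʳ-≤ 1ℚ (ℚₚ.neg-antimono-≤ (ℚₚ.<⇒≤ 0<r)))) z≤n)) r<1

    viol : Constraint → Colouring → ℚ
    viol B f = 𝟙 (Violates f B)

    viol-dep : ∀ {B f f′} → Agree (dom B) f f′ → viol B f ≡ viol B f′
    viol-dep {B} agree = 𝟙-cong (violates-dep agree) (violates-dep λ x Dx → sym (agree x Dx))

    -- Once the points of X₀ are coloured, the conditional probability of
    -- violating B exceeds L; by Markov's inequality this has probability ≤ L.
    Risky : Pred X 0ℓ → Constraint → Colouring → Set
    Risky X₀ B f = ∃[ ys ] (∀ x → x ∈ₗ ys → dom B x × ¬ X₀ x) × (∀ x → dom B x → ¬ X₀ x → x ∈ₗ ys) × L < E ys (viol B) f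

    module _ (X₀ : Pred X 0ℓ) where
      module S₁ = Stage codes X₀ f₀ (Risky X₀)
      -- The first colouring is the background of the second stage and so stays in force on `X₀`.
      module S₂ = Stage codes (∁ X₀) S₁.result (λ B f → Violates f B)

      solution : Colouring
      solution = S₂.result

      risky-dep : ∀ {B f f′} → Agree (dom B) f f′ → Risky X₀ B f → Risky X₀ B f′
      risky-dep {B} agree (ys , s , c , L<E) =
        ys , s , c , subst (L <_) (E-dep {dom B} {viol B} viol-dep ys (λ x (Dx , _) → agree x Dx)) L<E

      risky-resp : ∀ {B B′ f} → B ≈ᶜ B′ → Risky X₀ B f → Risky X₀ B′ f
      risky-resp {B} {B′} {f} B≈B′ (ys , s , c , L<E) = ys
        , (λ x e → dom-resp B≈B′ (proj₁ (s x e)) , proj₂ (s x e))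
        , (λ x D → c x (dom-resp (≈ᶜ-sym B≈B′) D))
        , subst (L <_) (E-cong ys (λ f → 𝟙-cong (violates-resp B≈B′) (violates-resp (≈ᶜ-sym B≈B′))) f) L<E

      open S₁.Correct sparse 0<r r<1 risky-dep risky-resp using () renaming (Small to Small₁; avoided to avoided₁)
      open S₂.Correct sparse 0<r r<1 violates-dep violates-resp using () renaming (Small to Small₂; avoided to avoided₂)

      free-points : ∀ B → B ∈ ℬ → ∃[ ys ] (∀ x → dom B x × ¬ X₀ x → x ∈ₗ ys) × (∀ x → x ∈ₗ ys → dom B x × ¬ X₀ x)
      free-points B b = exact (finite-⊆ (λ x → proj₁) (dom-finite B b))

      Ind-outside : ∀ {B x} → ¬ dom B x → Ind x (viol B)
      Ind-outside {B} {x} ¬D f i = viol-dep {B} λ y D → update-≢ f i (λ { refl → ¬D D })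

      -- Averaging over `K` and then over the uncoloured points `ys` covers all of `dom B`, so the
      -- expected conditional probability is at most L * L; Markov's inequality divides by L.
      small₁ : ∀ B → B ∈ ℬ → Small₁ B
      small₁ B b K _ K-cover f _ = ℚₚ.*-cancelˡ-≤-pos L {{ℚ.positive 0<L}} (begin
        L * E K (𝟙 ∘ Risky X₀ B) f              ≡⟨ E-* K L (𝟙 ∘ Risky X₀ B) f ⟨
        E K (λ f → L * 𝟙 (Risky X₀ B f)) f      ≤⟨ E-mono K markov f ⟩
        E K (E ys (viol B)) f                   ≡⟨ E-++ K ys (viol B) f ⟨
        E (K ++ ys) (viol B) f                  ≤⟨ unlikely B b (K ++ ys) cover f ⟩
        L * L                                   ∎)
        where
        open ℚₚ.≤-Reasoning
        ys : List X
        ys = proj₁ (free-points B b)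
        cover : ∀ x → dom B x → x ∈ₗ (K ++ ys)
        cover x D = Sum.[ Anyₚ.++⁺ˡ ∘ K-cover x D , (λ ¬X₀ → Anyₚ.++⁺ʳ K (proj₁ (proj₂ (free-points B b)) x (D , ¬X₀))) ]′ (lem (X₀ x))
        markov : ∀ f → L * 𝟙 (Risky X₀ B f) ≤ E ys (viol B) f
        markov f with lem (Risky X₀ B f)
        ... | inj₁ ris@(zs , s , c , L<E) = begin
          L * 𝟙 (Risky X₀ B f)  ≡⟨ cong (L *_) (𝟙-yes ris) ⟩
          L * 1ℚ                ≡⟨ ℚₚ.*-identityʳ L ⟩
          L                     ≤⟨ ℚₚ.<⇒≤ L<E ⟩
          E zs (viol B) f       ≡⟨ E-absorb {zs} {ys} {viol B}
                                     (λ x e → uncurry (c x) (proj₂ (proj₂ (free-points B b)) x e))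
                                     (λ x e → inj₁ (proj₁ (proj₂ (free-points B b)) x (s x e))) f ⟩
          E ys (viol B) f       ∎
        ... | inj₂ ¬ris = begin
          L * 𝟙 (Risky X₀ B f)  ≡⟨ cong (L *_) (𝟙-no ¬ris) ⟩
          L * 0ℚ                ≡⟨ ℚₚ.*-zeroʳ L ⟩
          0ℚ                    ≡⟨ E-const ys 0ℚ f ⟨
          E ys (λ _ → 0ℚ) f     ≤⟨ E-mono ys (λ f → 0≤𝟙 (Violates f B)) f ⟩
          E ys (viol B) f       ∎

      -- Not being risky is the very bound that the local lemma asks of the second stage. The
      -- colours of `f` on the free points are averaged away, so `f` may be replaced by `S₁.result`.
      small₂ : ∀ B → B ∈ ℬ → ¬ Risky X₀ B S₁.result → Small₂ B
      small₂ B b safe K K⊆X₁ K-cover f agree = begin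
        E K (viol B) f           ≡⟨ E-absorb {K} {ys} {viol B}
                                      (λ x e → uncurry (K-cover x) (proj₂ (proj₂ (free-points B b)) x e)) cover f ⟩
        E ys (viol B) f          ≡⟨ E-dep {dom B} {viol B} viol-dep ys same ⟩
        E ys (viol B) S₁.result  ≤⟨ ℚₚ.≮⇒≥ (λ L<E → safe (ys
                                      , proj₂ (proj₂ (free-points B b))
                                      , (λ x D ¬X₀ → proj₁ (proj₂ (free-points B b)) x (D , ¬X₀)) , L<E)) ⟩
        L                        ∎
        where
        open ℚₚ.≤-Reasoning
        ys : List X
        ys = proj₁ (free-points B b)
        cover : ∀ x → x ∈ₗ K → x ∈ₗ ys ⊎ Ind x (viol B)
        cover x e = Sum.map (λ D → proj₁ (proj₂ (free-points B b)) x (D , K⊆X₁ x e)) Ind-outside (lem (dom B x))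
        same : Agree (λ x → dom B x × ¬ x ∈ₗ ys) f S₁.result
        same x (D , x∉ys) = agree x λ ¬X₀ → x∉ys (proj₁ (proj₂ (free-points B b)) x (D , ¬X₀))

      -- Correctness is relative to an invariant set `O`, because different orbits will be served by
      -- different choices of `X₀`.
      module _ (O : Pred X 0ℓ) (O-closed : ∀ {x y} → O x → G x y → O y)
               (finite₁ : ∀ x → O x → X₀ x → Finite (Conn X₀ x))
               (finite₂ : ∀ x → O x → ¬ X₀ x → Finite (Conn (∁ X₀) x)) where

        O-conn : ∀ {Y x y} → O x → Conn Y x y → O y
        O-conn Ox (zero , refl , _)          = Ox
        O-conn Ox (suc k , z , path , g , _) = O-closed (O-conn Ox (k , path)) g

        -- If `dom B` meets `X₀`, the first stage has dealt with B. Otherwise no colour on `dom B`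
        -- has changed, so with `K` empty riskiness has probability 0 or 1; being at most L < 1 it
        -- is 0.
        safe : ∀ B → B ∈ ℬ → ∀ {x} → dom B x → O x → ¬ Risky X₀ B S₁.result
        safe B b {x} D Ox = Sum.[ meets , misses ]′ (lem (∃[ y ] dom B y × X₀ y))
          where
          meets : ∃[ y ] dom B y × X₀ y → ¬ Risky X₀ B S₁.result
          meets (y , Dy , X₀y) = avoided₁ {y} X₀y (finite₁ y (O-closed {x} {y} Ox (inj₂ (B , b , D , Dy))) X₀y)
            (λ B′ _ b′ _ _ → small₁ B′ b′) B b Dy
          misses : ¬ (∃[ y ] dom B y × X₀ y) → ¬ Risky X₀ B S₁.result
          misses none ris = ℚₚ.<-irrefl refl (ℚₚ.<-≤-trans L<1 (begin
              1ℚ                        ≡⟨ 𝟙-yes ris ⟨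
              𝟙 (Risky X₀ B S₁.result)  ≡⟨ 𝟙-cong (risky-dep {B} off) (risky-dep {B} λ y D → sym (off y D)) ⟩
              𝟙 (Risky X₀ B f₀)         ≤⟨ small₁ B b [] (λ _ ()) (λ y Dy X₀y → contradiction (y , Dy , X₀y) none) f₀ (λ _ _ → refl) ⟩
              L                         ∎))
            where
            open ℚₚ.≤-Reasoning
            off : Agree (dom B) S₁.result f₀
            off y Dy = S₁.result-∉ λ X₀y → none (y , Dy , X₀y)

        -- A domain inside `X₀` is settled by the first stage: the conditional probability of
        -- violation is then 0 or 1, and B not being risky makes it 0. Any other domain is treated
        -- by the second stage.
        satisfied : ∀ B → B ∈ ℬ → ∀ {x} → dom B x → O x → ¬ Violates solution B
        satisfied B b {x} D Ox = Sum.[ meets , misses ]′ (lem (∃[ y ] dom B y × ¬ X₀ y))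
          where
          meets : ∃[ y ] dom B y × ¬ X₀ y → ¬ Violates solution B
          meets (y , Dy , ¬X₀y) = avoided₂ {y} ¬X₀y (finite₂ y Oy ¬X₀y)
            (λ B′ z b′ y~z D′ → small₂ B′ b′ (safe B′ b′ {z} D′ (O-conn Oy y~z))) B b Dy
            where
            Oy : O y
            Oy = O-closed {x} {y} Ox (inj₂ (B , b , D , Dy))
          misses : ¬ (∃[ y ] dom B y × ¬ X₀ y) → ¬ Violates solution B
          misses none v = ℚₚ.<-irrefl refl (ℚₚ.<-≤-trans L<1 (begin
              1ℚ                ≡⟨ 𝟙-yes v ⟨
              viol B solution   ≡⟨ viol-dep {B} off ⟩
              viol B S₁.result  ≤⟨ small₂ B b (safe B b {x} D Ox) [] (λ _ ()) (λ y Dy ¬X₀y → contradiction (y , Dy , ¬X₀y) none) S₁.result (λ _ _ → refl) ⟩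
              L                 ∎))
            where
            open ℚₚ.≤-Reasoning
            off : Agree (dom B) solution S₁.result
            off y Dy = S₂.result-∉ λ ¬X₀y → none (y , Dy , ¬X₀y)

    -- A constraint with empty domain touches no component, so the stages say nothing about it. If
    -- violated, it would have probability 1, which exceeds L * L.
    no-empty-violation : ∀ B → B ∈ ℬ → (∀ x → ¬ dom B x) → ∀ f → ¬ Violates f B
    no-empty-violation B b empty f v = ℚₚ.<-irrefl refl (begin-strict
      1ℚ      ≡⟨ 𝟙-yes v ⟨
      viol B f ≤⟨ unlikely B b [] (λ x D → contradiction D (empty x)) f ⟩
      L * L   ≤⟨ *-≤-ˡ (ℚₚ.<⇒≤ 0<L) (ℚₚ.<⇒≤ L<1) ⟩
      L       <⟨ L<1 ⟩
      1ℚ      ∎)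
      where open ℚₚ.≤-Reasoning

-- Splitting orbits into two sets with finite components.

module Decomposition (em : ∀ {ℓ} → ExcludedMiddle ℓ) (ext : ∀ {a b} → Extensionality a b)
                     (X : Set) (G : X → X → Set) (G-refl : ∀ {x} → G x x) (G-sym : ∀ {x y} → G x y → G y x)
                     (G-finite : ∀ x → FiniteSets.Finite em (G x)) where
  open Classical em
  open FiniteSets em
  open Components X G G-sym
  open import Data.Nat.Base using (_+_; _≤_; _<_)

  Ball : ℕ → X → X → Set
  Ball = Path U

  Orb : X → X → Set
  Orb = Conn U

  ball-finite : ∀ k x → Finite (Ball k x)
  ball-finite zero    x = x ∷ [] , λ { _ (refl , _) → here refl }
  ball-finite (suc k) x =
    finite-⊆ (λ { y (z , path , g , _) → z , path , g }) (finite-⋃ (ball-finite k x) λ z _ → G-finite z)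

  orb-step : ∀ {x y z} → Orb x y → G y z → Orb x z
  orb-step c g = conn-step c g tt

  module Parity where
    indicator : X → X → Fin 2
    indicator x y with lem (Orb x y)
    ... | inj₁ _ = Fin.zero
    ... | inj₂ _ = Fin.suc Fin.zero

    indicator-≡ : ∀ {x x′} → Orb x x′ → indicator x ≡ indicator x′
    indicator-≡ {x} {x′} o = ext go
      where
      go : ∀ y → indicator x y ≡ indicator x′ y
      go y with lem (Orb x y) | lem (Orb x′ y)
      ... | inj₁ _ | inj₁ _  = refl
      ... | inj₂ _ | inj₂ _  = refl
      ... | inj₁ p | inj₂ ¬p = contradiction (conn-trans (conn-sym o) p) ¬p
      ... | inj₂ ¬p | inj₁ p = contradiction (conn-trans o p) ¬p

    -- Excluded middle for types is a choice operator.  Its value depends only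
    -- on the indicator function, so it picks one point in every orbit.
    pick : (X → Fin 2) → X → X
    pick χ x with em {P = ∃[ y ] χ y ≡ Fin.zero}
    ... | yes (y , _) = y
    ... | no _        = x

    pick-∈ : ∀ (χ : X → Fin 2) {x y} → χ y ≡ Fin.zero → χ (pick χ x) ≡ Fin.zero
    pick-∈ χ e with em {P = ∃[ y ] χ y ≡ Fin.zero}
    ... | yes (_ , e′) = e′
    ... | no none      = contradiction (_ , e) none

    pick-const : ∀ (χ : X → Fin 2) {x x′ y} → χ y ≡ Fin.zero → pick χ x ≡ pick χ x′
    pick-const χ e with em {P = ∃[ y ] χ y ≡ Fin.zero}
    ... | yes _   = refl
    ... | no none = contradiction (_ , e) none

    root : X → X
    root x = pick (indicator x) x

    indicator-self : ∀ {x y} → Orb x y → indicator x y ≡ Fin.zero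
    indicator-self {x} {y} o with lem (Orb x y)
    ... | inj₁ _ = refl
    ... | inj₂ ¬o = contradiction o ¬o

    indicator-orb : ∀ {x y} → indicator x y ≡ Fin.zero → Orb x y
    indicator-orb {x} {y} e with lem (Orb x y)
    ... | inj₁ o = o

    root-orb : ∀ x → Orb x (root x)
    root-orb x = indicator-orb (pick-∈ (indicator x) {x} (indicator-self (conn-refl {x = x} tt)))

    root-≡ : ∀ {x y} → Orb x y → root x ≡ root y
    root-≡ {x} {y} o = trans (cong (λ χ → pick χ x) (indicator-≡ o))
                             (pick-const (indicator y) (indicator-self (conn-refl {x = y} tt)))

    depth-least : ∀ x → ∃[ k ] Ball k (root x) x × (∀ m → m < k → ¬ Ball m (root x) x)
    depth-least x = least (λ k → Ball k (root x) x) (conn-sym (root-orb x))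

    depth : X → ℕ
    depth x = proj₁ (depth-least x)

    depth-lipschitz : ∀ {x y} → G x y → depth y ≤ suc (depth x)
    depth-lipschitz {x} {y} g = ℕₚ.≮⇒≥ λ lt → proj₂ (proj₂ (depth-least y)) (suc (depth x)) lt
      (x , subst (λ r → Ball (depth x) r x) (root-≡ (orb-step (conn-refl tt) g)) (proj₁ (proj₂ (depth-least x))) , g , tt)

    parity : ℕ → Fin 2
    parity zero          = Fin.zero
    parity (suc zero)    = Fin.suc Fin.zero
    parity (suc (suc n)) = parity n

    parity-suc : ∀ n → parity (suc n) ≢ parity n
    parity-suc zero          ()
    parity-suc (suc zero)    ()
    parity-suc (suc (suc n)) = parity-suc n

    parity-rigid : ∀ {m n} → m ≤ suc n → n ≤ suc m → parity m ≡ parity n → m ≡ n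
    parity-rigid {m} {n} m≤ n≤ e with ℕₚ.<-cmp m n
    ... | tri≈ _ m≡n _ = m≡n
    ... | tri< m<n _ _ = contradiction (subst (λ k → parity m ≡ parity k) (ℕₚ.≤-antisym n≤ m<n) e) (parity-suc m ∘ sym)
    ... | tri> _ _ n<m = contradiction (subst (λ k → parity k ≡ parity n) (ℕₚ.≤-antisym m≤ n<m) e) (parity-suc n)

    Even : Pred X 0ℓ
    Even x = parity (depth x) ≡ Fin.zero

    -- Components of one parity stay in a sphere around the root.
    sphere-finite : ∀ {Y} → (∀ {x y} → Y x → Y y → parity (depth x) ≡ parity (depth y)) → ∀ x → Y x → Finite (Conn Y x)
    sphere-finite {Y} same x Yx = finite-⊆ inside (ball-finite (depth x) (root x))
      where
      level : ∀ {y} → Conn Y x y → depth x ≡ depth y × Orb x y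
      level (zero , refl , _) = refl , conn-refl tt
      level {y} (suc k , z , path , g , Yy) =
        let (d≡ , o) = level (k , path) in
        trans d≡ (parity-rigid (depth-lipschitz (G-sym g)) (depth-lipschitz g) (same (conn-end (k , path)) Yy)) , orb-step o g
      inside : ∀ y → Conn Y x y → Ball (depth x) (root x) y
      inside y c = let (d≡ , o) = level c in
        subst (λ k → Ball k (root x) y) (sym d≡) (subst (λ r → Ball (depth y) r y) (sym (root-≡ o)) (proj₁ (proj₂ (depth-least y))))

    even-finite : ∀ x → Even x → Finite (Conn Even x)
    even-finite = sphere-finite λ e e′ → trans e (sym e′)

    odd-finite : ∀ x → ¬ Even x → Finite (Conn (∁ Even) x)
    odd-finite = sphere-finite λ o o′ → two o o′
      where
      two : ∀ {i j : Fin 2} → i ≢ Fin.zero → j ≢ Fin.zero → i ≡ j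
      two {Fin.zero} i≢ _ = contradiction refl i≢
      two {Fin.suc Fin.zero} {Fin.zero} _ j≢ = contradiction refl j≢
      two {Fin.suc Fin.zero} {Fin.suc Fin.zero} _ _ = refl

  -- For an equivalence R, the distance at most k in the quotient of G by R: moves inside a class
  -- are free, and loops of G turn exactly k steps into at most k.
  Reach : (X → X → Set) → ℕ → X → X → Set
  Reach R zero    x y = R x y
  Reach R (suc k) x y = ∃[ z ] Reach R k x z × (∃[ w ] G z w × R w y)

  record FiniteEquivalence (R : X → X → Set) : Set where
    field
      R-refl   : ∀ {x} → R x x
      R-sym    : ∀ {x y} → R x y → R y x
      R-trans  : ∀ {x y z} → R x y → R y z → R x z
      R-orb    : ∀ {x y} → R x y → Orb x y
      R-finite : ∀ x → Finite (R x)

    reach-R : ∀ k {x y z} → Reach R k x y → R y z → Reach R k x z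
    reach-R zero    r s = R-trans r s
    reach-R (suc k) (w , r , v , g , t) s = w , r , v , g , R-trans t s

    reach-G : ∀ k {x y z} → Reach R k x y → G y z → Reach R (suc k) x z
    reach-G k r g = _ , r , _ , g , R-refl

    reach-suc : ∀ k {x y} → Reach R k x y → Reach R (suc k) x y
    reach-suc k r = reach-G k r G-refl

    reach-mono : ∀ {j k x y} → j ℕ.≤′ k → Reach R j x y → Reach R k x y
    reach-mono ℕ.≤′-refl     r = r
    reach-mono (ℕ.≤′-step {k} l) r = reach-suc k (reach-mono l r)

    reach-trans : ∀ j k {x y z} → Reach R j x y → Reach R k y z → Reach R (k + j) x z
    reach-trans j zero    r s = reach-R j r s
    reach-trans j (suc k) r (w , s , v , g , t) = w , reach-trans j k r s , v , g , t

    reach-sym : ∀ k {x y} → Reach R k x y → Reach R k y x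
    reach-sym zero    r = R-sym r
    reach-sym (suc k) {x} {y} (z , r , w , g , t) =
      subst (λ m → Reach R m y x) (ℕₚ.+-comm k 1)
        (reach-trans 1 k (w , R-sym t , z , G-sym g , R-refl) (reach-sym k r))

    reach-finite : ∀ k x → Finite (Reach R k x)
    reach-finite zero    x = R-finite x
    reach-finite (suc k) x = finite-⋃ (reach-finite k x) λ z _ → finite-⋃ (G-finite z) λ w _ → R-finite w

    reach-orb : ∀ k {x y} → Reach R k x y → Orb x y
    reach-orb zero    r = R-orb r
    reach-orb (suc k) (z , r , w , g , t) = conn-trans (orb-step (reach-orb k r) g) (R-orb t)

  -- Twice the radius of the balls merged at stage n. Two centres whose balls share a point are
  -- within this distance, so isolation makes them equal, and merging stays transitive.
  scale : ℕ → ℕ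
  scale n = (3 + n) + (3 + n)

  Isolated : (ℕ → Pred X 0ℓ) → (X → X → Set) → ℕ → ℕ → Pred X 0ℓ
  Isolated Basic R n j a = Basic j a × ¬ (∃[ a′ ] Reach R (scale n) a a′ × Basic j a′ × ¬ a′ ≡ a)

  -- A toast.  E n has finite classes; the centres at stage n are isolated among
  -- the points of one basic open set at the scale of E n, and E (suc n) merges
  -- the balls around them.  A ring bounds a slightly smaller ball, so that two
  -- different rings are never adjacent.
  module Toast (Basic : ℕ → Pred X 0ℓ) (choose : ℕ → (X → X → Set) → ℕ) where

    E : ℕ → X → X → Set
    E zero    x y = x ≡ y
    E (suc n) x y = E n x y ⊎
      (∃[ a ] Reach (E n) (3 + n) x a × Isolated Basic (E n) n (choose n (E n)) a × Reach (E n) (3 + n) a y)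

    Centre : ℕ → Pred X 0ℓ
    Centre n = Isolated Basic (E n) n (choose n (E n))

    E-equivalence : ∀ n → FiniteEquivalence (E n)

    centre-unique : ∀ n {a a′} → Centre n a → Centre n a′ → Reach (E n) (scale n) a a′ → a ≡ a′
    centre-unique n (_ , isolated) (b′ , _) r = sym (dne λ a≢a′ → isolated (_ , r , b′ , a≢a′))

    E-equivalence zero = record
      { R-refl = refl ; R-sym = sym ; R-trans = trans ; R-orb = λ { refl → conn-refl tt }
      ; R-finite = λ x → x ∷ [] , λ { _ refl → here refl } }
    E-equivalence (suc n) = record
      { R-refl   = inj₁ R-refl
      ; R-sym    = λ
          { (inj₁ r) → inj₁ (R-sym r)
          ; (inj₂ (a , r , c , s)) → inj₂ (a , reach-sym (3 + n) s , c , reach-sym (3 + n) r) }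
      ; R-trans  = λ
          { (inj₁ r) (inj₁ s) → inj₁ (R-trans r s)
          ; (inj₁ r) (inj₂ (a , s , c , t)) →
              inj₂ (a , reach-sym (3 + n) (reach-R (3 + n) (reach-sym (3 + n) s) (R-sym r)) , c , t)
          ; (inj₂ (a , s , c , t)) (inj₁ r) → inj₂ (a , s , c , reach-R (3 + n) t r)
          ; (inj₂ (a , s , c , t)) (inj₂ (a′ , s′ , c′ , t′)) →
              inj₂ (a , s , c , subst (λ b → Reach (E n) (3 + n) b _)
                (sym (centre-unique n c c′ (reach-trans (3 + n) (3 + n) t s′))) t′) }
      ; R-orb    = λ
          { (inj₁ r) → R-orb r
          ; (inj₂ (a , s , _ , t)) → conn-trans (reach-orb (3 + n) s) (reach-orb (3 + n) t) }
      ; R-finite = λ x → finite-⊆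
          (λ { y (inj₁ r) → inj₁ r ; y (inj₂ (a , s , c , t)) → inj₂ (reach-trans (3 + n) (3 + n) s t) })
          (finite-∪ (R-finite x) (reach-finite (scale n) x))
      }
      where open FiniteEquivalence (E-equivalence n)

    E-mono : ∀ {m n x y} → m ℕ.≤′ n → E m x y → E n x y
    E-mono ℕ.≤′-refl     e = e
    E-mono (ℕ.≤′-step l) e = inj₁ (E-mono l e)

    module Eq n = FiniteEquivalence (E-equivalence n)

    -- The inner boundary of the ball of radius 1+n. Merging reaches two steps further: one step to
    -- a point of a hypothetical adjacent ring, one more to a neighbour of that point outside its
    -- own ball.
    RingAt : ℕ → X → Pred X 0ℓ
    RingAt n a y = Reach (E n) (1 + n) a y × (∃[ z ] G y z × ¬ Reach (E n) (1 + n) a z)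

    Ring : Pred X 0ℓ
    Ring y = ∃[ n ] ∃[ a ] Centre n a × RingAt n a y

    -- The later ball absorbs the 2-neighbourhood of an earlier ring it meets.
    nested : ∀ {m n a a′ y y′} → m < n → RingAt n a y → Centre m a′ → RingAt m a′ y′ → ¬ G y y′
    nested {m} {n} m<n (r , z , y~z , ¬r) c′ (r′ , _) y~y′ = ¬r (Eq.reach-R n (1 + n) r
      (E-mono (ℕₚ.≤⇒≤′ m<n) (inj₂ (_ , Eq.reach-suc m (2 + m) (Eq.reach-sym m (2 + m) near) , c′ , Eq.reach-G m (2 + m) near y~z))))
      where near = Eq.reach-G m (1 + m) r′ (G-sym y~y′)

    -- `nested` excludes adjacent rings of different stages, and at one stage two centres with
    -- adjacent rings are too close to be distinct. A component of rings therefore never leaves the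
    -- ball in which it starts.
    ring-step : ∀ {n m a a′ y y′} → Centre n a → RingAt n a y → Centre m a′ → RingAt m a′ y′ → G y y′ → RingAt n a y′
    ring-step {n} {m} c ra c′ ra′ g with ℕₚ.<-cmp m n
    ... | tri< m<n _ _ = contradiction g (nested m<n ra c′ ra′)
    ... | tri> _ _ n<m = contradiction (G-sym g) (nested n<m ra′ c ra)
    ... | tri≈ _ refl _ = subst (λ b → RingAt n b _)
            (sym (centre-unique n c c′ (Eq.reach-mono n (ℕₚ.≤⇒≤′ bound)
              (Eq.reach-trans n (2 + n) (1 + n) (Eq.reach-G n (1 + n) (proj₁ ra) g) (Eq.reach-sym n (1 + n) (proj₁ ra′)))))) ra′
      where
      bound : (1 + n) + (2 + n) ≤ scale n
      bound = ℕₚ.+-mono-≤ (ℕₚ.m≤n+m (1 + n) 2) (ℕₚ.n≤1+n (2 + n))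

    ring-finite : ∀ y → Ring y → Finite (Conn Ring y)
    ring-finite y (n , a , c , ra) = finite-⊆ (λ z conn → proj₁ (stay conn)) (Eq.reach-finite n (1 + n) a)
      where
      stay : ∀ {z} → Conn Ring y z → RingAt n a z
      stay (zero , refl , _) = ra
      stay (suc k , z , path , g , (m , a′ , c′ , ra′)) = ring-step c (stay (k , path)) c′ ra′ g

    Recurrent : Pred X 0ℓ
    Recurrent a = ∀ n₀ → ∃[ n ] n₀ ≤ n × Centre n a

    ball⇒reach : ∀ n k {x y} → Ball k x y → Reach (E n) k x y
    ball⇒reach n zero    (refl , _)         = Eq.R-refl n
    ball⇒reach n (suc k) (z , path , g , _) = Eq.reach-G n k (ball⇒reach n k path) g

    -- A walk can leave a ball only through its ring. The radius 1+n grows with the stage so that a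
    -- recurrent centre eventually has `x` in its ball, whatever the distance.
    off-ring-finite : ∀ {a x} → Recurrent a → Orb a x → ¬ Ring x → Finite (Conn (∁ Ring) x)
    off-ring-finite {a} {x} rec (k , path) _ =
      let (n , k≤n , c) = rec k in
      finite-⊆ (λ z → stay n c (Eq.reach-mono n (ℕₚ.≤⇒≤′ (ℕₚ.m≤n⇒m≤1+n k≤n)) (ball⇒reach n k path)))
               (Eq.reach-finite n (1 + n) a)
      where
      stay : ∀ n → Centre n a → Reach (E n) (1 + n) a x → ∀ {z} → Conn (∁ Ring) x z → Reach (E n) (1 + n) a z
      stay n c r (zero , refl , _) = r
      stay n c r {z} (suc k , y , path , g , _) = dne λ ¬r →
        conn-end (k , path) (n , a , c , stay n c r (k , path) , z , g , ¬r)

-- Pairing of natural numbers along the antidiagonals.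

module Pairing where
  step : ℕ × ℕ → ℕ × ℕ
  step (zero  , b) = suc b , zero
  step (suc a , b) = a , suc b

  unpair : ℕ → ℕ × ℕ
  unpair zero    = 0 , 0
  unpair (suc n) = step (unpair n)

  walk : ∀ k {n a b} → unpair n ≡ (k ℕ.+ a , b) → unpair (k ℕ.+ n) ≡ (a , k ℕ.+ b)
  walk zero    e = e
  walk (suc k) {n} {a} {b} e = trans (cong unpair (sym (ℕₚ.+-suc k n)))
    (trans (walk k {suc n} {a} {suc b} (cong step e)) (cong (a ,_) (ℕₚ.+-suc k b)))

  diagonal : ∀ s → ∃[ n ] unpair n ≡ (s , 0)
  diagonal zero    = 0 , refl
  diagonal (suc s) =
    let (n , e) = diagonal s in suc (s ℕ.+ n) ,
      trans (cong step (walk s {n} {0} {0} (trans e (cong (_, 0) (sym (ℕₚ.+-identityʳ s))))))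
            (cong (λ k → suc k , 0) (ℕₚ.+-identityʳ s))

  unpair-surjective : ∀ a b → ∃[ n ] unpair n ≡ (a , b)
  unpair-surjective a b =
    let (n , e) = diagonal (b ℕ.+ a) in
    b ℕ.+ n , trans (walk b {n} {a} {0} e) (cong (a ,_) (ℕₚ.+-identityʳ b))

  pair : ℕ → ℕ → ℕ
  pair a b = proj₁ (unpair-surjective a b)

  unpair-pair : ∀ a b → unpair (pair a b) ≡ (a , b)
  unpair-pair a b = proj₂ (unpair-surjective a b)

  proj₂-unpair≤ : ∀ n → proj₂ (unpair n) ℕ.≤ n
  proj₂-unpair≤ zero = z≤n
  proj₂-unpair≤ (suc n) with unpair n | proj₂-unpair≤ n
  ... | zero  , b | _  = z≤n
  ... | suc a , b | le = s≤s le

  -- Every value recurs as first component at arbitrarily late arguments, so each basic open set can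
  -- be targeted at infinitely many stages.
  unpair-late : ∀ m n₀ → ∃[ n ] proj₁ (unpair n) ≡ m × n₀ ℕ.≤ n
  unpair-late m n₀ = let (n , e) = unpair-surjective m n₀ in
    n , cong proj₁ e , subst (ℕ._≤ n) (cong proj₂ e) (proj₂-unpair≤ n)

-- Countable sets.

module Countability where
  open Pairing

  Countable : Set → Set
  Countable A = Σ[ e ∈ (ℕ → Maybe A) ] ∀ a → ∃[ n ] e n ≡ just a

  countable-ℕ : Countable ℕ
  countable-ℕ = just , λ n → n , refl

  countable-surjection : ∀ {A B : Set} → Countable A → (f : A → Maybe B) → (∀ b → ∃[ a ] f a ≡ just b) → Countable B
  countable-surjection {A} {B} (e , onto) f f-onto = e′ , λ b →
    let (a , fa) = f-onto b ; (n , en) = onto a in n , trans (cong bind en) fa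
    where
    bind : Maybe A → Maybe B
    bind (just a) = f a
    bind nothing  = nothing
    e′ : ℕ → Maybe B
    e′ n = bind (e n)

  countable-Σ : ∀ {A : Set} {B : A → Set} → Countable A → (∀ a → Countable (B a)) → Countable (Σ A B)
  countable-Σ {A} {B} (e , onto) c = (λ n → inner (e (proj₁ (unpair n))) (proj₂ (unpair n))) , λ (a , b) →
    let (m , em) = onto a ; (k , ek) = proj₂ (c a) b in
    pair m k , trans (cong₂ (λ i j → inner (e i) j) (cong proj₁ (unpair-pair m k)) (cong proj₂ (unpair-pair m k)))
      (trans (cong (λ x → inner x k) em) (cong (outer a) ek))
    where
    outer : ∀ a → Maybe (B a) → Maybe (Σ A B)
    outer a (just b) = just (a , b)
    outer a nothing  = nothing
    inner : Maybe A → ℕ → Maybe (Σ A B)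
    inner (just a) k = outer a (proj₁ (c a) k)
    inner nothing  k = nothing

  countable-Fin : ∀ n → Countable (Fin n)
  countable-Fin n = countable-surjection countable-ℕ f λ i → toℕ i , back i
    where
    f : ℕ → Maybe (Fin n)
    f k with k ℕₚ.<? n
    ... | yes k<n = just (Fin.fromℕ< k<n)
    ... | no  _   = nothing
    back : ∀ i → f (toℕ i) ≡ just i
    back i with toℕ i ℕₚ.<? n
    ... | yes p = cong just (Finₚ.fromℕ<-toℕ i p)
    ... | no ¬p = contradiction (Finₚ.toℕ<n i) ¬p

  countable-Vec : ∀ {A : Set} → Countable A → ∀ n → Countable (Vec A n)
  countable-Vec c zero    = countable-surjection countable-ℕ (λ _ → just []) λ { [] → 0 , refl }
  countable-Vec c (suc n) = countable-surjection (countable-Σ c λ _ → countable-Vec c n)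
    (λ { (x , xs) → just (x ∷ xs) }) λ { (x ∷ xs) → (x , xs) , refl }

  countable-List : ∀ {A : Set} → Countable A → Countable (List A)
  countable-List c = countable-surjection (countable-Σ countable-ℕ (countable-Vec c))
    (λ { (n , xs) → just (toList xs) }) λ xs → (length xs , Vec.fromList xs) , cong just (Vecₚ.toList∘fromList xs)

  optional : ∀ {A I : Set} → (I → Pred A 0ℓ) → Maybe I → Pred A 0ℓ
  optional P (just i) = P i
  optional P nothing  = ∅

  optional-all : ∀ {ℓ} {A I : Set} (T : Pred A 0ℓ → Set ℓ) {P : I → Pred A 0ℓ} → T ∅ → (∀ i → T (P i)) → ∀ m → T (optional P m)
  optional-all T t∅ t (just i) = t i
  optional-all T t∅ t nothing  = t∅

  ⋃-enumerated : ∀ {A I : Set} (c : Countable I) (P : I → Pred A 0ℓ) → ⋃ ℕ (optional P ∘ proj₁ c) ≐ ⋃ I P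
  ⋃-enumerated {A} {I} (e , onto) P = (λ {x} (n , p) → forget (e n) p) , λ {x} (i , p) →
    let (n , en) = onto i in n , subst (λ m → optional P m x) (sym en) p
    where
    forget : ∀ m {x} → optional P m x → ⋃ I P x
    forget (just i) p = i , p

-- Complete separable spaces through dyadic neighbourhoods.

-- A complete separable metric reduced to its balls of radius 2^-k: `N-half` is the triangle
-- inequality, and `complete` asks for limits of sequences whose n-th step is smaller than 2^-n.
record Uniform (X : Set) : Set₁ where
  field
    N        : ℕ → X → X → Set
    N-refl   : ∀ {k x} → N k x x
    N-sym    : ∀ {k x y} → N k x y → N k y x
    N-half   : ∀ {k x y z} → N (suc k) x y → N (suc k) y z → N k x z
    N-sep    : ∀ {x y} → (∀ k → N k x y) → x ≡ y
    N-open   : ∀ {k x y} → N k x y → ∃[ j ] ∀ z → N j y z → N k x z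
    complete : (s : ℕ → X) → (∀ n → N n (s n) (s (suc n))) →
               ∃[ x ] ∀ k → ∃[ m ] ∀ n → m ℕ.≤ n → N k (s n) x
    dense    : ℕ → Maybe X
    dense-∃  : ∀ x k → ∃[ n ] ∃[ y ] dense n ≡ just y × N k x y

  N-suc : ∀ {k x y} → N (suc k) x y → N k x y
  N-suc n = N-half n N-refl

  N-mono : ∀ {j k x y} → j ℕ.≤′ k → N k x y → N j x y
  N-mono ℕ.≤′-refl     n = n
  N-mono (ℕ.≤′-step l) n = N-mono l (N-suc n)

  Opn : Pred X 0ℓ → Set
  Opn A = ∀ x → A x → ∃[ k ] ∀ y → N k x y → A y

  Interior : Pred X 0ℓ → Pred X 0ℓ
  Interior A x = ∃[ k ] ∀ y → N k x y → A y

  interior-opn : ∀ A → Opn (Interior A)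
  interior-opn A x (k , f) = suc k , λ y n → suc k , λ z n′ → f z (N-half n n′)

  interior-⊆ : ∀ A → Interior A ⊆ A
  interior-⊆ A (k , f) = f _ N-refl

  Basic : ℕ → Pred X 0ℓ
  Basic m y = ∃[ z ] dense (proj₁ (Pairing.unpair m)) ≡ just z × N (proj₂ (Pairing.unpair m)) z y

  basic-opn : ∀ m → Opn (Basic m)
  basic-opn m y (z , e , n) = let (j , f) = N-open n in j , λ w n′ → z , e , f w n′

  basic-base : ∀ x k → ∃[ m ] Basic m x × (∀ y → Basic m y → N k x y)
  basic-base x k with dense-∃ x (suc k)
  ... | n , z , e , near = Pairing.pair n (suc k)
      , (z , trans (cong (dense ∘ proj₁) (Pairing.unpair-pair n (suc k))) e
           , subst (λ j → N j z x) (sym (cong proj₂ (Pairing.unpair-pair n (suc k)))) (N-sym near))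
      , λ { y (z′ , e′ , near′) → N-half near
              (subst (λ w → N (suc k) w y)
                (just-inj (trans (sym e′) (trans (cong (dense ∘ proj₁) (Pairing.unpair-pair n (suc k))) e)))
                (subst (λ j → N j z′ y) (cong proj₂ (Pairing.unpair-pair n (suc k))) near′)) }
    where
    just-inj : ∀ {x y : X} → just x ≡ just y → x ≡ y
    just-inj refl = refl

-- Analytic sets and the σ-algebra that they generate.

module Descriptive (em : ∀ {ℓ} → ExcludedMiddle ℓ) (ext : ∀ {a b} → Extensionality a b)
                   (X : Set) (𝓤 : Uniform X) where
  open Classical em
  open FiniteSets em
  open Pairing
  open Countability
  open Uniform 𝓤
  open import Data.Nat.Base using (_≤_; _<_; _⊔_)
  open import Data.List.Membership.Propositional renaming (_∈_ to _∈ₗ_)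

  isolate : ∀ x xs → ∃[ m ] Basic m x × (∀ y → y ∈ₗ xs → Basic m y → y ≡ x)
  isolate x xs = let (k , f) = radius xs ; (m , b , g) = basic-base x k in
    m , b , λ y e b′ → f y e (g y b′)
    where
    radius : ∀ xs → ∃[ k ] ∀ y → y ∈ₗ xs → N k x y → y ≡ x
    radius [] = 0 , λ _ ()
    radius (y ∷ xs) with radius xs | lem (y ≡ x)
    ... | k , f | inj₁ y≡x = k , λ { _ (here refl) _ → y≡x ; z (there e) → f z e }
    ... | k , f | inj₂ y≢x = let (j , ¬n) = ¬∀⇒∃¬ (λ h → y≢x (sym (N-sep h))) in
          j ⊔ k , λ { _ (here refl) n → contradiction (N-mono (ℕₚ.≤⇒≤′ (ℕₚ.m≤m⊔n j k)) n) ¬n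
                    ; z (there e) n → f z e (N-mono (ℕₚ.≤⇒≤′ (ℕₚ.m≤n⊔m j k)) n) }

  -- Relations of all arities live in the one space of sequences; coordinates act as de Bruijn
  -- indices, and `_∷ₑ_` binds a new variable 0.
  Env : Set
  Env = ℕ → X

  infixr 5 _∷ₑ_
  _∷ₑ_ : X → Env → Env
  (z ∷ₑ v) zero    = z
  (z ∷ₑ v) (suc i) = v i

  AgreeBelow : ℕ → (ℕ → ℕ) → (ℕ → ℕ) → Set
  AgreeBelow n α α′ = ∀ i → i < n → α i ≡ α′ i

  CloseBelow : ℕ → Env → Env → Set
  CloseBelow n v v′ = ∀ i → i < n → N n (v i) (v′ i)

  Closed : ((ℕ → ℕ) → Env → Set) → Set
  Closed C = ∀ α v → (∀ n → ∃[ α′ ] ∃[ v′ ] AgreeBelow n α α′ × CloseBelow n v v′ × C α′ v′) → C α v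

  -- The projections of closed subsets of the product of Baire space with the space of sequences in
  -- X.
  Analytic : Pred Env 0ℓ → Set₁
  Analytic P = Σ[ C ∈ ((ℕ → ℕ) → Env → Set) ] Closed C × (∀ v → (P v → ∃[ α ] C α v) × (∃[ α ] C α v → P v))

  close-mono : ∀ {m n v v′} → m ≤ n → CloseBelow n v v′ → CloseBelow m v v′
  close-mono m≤n close i i<m = N-mono (ℕₚ.≤⇒≤′ m≤n) (close i (ℕₚ.<-≤-trans i<m m≤n))

  -- A modulus of continuity: the first n entries of a sequence reindexed along `σ` are among its
  -- first M entries.
  bound : (σ : ℕ → ℕ) → ∀ n → ∃[ M ] n ≤ M × (∀ i → i < n → σ i < M)
  bound σ zero    = 0 , z≤n , λ _ ()
  bound σ (suc n) = let (M , n≤M , f) = bound σ n in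
    suc (M ⊔ σ n) , s≤s (ℕₚ.≤-trans n≤M (ℕₚ.m≤m⊔n M (σ n))) , λ i i<1+n →
      Sum.[ (λ i<n → ℕₚ.m≤n⇒m≤1+n (ℕₚ.≤-trans (f i i<n) (ℕₚ.m≤m⊔n M (σ n))))
          , (λ { refl → s≤s (ℕₚ.m≤n⊔m M (σ n)) }) ]′ (ℕₚ.m≤n⇒m<n∨m≡n (ℕ.s≤s⁻¹ i<1+n))

  analytic-resp : ∀ {P Q : Pred Env 0ℓ} → P ≐ Q → Analytic P → Analytic Q
  analytic-resp (P⊆Q , Q⊆P) (C , cl , f) = C , cl , λ v → (λ q → proj₁ (f v) (Q⊆P q)) , (λ e → P⊆Q (proj₂ (f v) e))

  analytic-coordinate : ∀ i (F : Pred X 0ℓ) → (∀ x → (∀ n → ∃[ y ] N n x y × F y) → F x) → Analytic (λ v → F (v i))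
  analytic-coordinate i F F-closed = (λ _ v → F (v i)) , closed , λ v → ((λ _ → 0) ,_) , proj₂
    where
    closed : Closed (λ _ v → F (v i))
    closed α v approx = F-closed (v i) λ n →
      let (_ , v′ , _ , close , Fv′) = approx (n ⊔ suc i) in
      v′ i , N-mono (ℕₚ.≤⇒≤′ (ℕₚ.m≤m⊔n n (suc i))) (close i (ℕₚ.m≤n⊔m n (suc i))) , Fv′

  analytic-⋃ : (P : ℕ → Pred Env 0ℓ) → (∀ n → Analytic (P n)) → Analytic (⋃ ℕ P)
  analytic-⋃ P an = C , closed , λ v →
      (λ { (n , p) → let (α , c) = proj₁ (proj₂ (proj₂ (an n)) v) p in (λ { zero → n ; (suc i) → α i }) , c })
    , (λ { (α , c) → α 0 , proj₂ (proj₂ (proj₂ (an (α 0))) v) (α ∘ suc , c) })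
    where
    C : (ℕ → ℕ) → Env → Set
    C α v = proj₁ (an (α 0)) (α ∘ suc) v
    closed : Closed C
    closed α v approx = proj₁ (proj₂ (an (α 0))) (α ∘ suc) v λ n →
      let (α′ , v′ , agree , close , c) = approx (suc n) in
      α′ ∘ suc , v′ , (λ i i<n → agree (suc i) (s≤s i<n)) , close-mono (ℕₚ.n≤1+n n) close
      , subst (λ k → proj₁ (an k) (α′ ∘ suc) v′) (sym (agree 0 (s≤s z≤n))) c

  analytic-∅ : Analytic ∅
  analytic-∅ = (λ _ _ → ⊥) , (λ α v approx → case approx 0 of λ ()) , λ v → (λ ()) , λ ()

  analytic-⋃ᶜ : ∀ {I : Set} → Countable I → (P : I → Pred Env 0ℓ) → (∀ i → Analytic (P i)) → Analytic (⋃ I P)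
  analytic-⋃ᶜ c P an = analytic-resp (⋃-enumerated c P)
    (analytic-⋃ _ λ n → optional-all Analytic analytic-∅ an (proj₁ c n))

  -- One sequence of naturals stores the witnesses for all `m`, in the columns of the pairing
  -- function.
  analytic-⋂ : (P : ℕ → Pred Env 0ℓ) → (∀ n → Analytic (P n)) → Analytic (λ v → ∀ n → P n v)
  analytic-⋂ P an = C , closed , λ v →
      (λ p → let α : ℕ → ℕ → ℕ
                 α m = proj₁ (proj₁ (proj₂ (proj₂ (an m)) v) (p m))
             in (λ k → uncurry α (unpair k)) , λ m →
               subst (λ β → proj₁ (an m) β v) (sym (ext λ i → cong (uncurry α) (unpair-pair m i)))
                     (proj₂ (proj₁ (proj₂ (proj₂ (an m)) v) (p m))))
    , (λ { (α , c) m → proj₂ (proj₂ (proj₂ (an m)) v) (α ∘ pair m , c m) })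
    where
    C : (ℕ → ℕ) → Env → Set
    C α v = ∀ m → proj₁ (an m) (α ∘ pair m) v
    closed : Closed C
    closed α v approx m = proj₁ (proj₂ (an m)) (α ∘ pair m) v λ n →
      let (M , n≤M , f) = bound (pair m) n ; (α′ , v′ , agree , close , c) = approx M in
      α′ ∘ pair m , v′ , (λ i i<n → agree (pair m i) (f i i<n)) , close-mono n≤M close , c m

  analytic-∪ : ∀ {P Q : Pred Env 0ℓ} → Analytic P → Analytic Q → Analytic (P ∪ Q)
  analytic-∪ {P} {Q} p q = analytic-resp
    ((λ { (zero , x) → inj₁ x ; (suc _ , x) → inj₂ x }) , λ { (inj₁ x) → 0 , x ; (inj₂ x) → 1 , x })
    (analytic-⋃ (λ { zero → P ; (suc _) → Q }) (λ { zero → p ; (suc _) → q }))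

  analytic-∩ : ∀ {P Q : Pred Env 0ℓ} → Analytic P → Analytic Q → Analytic (P ∩ Q)
  analytic-∩ {P} {Q} p q = analytic-resp
    ((λ f → f 0 , f 1) , λ { (x , y) zero → x ; (x , y) (suc _) → y })
    (analytic-⋂ (λ { zero → P ; (suc _) → Q }) (λ { zero → p ; (suc _) → q }))

  analytic-rename : ∀ (σ : ℕ → ℕ) {P : Pred Env 0ℓ} → Analytic P → Analytic (λ v → P (v ∘ σ))
  analytic-rename σ (C , cl , f) = (λ α v → C α (v ∘ σ))
    , (λ α v approx → cl α (v ∘ σ) λ n →
        let (M , n≤M , b) = bound σ n ; (α′ , v′ , agree , close , c) = approx M in
        α′ , v′ ∘ σ , (λ i i<n → agree i (ℕₚ.<-≤-trans i<n n≤M))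
        , (λ i i<n → N-mono (ℕₚ.≤⇒≤′ n≤M) (close (σ i) (b i i<n))) , c)
    , λ v → f (v ∘ σ)

  -- A point of X is coded by the indices of points of the dense set near it.
  Coded : (ℕ → ℕ) → X → Set
  Coded β z = ∀ n k → ∃[ z′ ] N k z z′ × (∃[ y ] dense (β n) ≡ just y × N n y z′)

  -- Arbitrarily close to `z` and to `w` there are points in the ball around one common dense point;
  -- the two spare levels pay for the four steps from `z` to `w`.
  coded-near : ∀ {β β′ n z w} → Coded β z → Coded β′ w → β (2 ℕ.+ n) ≡ β′ (2 ℕ.+ n) → N n z w
  coded-near {β} {β′} {n} cz cw e with cz (2 ℕ.+ n) (2 ℕ.+ n) | cw (2 ℕ.+ n) (2 ℕ.+ n)
  ... | z′ , zz′ , y , d , yz′ | w′ , ww′ , y′ , d′ , y′w′ =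
    N-half (N-half zz′ (N-sym yz′)) (N-half (subst (λ u → N (2 ℕ.+ n) u w′) (just-inj (trans (sym d′) (trans (cong dense (sym e)) d))) y′w′) (N-sym ww′))
    where
    just-inj : ∀ {x y : X} → just x ≡ just y → x ≡ y
    just-inj refl = refl

  -- One column of `α` codes the bound point, another is the witness for P. A projection along X
  -- alone need not preserve closedness; the code forces the points of approximating triples to form
  -- a Cauchy sequence, and completeness supplies the limit.
  analytic-∃ : {P : Pred Env 0ℓ} → Analytic P → Analytic (λ v → ∃[ z ] P (z ∷ₑ v))
  analytic-∃ {P} (C , cl , f) = C′ , closed , λ v → to v , λ { (α , z , _ , c) → z , proj₂ (f (z ∷ₑ v)) (α ∘ pair 1 , c) }
    where
    C′ : (ℕ → ℕ) → Env → Set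
    C′ α v = ∃[ z ] Coded (α ∘ pair 0) z × C (α ∘ pair 1) (z ∷ₑ v)
    to : ∀ v → ∃[ z ] P (z ∷ₑ v) → ∃[ α ] C′ α v
    to v (z , p) = α , z , coded , subst (λ β → C β (z ∷ₑ v)) (sym (ext λ i → cong combine (unpair-pair 1 i))) c
      where
      γ : ℕ → ℕ
      γ = proj₁ (proj₁ (f (z ∷ₑ v)) p)
      c : C γ (z ∷ₑ v)
      c = proj₂ (proj₁ (f (z ∷ₑ v)) p)
      combine : ℕ × ℕ → ℕ
      combine (zero  , i) = proj₁ (dense-∃ z i)
      combine (suc _ , i) = γ i
      α : ℕ → ℕ
      α k = combine (unpair k)
      coded : Coded (α ∘ pair 0) z
      coded n k = let (_ , y , e , near) = dense-∃ z n in
        z , N-refl , y , trans (cong (dense ∘ combine) (unpair-pair 0 n)) e , N-sym near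
    closed : Closed C′
    closed α v approx = z , coded , cl (α ∘ pair 1) (z ∷ₑ v) approx′
      where
      -- The second summand makes the code of `s n` agree with `α` up to entry 2+n, as `coded-near`
      -- requires for consecutive points; the first ensures precision at least n.
      M : ℕ → ℕ
      M n = n ℕ.+ proj₁ (bound (pair 0) (3 ℕ.+ n))
      αs : ℕ → ℕ → ℕ
      αs n = proj₁ (approx (M n))
      vs : ℕ → Env
      vs n = proj₁ (proj₂ (approx (M n)))
      agree : ∀ n → AgreeBelow (M n) α (αs n)
      agree n = proj₁ (proj₂ (proj₂ (approx (M n))))
      close : ∀ n → CloseBelow (M n) v (vs n)
      close n = proj₁ (proj₂ (proj₂ (proj₂ (approx (M n)))))
      s : ℕ → X
      s n = proj₁ (proj₂ (proj₂ (proj₂ (proj₂ (approx (M n))))))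
      s-coded : ∀ n → Coded (αs n ∘ pair 0) (s n)
      s-coded n = proj₁ (proj₂ (proj₂ (proj₂ (proj₂ (proj₂ (approx (M n)))))))
      s-C : ∀ n → C (αs n ∘ pair 1) (s n ∷ₑ vs n)
      s-C n = proj₂ (proj₂ (proj₂ (proj₂ (proj₂ (proj₂ (approx (M n)))))))
      same : ∀ {i n} → i ≤ 2 ℕ.+ n → α (pair 0 i) ≡ αs n (pair 0 i)
      same {i} {n} i≤ = agree n (pair 0 i) (ℕₚ.<-≤-trans
        (proj₂ (proj₂ (bound (pair 0) (3 ℕ.+ n))) i (s≤s i≤)) (ℕₚ.m≤n+m _ n))
      limit : ∃[ z ] ∀ k → ∃[ m ] ∀ n → m ≤ n → N k (s n) z
      limit = complete s λ n → coded-near (s-coded n) (s-coded (suc n))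
        (trans (sym (same ℕₚ.≤-refl)) (same (ℕₚ.n≤1+n (2 ℕ.+ n))))
      z : X
      z = proj₁ limit
      coded : Coded (α ∘ pair 0) z
      coded i k =
        let (m , near) = proj₂ limit (suc k)
            n = m ⊔ i
            (z′ , sz′ , y , d , yz′) = s-coded n i (suc k)
        in z′ , N-half (N-sym (near n (ℕₚ.m≤m⊔n m i))) sz′ , y
           , trans (cong dense (same (ℕₚ.≤-trans (ℕₚ.m≤n⊔m m i) (ℕₚ.m≤n+m n 2)))) d , yz′
      approx′ : ∀ n → ∃[ α′ ] ∃[ v′ ] AgreeBelow n (α ∘ pair 1) α′ × CloseBelow n (z ∷ₑ v) v′ × C α′ v′
      approx′ n =
        let (m , near) = proj₂ limit n
            (M₁ , n≤M₁ , b) = bound (pair 1) n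
            k = m ⊔ M₁
            M₁≤Mk : M₁ ≤ M k
            M₁≤Mk = ℕₚ.≤-trans (ℕₚ.m≤n⊔m m M₁) (ℕₚ.m≤m+n k _)
        in αs k ∘ pair 1 , s k ∷ₑ vs k
           , (λ i i<n → agree k (pair 1 i) (ℕₚ.<-≤-trans (b i i<n) M₁≤Mk))
           , (λ { zero _ → N-sym (near k (ℕₚ.m≤m⊔n m M₁))
                ; (suc i) i<n → close-mono (ℕₚ.≤-trans n≤M₁ M₁≤Mk) (close k) i (ℕₚ.<-trans (ℕₚ.n<1+n i) i<n) })
           , s-C k

  -- By Suslin's theorem on analytic sets with analytic complement these are the Borel sets; in this
  -- form closure under complements is immediate.
  Δ : Pred Env 0ℓ → Set₁
  Δ P = Analytic P × Analytic (∁ P)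

  Δ-resp : ∀ {P Q : Pred Env 0ℓ} → P ≐ Q → Δ P → Δ Q
  Δ-resp (f , g) (p , p′) = analytic-resp (f , g) p , analytic-resp ((λ ¬p q → ¬p (g q)) , (λ ¬q p → ¬q (f p))) p′

  Δ-∁ : ∀ {P : Pred Env 0ℓ} → Δ P → Δ (∁ P)
  Δ-∁ (p , p′) = p′ , analytic-resp ((λ x ¬x → ¬x x) , dne) p

  Δ-⋃ : (P : ℕ → Pred Env 0ℓ) → (∀ n → Δ (P n)) → Δ (⋃ ℕ P)
  Δ-⋃ P δ = analytic-⋃ P (proj₁ ∘ δ) ,
    analytic-resp ((λ { f (n , x) → f n x }) , λ f n x → f (n , x)) (analytic-⋂ (λ n → ∁ (P n)) (proj₂ ∘ δ))

  -- An open set is the union of the closed sets `F k` of points that lie at distance at least 2^-k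
  -- from its complement.
  Δ-opn : ∀ i {O : Pred X 0ℓ} → Opn O → Δ (λ v → O (v i))
  Δ-opn i {O} opn =
      analytic-resp
        ( (λ { {v} (k , f) → dne λ ¬o → f (v i) ¬o N-refl })
        , (λ {v} o → let (k , f) = opn (v i) o in k , λ y ¬o n → ¬o (f y n)))
        (analytic-⋃ (λ k v → F k (v i)) λ k → analytic-coordinate i (F k) (F-closed k))
    , analytic-coordinate i (∁ O) λ x approx o →
        let (k , f) = opn x o ; (y , n , ¬o) = approx k in ¬o (f y n)
    where
    F : ℕ → Pred X 0ℓ
    F k x = ∀ y → ¬ O y → ¬ N k x y
    F-closed : ∀ k x → (∀ n → ∃[ y ] N n x y × F k y) → F k x
    F-closed k x approx y ¬o n =
      let (j , f) = N-open (N-sym n) ; (x′ , near , Fx′) = approx j in Fx′ y ¬o (N-sym (f x′ near))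

  Δ-borel : ∀ i {𝒪 : Pred (Pred X 0ℓ) (lsuc 0ℓ)} → (∀ A → 𝒪 A → Opn A) → ∀ {A} → Generated 𝒪 A → Δ (λ v → A (v i))
  Δ-borel i opn (gen o)       = Δ-opn i (opn _ o)
  Δ-borel i opn gen-∅         = Δ-opn i λ _ ()
  Δ-borel i opn (gen-∁ g)     = Δ-∁ (Δ-borel i opn g)
  Δ-borel i opn (gen-⋃ A g)   = Δ-⋃ (λ n v → A n (v i)) λ n → Δ-borel i opn (g n)
  Δ-borel i opn (resp (f , h) g) = Δ-resp (f , h) (Δ-borel i opn g)

  Δ-∪ : ∀ {P Q : Pred Env 0ℓ} → Δ P → Δ Q → Δ (P ∪ Q)
  Δ-∪ (p , p′) (q , q′) = analytic-∪ p q ,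
    analytic-resp ((λ { (f , g) (inj₁ x) → f x ; (f , g) (inj₂ y) → g y }) , λ h → h ∘ inj₁ , h ∘ inj₂) (analytic-∩ p′ q′)

  Δ-∩ : ∀ {P Q : Pred Env 0ℓ} → Δ P → Δ Q → Δ (P ∩ Q)
  Δ-∩ {P} {Q} (p , p′) (q , q′) = analytic-∩ p q ,
    analytic-resp ((λ { (inj₁ f) (x , _) → f x ; (inj₂ g) (_ , y) → g y })
                  , λ {v} h → Sum.[ (λ x → inj₂ λ y → h (x , y)) , inj₁ ]′ (lem (P v))) (analytic-∪ p′ q′)

  -- Distinct points are separated by one of countably many basic open sets.
  Δ-≡ : ∀ i j → Δ (λ v → v i ≡ v j)
  Δ-≡ i j = Δ-resp
    ( (λ {v} none → dne λ ne → none (let (k , ¬n) = ¬∀⇒∃¬ (λ h → ne (N-sep h))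
                                         (m , b , g) = basic-base (v i) k in m , b , λ b′ → ¬n (g (v j) b′)))
    , (λ { {v} e (m , b , ¬b) → ¬b (subst (Basic m) e b) }))
    (Δ-∁ (Δ-⋃ (λ m v → Basic m (v i) × ¬ Basic m (v j)) λ m → Δ-∩ (Δ-opn i (basic-opn m)) (Δ-∁ (Δ-opn j (basic-opn m)))))

  𝒟 : Pred (Pred Env 0ℓ) (lsuc 0ℓ)
  𝒟 = Generated Analytic

  𝒟-Δ : ∀ {P} → Δ P → 𝒟 P
  𝒟-Δ = gen ∘ proj₁

  𝒟-⋃ : ∀ {I : Set} → Countable I → (P : I → Pred Env 0ℓ) → (∀ i → 𝒟 (P i)) → 𝒟 (⋃ I P)
  𝒟-⋃ c P d = resp (⋃-enumerated c P) (gen-⋃ _ λ n → optional-all 𝒟 gen-∅ d (proj₁ c n))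

  𝒟-⋂ : ∀ {I : Set} → Countable I → (P : I → Pred Env 0ℓ) → (∀ i → 𝒟 (P i)) → 𝒟 (λ v → ∀ i → P i v)
  𝒟-⋂ c P d = resp ((λ f i → dne λ ¬p → f (i , ¬p)) , λ { f (i , ¬p) → ¬p (f i) })
    (gen-∁ (𝒟-⋃ c (λ i → ∁ (P i)) λ i → gen-∁ (d i)))

  𝒟-∪ : ∀ {P Q : Pred Env 0ℓ} → 𝒟 P → 𝒟 Q → 𝒟 (P ∪ Q)
  𝒟-∪ {P} {Q} p q = resp
    ((λ { (zero , x) → inj₁ x ; (suc _ , x) → inj₂ x }) , λ { (inj₁ x) → 0 , x ; (inj₂ x) → 1 , x })
    (gen-⋃ (λ { zero → P ; (suc _) → Q }) (λ { zero → p ; (suc _) → q }))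

  𝒟-∩ : ∀ {P Q : Pred Env 0ℓ} → 𝒟 P → 𝒟 Q → 𝒟 (P ∩ Q)
  𝒟-∩ {P} {Q} p q = resp
    ((λ f → f 0 , f 1) , λ { (x , y) zero → x ; (x , y) (suc _) → y })
    (𝒟-⋂ countable-ℕ (λ { zero → P ; (suc _) → Q }) (λ { zero → p ; (suc _) → q }))

  𝒟-const : ∀ (P : Set) → 𝒟 (λ _ → P)
  𝒟-const P with lem P
  ... | inj₁ p  = resp ((λ _ → p) , λ _ ()) (gen-∁ gen-∅)
  ... | inj₂ ¬p = resp ((λ ()) , λ p → contradiction p ¬p) gen-∅

  -- Finite sections: on the set where exactly one z ∈ Basic m is R-related to
  -- v, passing from v to this z commutes with all σ-algebra operations.
  𝒟-∃ : ∀ {R Φ : Pred Env 0ℓ} → Analytic R → (∀ v → Finite (λ z → R (z ∷ₑ v))) → 𝒟 Φ →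
        𝒟 (λ v → ∃[ z ] R (z ∷ₑ v) × Φ (z ∷ₑ v))
  𝒟-∃ {R} {Φ} R-analytic R-finite Φ-𝒟 = resp (union , split) (gen-⋃ (λ m → At m Φ) λ m → at m Φ-𝒟)
    where
    Hit : ℕ → Pred Env 0ℓ
    Hit m w = R w × Basic m (w 0)
    Twice : ℕ → Pred Env 0ℓ
    Twice m v = ∃[ z ] ∃[ z′ ] Hit m (z ∷ₑ v) × Hit m (z′ ∷ₑ v) × ¬ z ≡ z′
    Once : ℕ → Pred Env 0ℓ
    Once m v = (∃[ z ] Hit m (z ∷ₑ v)) × ¬ Twice m v
    At : ℕ → Pred Env 0ℓ → Pred Env 0ℓ
    At m Ψ v = Once m v × (∃[ z ] Hit m (z ∷ₑ v) × Ψ (z ∷ₑ v))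
    hit-analytic : ∀ m → Analytic (Hit m)
    hit-analytic m = analytic-∩ R-analytic (proj₁ (Δ-opn 0 (basic-opn m)))
    -- Omits variable 1: under the binders of z and z′ it yields the environment of z′ without z.
    skip : ℕ → ℕ
    skip zero    = 0
    skip (suc i) = suc (suc i)
    twice-analytic : ∀ m → Analytic (Twice m)
    twice-analytic m = analytic-∃ (analytic-resp
      ( (λ { {w} (z′ , h , h′ , ne) → z′ , h , subst (Hit m) (skip-≡ w z′) h′ , ne })
      , (λ { {w} (z′ , h , h′ , ne) → z′ , h , subst (Hit m) (sym (skip-≡ w z′)) h′ , ne }))
      (analytic-∃ {P = λ w → Hit m (w ∘ suc) × Hit m (w ∘ skip) × ¬ w 1 ≡ w 0}
        (analytic-∩ (analytic-rename suc (hit-analytic m))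
          (analytic-∩ (analytic-rename skip (hit-analytic m)) (proj₂ (Δ-≡ 1 0))))))
      where
      skip-≡ : ∀ w z′ → (z′ ∷ₑ w) ∘ skip ≡ z′ ∷ₑ (w ∘ suc)
      skip-≡ w z′ = ext λ { zero → refl ; (suc i) → refl }
    once-𝒟 : ∀ m → 𝒟 (Once m)
    once-𝒟 m = 𝒟-∩ (gen (analytic-∃ (hit-analytic m))) (gen-∁ (gen (twice-analytic m)))
    same : ∀ {m v z z′} → Once m v → Hit m (z ∷ₑ v) → Hit m (z′ ∷ₑ v) → z ≡ z′
    same (_ , ¬twice) h h′ = dne λ ne → ¬twice (_ , _ , h , h′ , ne)
    at : ∀ m {Ψ} → 𝒟 Ψ → 𝒟 (At m Ψ)
    at m (gen a)  = 𝒟-∩ (once-𝒟 m) (gen (analytic-∃ (analytic-∩ (hit-analytic m) a)))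
    at m gen-∅    = resp ((λ ()) , λ { (_ , _ , _ , ()) }) gen-∅
    at m (gen-∁ {Ψ} d) = resp
      ( (λ { (o@((z , h) , _) , ¬a) → o , z , h , λ ψ → ¬a (o , z , h , ψ) })
      , (λ { {v} (o , z , h , ¬ψ) → o , λ { (_ , z′ , h′ , ψ) → ¬ψ (subst (λ y → Ψ (y ∷ₑ v)) (same {m} {v} o h′ h) ψ) } }))
      (𝒟-∩ (once-𝒟 m) (gen-∁ (at m d)))
    at m (gen-⋃ A d) = resp
      ( (λ { (n , o , z , h , ψ) → o , z , h , n , ψ }) , (λ { (o , z , h , n , ψ) → n , o , z , h , ψ }))
      (gen-⋃ (λ n → At m (A n)) λ n → at m (d n))
    at m (resp (f , g) d) = resp
      ((λ { (o , z , h , ψ) → o , z , h , f ψ }) , λ { (o , z , h , ψ) → o , z , h , g ψ }) (at m d)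
    union : ∀ {v} → ⋃ ℕ (λ m → At m Φ) v → ∃[ z ] R (z ∷ₑ v) × Φ (z ∷ₑ v)
    union (m , _ , z , (r , _) , φ) = z , r , φ
    -- A member of a finite section has a basic neighbourhood free of the other members, so every
    -- witness is the unique one for some `m`.
    split : ∀ {v} → ∃[ z ] R (z ∷ₑ v) × Φ (z ∷ₑ v) → ⋃ ℕ (λ m → At m Φ) v
    split {v} (z , r , φ) =
      let (xs , cover) = R-finite v ; (m , b , only) = isolate z xs in
      m , ((z , r , b) , λ { (y , y′ , (ry , by) , (ry′ , by′) , ne) →
             ne (trans (only y (cover y ry) by) (sym (only y′ (cover y′ ry′) by′))) })
        , z , (r , b) , φ

-- Dyadic radii.

module Archimedean where
  open ℚ-Order
  open import Data.Rational.Base using (_≤_; _<_; _+_; _*_)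
  open ℚ-Solver.+-*-Solver

  0≤fromℕℚ : ∀ n → 0ℚ ≤ fromℕℚ n
  0≤fromℕℚ n = ℚₚ.nonNegative⁻¹ (fromℕℚ n) {{ℚₚ.normalize-nonNeg n 1}}

  1≤fromℕℚ-suc : ∀ n → 1ℚ ≤ fromℕℚ (suc n)
  1≤fromℕℚ-suc n = ℚₚ.≤-trans (ℚₚ.≤-reflexive (sym (ℚₚ.+-identityʳ 1ℚ)))
    (ℚₚ.≤-trans (ℚₚ.+-monoʳ-≤ 1ℚ (0≤fromℕℚ n)) (ℚₚ.≤-reflexive (sym (fromℕℚ-suc n))))

  0<fromℕℚ-suc : ∀ n → 0ℚ < fromℕℚ (suc n)
  0<fromℕℚ-suc n = ℚₚ.<-≤-trans (ℚₚ.positive⁻¹ 1ℚ) (1≤fromℕℚ-suc n)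

  radius : ℕ → ℚ
  radius = pow ½

  0<radius : ∀ k → 0ℚ < radius k
  0<radius k = 0<pow k (ℚₚ.positive⁻¹ ½)

  radius-half : ∀ k → radius (suc k) + radius (suc k) ≡ radius k
  radius-half k = solve 1 (λ r → con ½ :* r :+ con ½ :* r := r) refl (radius k)

  radius-bound : ∀ k → radius k * fromℕℚ (suc k) ≤ 1ℚ
  radius-bound zero    = ℚₚ.≤-reflexive refl
  radius-bound (suc k) = begin
    ½ * r * fromℕℚ (2 ℕ.+ k)                 ≡⟨ cong (λ z → ½ * r * z) (fromℕℚ-suc (suc k)) ⟩
    ½ * r * (1ℚ + n)                         ≡⟨ solve 2 (λ r n → con ½ :* r :* (con 1ℚ :+ n) := con ½ :* (r :* con 1ℚ) :+ con ½ :* (r :* n)) refl r n ⟩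
    ½ * (r * 1ℚ) + ½ * (r * n)               ≤⟨ ℚₚ.+-mono-≤ (*-monoˡ {½} 0≤½ (ℚₚ.≤-trans (*-monoˡ (ℚₚ.<⇒≤ (0<radius k)) (1≤fromℕℚ-suc k)) (radius-bound k)))
                                                             (*-monoˡ {½} 0≤½ (radius-bound k)) ⟩
    ½ * 1ℚ + ½ * 1ℚ                          ≡⟨ refl ⟩
    1ℚ                                       ∎
    where
    open ℚₚ.≤-Reasoning
    r n : ℚ
    r = radius k
    n = fromℕℚ (suc k)
    0≤½ : 0ℚ ≤ ½
    0≤½ = ℚₚ.nonNegative⁻¹ ½

  unit-fraction≤ : ∀ ε → 0ℚ < ε → ∃[ n ] (+ 1 ℚ./ suc n) ≤ ε
  unit-fraction≤ ε@(ℚ.mkℚ (+ zero) d _) 0<ε = contradiction 0<ε λ { (ℚ.*<* (ℤ.+<+ ())) }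
  unit-fraction≤ ε@(ℚ.mkℚ (ℤ.-[1+ _ ]) d _) 0<ε = contradiction 0<ε λ { (ℚ.*<* ()) }
  unit-fraction≤ ε@(ℚ.mkℚ (+ suc m) d _) 0<ε = d , (begin
    + 1 ℚ./ suc d                         ≡⟨ ℚₚ.*-identityˡ _ ⟨
    1ℚ * (+ 1 ℚ./ suc d)                  ≤⟨ *-monoʳ (ℚₚ.nonNegative⁻¹ _ {{ℚₚ.normalize-nonNeg 1 (suc d)}}) (1≤fromℕℚ-suc m) ⟩
    fromℕℚ (suc m) * (+ 1 ℚ./ suc d)      ≡⟨ m/n≡m*1/n (suc m) (suc d) ⟨
    + suc m ℚ./ suc d                     ≡⟨ ℚₚ.↥p/↧p≡p ε ⟩
    ε                                     ∎)
    where open ℚₚ.≤-Reasoning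

  radius-small : ∀ ε → 0ℚ < ε → ∃[ k ] radius k ≤ ε
  radius-small ε 0<ε = let (n , le) = unit-fraction≤ ε 0<ε in
    n , ℚₚ.≤-trans (ℚₚ.*-cancelʳ-≤-pos (fromℕℚ (suc n)) {{ℚ.positive (0<fromℕℚ-suc n)}}
          (ℚₚ.≤-trans (radius-bound n) (ℚₚ.≤-reflexive (sym (1/n*n≡1 (suc n)))))) le

-- From a Polish topology to dyadic neighbourhoods.

module Metrization {X : Set} (τ : Topology X) (polish : Polish τ) where
  open ℚ-Order
  open Archimedean
  open import Data.Rational.Base using (_≤_; _<_; _+_; _-_)

  private
    d : Metric X
    d = proj₁ (proj₂ polish)
    open Metric d using (dist; dist≃0; dist-sym; dist-tri)
    open Equivalence

    Near : ℚ → X → X → Set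
    Near ε x y = dist x y <ℚ ε

    near-refl : ∀ {ε x} → 0ℚ < ε → Near ε x x
    near-refl {x = x} 0<ε = proj₁ (from (dist≃0 x x) refl) (0 , 0<ε)

    near-tri : ∀ {ε δ x y z} → Near ε x y → Near δ y z → Near (ε + δ) x z
    near-tri p q = dist-tri _ _ _ (_ , _ , p , q , ℚₚ.≤-refl)

    near-≤ : ∀ {ε δ x y} → ε ≤ δ → Near ε x y → Near δ x y
    near-≤ ε≤δ p = ℝ≥0.upward (dist _ _) p ε≤δ

    record N (k : ℕ) (x y : X) : Set where
      constructor near
      field within : Near (radius k) x y
    open N

    N-half : ∀ {k x y z} → N (suc k) x y → N (suc k) y z → N k x z
    N-half {k} (near p) (near q) = near (near-≤ (ℚₚ.≤-reflexive (radius-half k)) (near-tri p q))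

    N-sym : ∀ {k x y} → N k x y → N k y x
    N-sym {x = x} {y} (near p) = near (proj₁ (dist-sym y x) p)

    N-refl : ∀ {k x} → N k x x
    N-refl {k} = near (near-refl (0<radius k))

    N-open : ∀ {k x y} → N k x y → ∃[ j ] ∀ z → N j y z → N k x z
    N-open {k} {x} {y} (near n) =
      let (r , r<k , p) = ℝ≥0.open′ (dist x y) n
          (j , le) = radius-small (radius k - r) (subst (_< radius k - r) (ℚₚ.+-inverseʳ r) (ℚₚ.+-monoˡ-< (ℚ.- r) r<k))
      in j , λ z (near q) → near (near-≤ (ℚₚ.≤-trans (ℚₚ.+-monoʳ-≤ r le)
           (ℚₚ.≤-reflexive (solve 2 (λ r s → r :+ (s :- r) := s) refl r (radius k)))) (near-tri p q))
      where open ℚ-Solver.+-*-Solver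

    N-sep : ∀ {x y} → (∀ k → N k x y) → x ≡ y
    N-sep {x} {y} h = to (dist≃0 x y)
      ( (λ { (_ , 0<ε) → let (k , le) = radius-small _ 0<ε in near-≤ le (within (h k)) })
      , λ a → 0 , ℝ≥0.positive (dist x y) a)

    -- `N-half` sums the geometric series: all steps from m+1 on stay together below 2^-m.
    chain : ∀ (s : ℕ → X) → (∀ n → N n (s n) (s (suc n))) → ∀ j m → N m (s (suc m)) (s (suc m ℕ.+ j))
    chain s close zero    m = subst (λ i → N m (s (suc m)) (s (suc i))) (sym (ℕₚ.+-identityʳ m)) N-refl
    chain s close (suc j) m = subst (λ i → N m (s (suc m)) (s (suc i))) (sym (ℕₚ.+-suc m j))
                                (N-half (close (suc m)) (chain s close j (suc m)))

    tail : ∀ (s : ℕ → X) → (∀ n → N n (s n) (s (suc n))) → ∀ {m n} → suc m ℕ.≤ n → N m (s (suc m)) (s n)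
    tail s close {m} le = subst (λ i → N m (s (suc m)) (s i)) (ℕₚ.m+[n∸m]≡n le) (chain s close _ m)

  open⇔ : ∀ A → Topology.Open τ A ⇔ (∀ x → A x → ∃[ k ] ∀ y → N k x y → A y)
  open⇔ A = mk⇔
    (λ o x a → let (ε , 0<ε , f) = to (proj₂ (proj₂ (proj₂ polish)) A) o x a ; (k , le) = radius-small ε 0<ε in
               k , λ y n → f y (near-≤ le (within n)))
    (λ h → from (proj₂ (proj₂ (proj₂ polish)) A) λ x a → let (k , f) = h x a in radius k , 0<radius k , λ y n → f y (near n))

  uniform : Uniform X
  uniform = record
    { N = N
    ; N-refl = N-refl
    ; N-sym = N-sym
    ; N-half = N-half
    ; N-sep = N-sep
    ; N-open = N-open
    ; complete = λ s close →
        let (x , conv) = proj₁ (proj₂ (proj₂ polish)) s λ ε 0<ε →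
              let (k , le) = radius-small ε 0<ε in
              -- `tail` loses one level, and joining two tails loses another.
              2 ℕ.+ k , λ m n m≥ n≥ → near-≤ le (within (N-half (N-sym (tail s close m≥)) (tail s close n≥)))
        in x , λ k → let (m , f) = conv (radius k) (0<radius k) in m , λ n le → near (f n le)
    ; dense = proj₁ (proj₁ polish)
    ; dense-∃ = λ x k →
        let (y , n , (m , e)) = proj₂ (proj₁ polish) x (N k x) (from (open⇔ (N k x)) (λ y → N-open)) N-refl in
        m , y , e , n
    }

-- Meager sets and the Baire property.

module Category (em : ∀ {ℓ} → ExcludedMiddle ℓ) (ext : ∀ {a b} → Extensionality a b)
                (X : Set) (τ : Topology X) (𝓤 : Uniform X)
                (open⇔ : ∀ A → Topology.Open τ A ⇔ Uniform.Opn 𝓤 A) where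
  open Classical em
  open Pairing
  open Countability
  open Uniform 𝓤
  open Descriptive em ext X 𝓤
  open Equivalence

  opn⇒open : ∀ {A} → Opn A → Topology.Open τ A
  opn⇒open {A} = from (open⇔ A)

  open⇒opn : ∀ {A} → Topology.Open τ A → Opn A
  open⇒opn {A} = to (open⇔ A)

  closure-mono : ∀ {A B} → A ⊆ B → Closure τ A ⊆ Closure τ B
  closure-mono A⊆B cl V o Vx = let (y , Vy , Ay) = cl V o Vx in y , Vy , A⊆B Ay

  nowhereDense-⊆ : ∀ {A B} → A ⊆ B → NowhereDense τ B → NowhereDense τ A
  nowhereDense-⊆ A⊆B nd V o V⊆ = nd V o λ v → closure-mono A⊆B (V⊆ v)

  meager-⊆ : ∀ {A B} → A ⊆ B → Meager τ B → Meager τ A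
  meager-⊆ {A} A⊆B (M , nd , B⊆ , _) = (λ n → M n ∩ A) , (λ n → nowhereDense-⊆ proj₁ (nd n))
    , (λ a → let (n , x) = B⊆ (A⊆B a) in n , x , a) , λ { (n , _ , a) → a }

  nowhereDense⇒meager : ∀ {A} → NowhereDense τ A → Meager τ A
  nowhereDense⇒meager {A} nd = (λ _ → A) , (λ _ → nd) , (λ a → 0 , a) , proj₂

  meager-⋃ : (A : ℕ → Pred X 0ℓ) → (∀ n → Meager τ (A n)) → Meager τ (⋃ ℕ A)
  meager-⋃ A m = (λ k → M (unpair k)) , (λ k → proj₁ (proj₂ (m (proj₁ (unpair k)))) (proj₂ (unpair k)))
    , (λ { (n , a) → let (k , x) = proj₁ (proj₂ (proj₂ (m n))) a in
           pair n k , subst (λ p → M p _) (sym (unpair-pair n k)) x })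
    , (λ { (k , x) → proj₁ (unpair k) , proj₂ (proj₂ (proj₂ (m (proj₁ (unpair k))))) (proj₂ (unpair k) , x) })
    where
    M : ℕ × ℕ → Pred X 0ℓ
    M (n , k) = proj₁ (m n) k

  meager-∅ : Meager τ ∅
  meager-∅ = nowhereDense⇒meager λ V o V⊆ x Vx → let (_ , _ , e) = V⊆ Vx V o Vx in e

  meager-∪ : ∀ {A B} → Meager τ A → Meager τ B → Meager τ (A ∪ B)
  meager-∪ {A} {B} a b = meager-⊆ (λ { (inj₁ x) → 0 , x ; (inj₂ y) → 1 , y })
    (meager-⋃ (λ { zero → A ; (suc _) → B }) λ { zero → a ; (suc _) → b })

  meager-⋃ᶜ : ∀ {I : Set} → Countable I → (A : I → Pred X 0ℓ) → (∀ i → Meager τ (A i)) → Meager τ (⋃ I A)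
  meager-⋃ᶜ c A m = meager-⊆ (proj₂ (⋃-enumerated c A))
    (meager-⋃ _ λ n → optional-all (Meager τ) meager-∅ m (proj₁ c n))

  BP : Pred X 0ℓ → Set₁
  BP = BaireProperty τ

  BP-open : ∀ {A} → Opn A → BP A
  BP-open {A} o = A , opn⇒open o , meager-⊆ (λ { (inj₁ (a , ¬a)) → ¬a a ; (inj₂ (a , ¬a)) → ¬a a }) meager-∅

  BP-modulo : ∀ {A B} → Meager τ (A ∖ B) → Meager τ (B ∖ A) → BP B → BP A
  BP-modulo {A} {B} m m′ (V , o , mV) = V , o , meager-⊆
    (λ { {x} (inj₁ (a , ¬v)) → Sum.[ (λ b → inj₂ (inj₂ (inj₁ (b , ¬v)))) , (λ ¬b → inj₁ (a , ¬b)) ]′ (lem (B x))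
       ; {x} (inj₂ (v , ¬a)) → Sum.[ (λ b → inj₂ (inj₁ (b , ¬a))) , (λ ¬b → inj₂ (inj₂ (inj₂ (v , ¬b)))) ]′ (lem (B x)) })
    (meager-∪ m (meager-∪ m′ mV))

  BP-resp : ∀ {A B} → A ≐ B → BP A → BP B
  BP-resp (A⊆B , B⊆A) = BP-modulo
    (meager-⊆ (λ { (b , ¬a) → ¬a (B⊆A b) }) meager-∅) (meager-⊆ (λ { (a , ¬b) → ¬b (A⊆B a) }) meager-∅)

  boundary-nowhereDense : ∀ {V} → Opn V → NowhereDense τ (∁ V ∖ Interior (∁ V))
  boundary-nowhereDense {V} Vo W Wo W⊆ x Wx =
    let (y , Wy , ¬Vy , ¬int) = W⊆ Wx W Wo Wx
        (k , f) = open⇒opn Wo y Wy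
    in ¬int (k , λ z n Vz → let (w , Vw , ¬Vw , _) = W⊆ (f z n) V (opn⇒open Vo) Vz in ¬Vw Vw)

  -- The complement of the approximating open set is closed and differs from its interior by a
  -- nowhere dense set.
  BP-∁ : ∀ {A} → BP A → BP (∁ A)
  BP-∁ {A} (V , o , m) = Interior (∁ V) , opn⇒open (interior-opn (∁ V)) , meager-⊆
    (λ { {x} (inj₁ (¬a , ¬i)) → Sum.[ (λ v → inj₁ (inj₂ (v , ¬a))) , (λ ¬v → inj₂ (¬v , ¬i)) ]′ (lem (V x))
       ; {x} (inj₂ (i , ¬¬a)) → inj₁ (inj₁ (dne ¬¬a , interior-⊆ (∁ V) i)) })
    (meager-∪ m (nowhereDense⇒meager (boundary-nowhereDense (open⇒opn o))))

  BP-⋃ : (A : ℕ → Pred X 0ℓ) → (∀ n → BP (A n)) → BP (⋃ ℕ A)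
  BP-⋃ A bp = ⋃ ℕ (λ n → proj₁ (bp n)) , Topology.open-⋃ τ ℕ _ (λ n → proj₁ (proj₂ (bp n))) , meager-⊆
    (λ { (inj₁ ((n , a) , ¬v)) → n , inj₁ (a , λ v → ¬v (n , v))
       ; (inj₂ ((n , v) , ¬a)) → n , inj₂ (v , λ a → ¬a (n , a)) })
    (meager-⋃ _ λ n → proj₂ (proj₂ (bp n)))

  -- A localisation principle: `V` is the union of the basic sets inside it, so if these are all
  -- meager, then so are `V` and `Q`. To prove `Q` meager one may therefore work inside a basic set
  -- where `Q` is comeager.
  meager-unless-inside : ∀ {Q : Pred X 0ℓ} → ((V , _) : BP Q) → (∀ m → (∀ y → Basic m y → V y) → Meager τ (Basic m)) → Meager τ Q
  meager-unless-inside {Q} (V , o , mΔ) h = meager-⊆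
      (λ {a} q → Sum.[ (λ v → inj₂ (inV v)) , (λ ¬v → inj₁ (inj₁ (q , ¬v))) ]′ (lem (V a)))
      (meager-∪ mΔ (meager-⋃ Inside part))
    where
    Inside : ℕ → Pred X 0ℓ
    Inside m a = Basic m a × (∀ y → Basic m y → V y)
    inV : ∀ {a} → V a → ⋃ ℕ Inside a
    inV {a} v = let (k , f) = open⇒opn o a v ; (m , b , g) = basic-base a k in m , b , λ y b′ → f y (g y b′)
    part : ∀ m → Meager τ (Inside m)
    part m with lem (∀ y → Basic m y → V y)
    ... | inj₁ sub  = meager-⊆ proj₁ (h m sub)
    ... | inj₂ ¬sub = meager-⊆ (λ (_ , s) → ¬sub s) meager-∅

  -- Small A is the largest open set in which A is meager; its complement is
  -- the hull of A.
  Small : Pred X 0ℓ → Pred X 0ℓ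
  Small A x = ∃[ m ] Basic m x × True (em {P = Meager τ (Basic m ∩ A)})

  small-opn : ∀ A → Opn (Small A)
  small-opn A x (m , b , t) = let (k , f) = basic-opn m x b in k , λ y n → m , f y n , t

  small-meager : ∀ A → Meager τ (A ∩ Small A)
  small-meager A = meager-⊆ (λ { (a , m , b , t) → m , a , b , t }) (meager-⋃ _ λ m → part m)
    where
    part : ∀ m → Meager τ (λ x → A x × Basic m x × True (em {P = Meager τ (Basic m ∩ A)}))
    part m with lem (True (em {P = Meager τ (Basic m ∩ A)}))
    ... | inj₁ t  = meager-⊆ (λ { (a , b , _) → b , a }) (toWitness t)
    ... | inj₂ ¬t = meager-⊆ (λ { (_ , _ , t) → ¬t t }) meager-∅

  ¬small⇒closure : ∀ {A x} → ¬ Small A x → ∀ k → ∃[ y ] N k x y × A y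
  ¬small⇒closure {A} {x} ¬s k = dne λ none →
    let (m , b , g) = basic-base x k in
    ¬s (m , b , fromWitness (meager-⊆ (λ { {y} (b′ , a) → none (y , g y b′ , a) }) meager-∅))

  -- On an open set W inside the closure of the gap every `Small (As n)` is dense. So each `As n`,
  -- and with them A, is meager in W, which puts W inside `Small A` and away from the gap.
  hull-gap : ∀ {A} (As : ℕ → Pred X 0ℓ) → A ⊆ ⋃ ℕ As → NowhereDense τ (∁ (Small A) ∖ ⋃ ℕ (λ n → ∁ (Small (As n))))
  hull-gap {A} As A⊆ W Wo W⊆ x Wx =
    let (k , f) = open⇒opn Wo x Wx ; (m , b , g) = basic-base x k in
    let (y , (by , _) , ¬small , _) = W⊆ Wx (Basic m ∩ W) (Topology.open-∩ τ (opn⇒open (basic-opn m)) Wo) (b , Wx) in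
    ¬small
      (m , by , fromWitness (meager-⊆ (λ { {y} (b′ , a) → cover m g f y b′ a })
             (meager-⋃ _ λ n → meager-∪ (small-meager (As n)) (nowhereDense⇒meager (thin n)))))
    where
    thin : ∀ n → NowhereDense τ (W ∖ Small (As n))
    thin n V Vo V⊆ y Vy =
      let (z , Vz , Wz , _) = V⊆ Vy V Vo Vy
          (w , (Vw , Ww) , _ , inSmall) = W⊆ Wz (V ∩ W) (Topology.open-∩ τ Vo Wo) (Vz , Wz)
          s = dne (λ ¬s → inSmall (n , ¬s))
          (u , (Vu , su) , _ , ¬su) = V⊆ Vw (V ∩ Small (As n)) (Topology.open-∩ τ Vo (opn⇒open (small-opn (As n)))) (Vw , s)
      in ¬su su
    cover : ∀ m {k} → (∀ y → Basic m y → N k x y) → (∀ y → N k x y → W y) → ∀ y → Basic m y → A y →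
            ⋃ ℕ (λ n → (As n ∩ Small (As n)) ∪ (W ∖ Small (As n))) y
    cover m g f y b a = let (n , an) = A⊆ a in
      n , Sum.[ (λ s → inj₁ (an , s)) , (λ ¬s → inj₂ (f y (g y b) , ¬s)) ]′ (lem (Small (As n) y))

  -- Souslin's theorem: outside the meager union of the gaps, a point of the
  -- hull of P follows a branch of hulls, which closedness puts into P.
  BP-analytic : ∀ {P : Pred Env 0ℓ} → Analytic P → BP (λ x → P (λ _ → x))
  BP-analytic {P} (C , C-closed , P⇔) = BP-modulo
    (meager-⊆ (λ { {x} (p , ¬d) → (let (α , c) = proj₁ (P⇔ _) p in α , tt , c) , dne ¬d }) (small-meager (Piece [])))
    (meager-⊆ (λ { {x} (d , ¬p) → dne λ no-gap → ¬p (branch x d λ s ds → dne λ ne → no-gap (s , ds , λ { (n , dn) → ne (n , dn) })) })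
      (meager-⋃ᶜ (countable-List countable-ℕ) _ λ s → nowhereDense⇒meager (hull-gap (λ n → Piece (n ∷ s)) (refine s))))
    (BP-∁ (BP-open (small-opn (Piece []))))
    where
    -- Initial segments are stored in reverse, so that the head of a list is the newest entry and
    -- extension is a cons.
    Extends : List ℕ → (ℕ → ℕ) → Set
    Extends []      α = ⊤
    Extends (n ∷ s) α = α (length s) ≡ n × Extends s α
    Piece : List ℕ → Pred X 0ℓ
    Piece s x = ∃[ α ] Extends s α × C α (λ _ → x)
    refine : ∀ s → Piece s ⊆ ⋃ ℕ (λ n → Piece (n ∷ s))
    refine s (α , e , c) = α (length s) , α , (refl , e) , c
    Hull : List ℕ → Pred X 0ℓ
    Hull s = ∁ (Small (Piece s))
    branch : ∀ x → Hull [] x → (∀ s → Hull s x → ∃[ n ] Hull (n ∷ s) x) → P (λ _ → x)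
    branch x h₀ next = proj₂ (P⇔ _) (α , C-closed α (λ _ → x) λ n →
        let (y , near , α′ , e , c) = ¬small⇒closure (proj₂ (stage n)) n in
        α′ , (λ _ → y) , (λ i i<n → agree n i i<n α′ e) , (λ _ _ → near) , c)
      where
      stage : ℕ → ∃[ s ] Hull s x
      stage zero    = [] , h₀
      stage (suc n) = let (s , h) = stage n ; (k , h′) = next s h in k ∷ s , h′
      α : ℕ → ℕ
      α n = proj₁ (next (proj₁ (stage n)) (proj₂ (stage n)))
      stage-length : ∀ n → length (proj₁ (stage n)) ≡ n
      stage-length zero    = refl
      stage-length (suc n) = cong suc (stage-length n)
      agree : ∀ n i → i ℕ.< n → ∀ α′ → Extends (proj₁ (stage n)) α′ → α i ≡ α′ i
      agree (suc n) i i<1+n α′ (e , es) with ℕₚ.m≤n⇒m<n∨m≡n (ℕ.s≤s⁻¹ i<1+n)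
      ... | inj₁ i<n  = agree n i i<n α′ es
      ... | inj₂ refl = trans (sym e) (cong α′ (stage-length n))

  BP-𝒟 : ∀ {P : Pred Env 0ℓ} → 𝒟 P → BP (λ x → P (λ _ → x))
  BP-𝒟 (gen a)          = BP-analytic a
  BP-𝒟 gen-∅            = BP-open λ _ ()
  BP-𝒟 (gen-∁ d)        = BP-∁ (BP-𝒟 d)
  BP-𝒟 (gen-⋃ A d)      = BP-⋃ _ λ n → BP-𝒟 (d n)
  BP-𝒟 (resp (f , g) d) = BP-resp (f , g) (BP-𝒟 d)

-- Duplicate-free lists over a setoid.

module SetoidLists (em : ∀ {ℓ} → ExcludedMiddle ℓ) (S : Setoid 0ℓ 0ℓ) where
  open Classical em
  open Setoid S using (_≈_) renaming (Carrier to A; sym to ≈-sym; trans to ≈-trans)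
  open Membership S using () renaming (_∈_ to _∈ₛ_)

  Distinct : ∀ {n} → Vec A n → Set
  Distinct v = ∀ i j → lookup v i ≈ lookup v j → i ≡ j

  distinct⇒unique : ∀ {n} (v : Vec A n) → Distinct v → Unique.Unique S (toList v)
  distinct⇒unique []      d = []
  distinct⇒unique (x ∷ v) d = apart v (λ i e → case d Fin.zero (Fin.suc i) e of λ ())
                            ∷ distinct⇒unique v λ i j e → Finₚ.suc-injective (d (Fin.suc i) (Fin.suc j) e)
    where
    apart : ∀ {n} (v : Vec A n) → (∀ i → ¬ x ≈ lookup v i) → All (λ y → ¬ x ≈ y) (toList v)
    apart []      f = []
    apart (y ∷ v) f = f Fin.zero ∷ apart v (f ∘ Fin.suc)

  ∈-toList⁺ : ∀ {n} (v : Vec A n) i {x} → x ≈ lookup v i → x ∈ₛ toList v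
  ∈-toList⁺ (y ∷ v) Fin.zero    e = here e
  ∈-toList⁺ (y ∷ v) (Fin.suc i) e = there (∈-toList⁺ v i e)

  ∈-toList⁻ : ∀ {n} (v : Vec A n) {x} → x ∈ₛ toList v → ∃[ i ] x ≈ lookup v i
  ∈-toList⁻ (y ∷ v) (here e)  = Fin.zero , e
  ∈-toList⁻ (y ∷ v) (there p) = let (i , e) = ∈-toList⁻ v p in Fin.suc i , e

  unique⇒distinct : ∀ {n} (v : Vec A n) → Unique.Unique S (toList v) → Distinct v
  unique⇒distinct (x ∷ v) (a ∷ u) Fin.zero Fin.zero e = refl
  unique⇒distinct (x ∷ v) (a ∷ u) (Fin.suc i) (Fin.suc j) e = cong Fin.suc (unique⇒distinct v u i j e)
  unique⇒distinct (x ∷ v) (a ∷ u) Fin.zero (Fin.suc j) e = contradiction (∈-toList⁺ v j e) (Allₚ.All¬⇒¬Any a)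
  unique⇒distinct (x ∷ v) (a ∷ u) (Fin.suc i) Fin.zero e = contradiction (∈-toList⁺ v i (≈-sym e)) (Allₚ.All¬⇒¬Any a)

  enumerate : ∀ {P : Pred A 0ℓ} → P Respects _≈_ → ∀ xs → (∀ x → P x → x ∈ₛ xs) →
              ∃[ ys ] Unique.Unique S ys × (∀ x → P x → x ∈ₛ ys) × (∀ x → x ∈ₛ ys → P x)
  enumerate {P} P-resp xs cover = let (ys , u , f , g) = go xs in ys , u , (λ x p → f x p (cover x p)) , g
    where
    go : ∀ xs → ∃[ ys ] Unique.Unique S ys × (∀ x → P x → x ∈ₛ xs → x ∈ₛ ys) × (∀ x → x ∈ₛ ys → P x)
    go [] = [] , [] , (λ _ _ ()) , λ _ ()
    go (x ∷ xs) with go xs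
    ... | ys , u , f , g with lem (P x × ¬ x ∈ₛ ys)
    ...   | inj₁ (p , x∉ys) = x ∷ ys , Allₚ.¬Any⇒All¬ ys x∉ys ∷ u
            , (λ { y q (here e) → here e ; y q (there e) → there (f y q e) })
            , λ { y (here e) → P-resp (≈-sym e) p ; y (there e) → g y e }
    ...   | inj₂ old = ys , u
            , (λ { y q (here e) → Any.map (≈-trans e) (dne λ x∉ys → old (P-resp e q , x∉ys)) ; y q (there e) → f y q e }) , g

  cardinality : ∀ {P : Pred A 0ℓ} → P Respects _≈_ → ∀ xs → (∀ x → P x → x ∈ₛ xs) → ∃[ n ] HasCardinality S P n
  cardinality P-resp xs cover =
    let (ys , u , f , g) = enumerate P-resp xs cover in length ys , ys , u , refl , λ x → mk⇔ (f x) (g x)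

-- Constraints as tuples of points with finite words.

module Coding (em : ∀ {ℓ} → ExcludedMiddle ℓ) (X : Set) (q : ℕ) .{{_ : NonZero q}} where
  open Classical em
  open CSP X q
  open Setoid Graphs using () renaming (_≈_ to _≈ᵍ_; refl to ≈ᵍ-refl; sym to ≈ᵍ-sym; trans to ≈ᵍ-trans)
  open Setoid GraphSets using () renaming (_≈_ to _≈ᶜ_)
  open Membership (setoid (X × Fin q)) using () renaming (_∈_ to _∈ᵍ_)
  open Membership Graphs using () renaming (_∈_ to _∈ᶜ_)
  module XL = SetoidLists em (setoid X)
  module PL = SetoidLists em (setoid (X × Fin q))
  module GL = SetoidLists em Graphs

  Word : ℕ → Set
  Word k = Vec (Fin q) k

  module WL k = SetoidLists em (setoid (Word k))

  graph : ∀ {k} → Vec X k → Word k → Graph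
  graph u w = toList (Vec.zip u w)

  -- Points and colours are separated: `u` carries the points, and the words are one of countably
  -- many finite patterns. Borelness of ℬ becomes, pattern by pattern, a condition on tuples of
  -- points.
  constraint : ∀ {k n} → Vec X k → Vec (Word k) n → Constraint
  constraint u b = toList (Vec.map (graph u) b)

  ∈-graph⁺ : ∀ {k} (u : Vec X k) w j → (lookup u j , lookup w j) ∈ᵍ graph u w
  ∈-graph⁺ u w j = PL.∈-toList⁺ (Vec.zip u w) j (sym (Vecₚ.lookup-zip j u w))

  ∈-graph⁻ : ∀ {k} (u : Vec X k) w {x i} → (x , i) ∈ᵍ graph u w → ∃[ j ] x ≡ lookup u j × i ≡ lookup w j
  ∈-graph⁻ u w e = let (j , eq) = PL.∈-toList⁻ (Vec.zip u w) e
                       eq′ = trans eq (Vecₚ.lookup-zip j u w) in j , cong proj₁ eq′ , cong proj₂ eq′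

  ∈-constraint⁺ : ∀ {k n} (u : Vec X k) (b : Vec (Word k) n) j {φ} → φ ≈ᵍ graph u (lookup b j) → φ ∈ᶜ constraint u b
  ∈-constraint⁺ u b j {φ} e =
    GL.∈-toList⁺ (Vec.map (graph u) b) j (subst (φ ≈ᵍ_) (sym (Vecₚ.lookup-map j (graph u) b)) e)

  ∈-constraint⁻ : ∀ {k n} (u : Vec X k) (b : Vec (Word k) n) {φ} → φ ∈ᶜ constraint u b → ∃[ j ] φ ≈ᵍ graph u (lookup b j)
  ∈-constraint⁻ u b {φ} e = let (j , eq) = GL.∈-toList⁻ (Vec.map (graph u) b) e in
    j , subst (φ ≈ᵍ_) (Vecₚ.lookup-map j (graph u) b) eq

  graph-unique : ∀ {k} (u : Vec X k) w → XL.Distinct u → Unique.Unique (setoid (X × Fin q)) (graph u w)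
  graph-unique u w d = PL.distinct⇒unique (Vec.zip u w) λ i j e →
    d i j (cong proj₁ (trans (sym (Vecₚ.lookup-zip i u w)) (trans e (Vecₚ.lookup-zip j u w))))

  graph-injective : ∀ {k} (u : Vec X k) {w w′} → XL.Distinct u → graph u w ≈ᵍ graph u w′ → w ≡ w′
  graph-injective u {w} {w′} d (f , _) = trans (sym (Vecₚ.tabulate∘lookup w))
    (trans (Vecₚ.tabulate-cong same) (Vecₚ.tabulate∘lookup w′))
    where
    same : ∀ j → lookup w j ≡ lookup w′ j
    same j = let (j′ , e , e′) = ∈-graph⁻ u w′ (f (∈-graph⁺ u w j)) in trans e′ (cong (lookup w′) (sym (d j j′ e)))

  constraint-unique : ∀ {k n} (u : Vec X k) (b : Vec (Word k) n) → XL.Distinct u → WL.Distinct k b →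
                      Unique.Unique Graphs (constraint u b)
  constraint-unique u b d d′ = GL.distinct⇒unique (Vec.map (graph u) b) λ i j e →
    d′ i j (graph-injective u d (≈ᵍ-trans {graph u (lookup b i)} {lookup (Vec.map (graph u) b) i} {graph u (lookup b j)}
      (≡⇒≈ (sym (Vecₚ.lookup-map i (graph u) b)))
      (≈ᵍ-trans {lookup (Vec.map (graph u) b) i} {lookup (Vec.map (graph u) b) j} {graph u (lookup b j)}
        e (≡⇒≈ (Vecₚ.lookup-map j (graph u) b)))))
    where
    ≡⇒≈ : ∀ {φ ψ : Graph} → φ ≡ ψ → φ ≈ᵍ ψ
    ≡⇒≈ {φ} refl = ≈ᵍ-refl {φ}

  -- As b is nonempty, the common domain is exactly u.
  dom-constraint : ∀ {k n} (u : Vec X k) (b : Vec (Word k) (suc n)) →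
                   (∀ {x} → dom (constraint u b) x → ∃[ j ] x ≡ lookup u j) × (∀ j → dom (constraint u b) (lookup u j))
  dom-constraint u b =
      (λ { (φ , φ∈ , i , xi∈) → let (j , (f , _)) = ∈-constraint⁻ u b {φ} φ∈
                                    (j′ , e , _) = ∈-graph⁻ u (lookup b j) (f xi∈) in j′ , e })
    , λ j → graph u (lookup b Fin.zero)
          , ∈-constraint⁺ u b Fin.zero {graph u (lookup b Fin.zero)} (≈ᵍ-refl {graph u (lookup b Fin.zero)})
          , lookup (lookup b Fin.zero) j , ∈-graph⁺ u (lookup b Fin.zero) j

  violates-constraint : ∀ {k n} (u : Vec X k) (b : Vec (Word k) (suc n)) → XL.Distinct u → ∀ f →
                        (Violates f (constraint u b) → ∃[ j ] lookup b j ≡ Vec.map f u) ×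
                        (∃[ j ] lookup b j ≡ Vec.map f u → Violates f (constraint u b))
  violates-constraint {k} u b d f = to , from
    where
    to : Violates f (constraint u b) → ∃[ j ] lookup b j ≡ Vec.map f u
    to (φ , φ∈ , r) = let (j , (_ , h)) = ∈-constraint⁻ u b {φ} φ∈ in
      j , trans (sym (Vecₚ.tabulate∘lookup _)) (trans (Vecₚ.tabulate-cong λ l →
            trans (sym (proj₂ (Equivalence.to (r (lookup u l) (lookup (lookup b j) l)) (h (∈-graph⁺ u (lookup b j) l)))))
                  (sym (Vecₚ.lookup-map l f u)))
          (Vecₚ.tabulate∘lookup (Vec.map f u)))
    from : ∃[ j ] lookup b j ≡ Vec.map f u → Violates f (constraint u b)
    from (j , e) = graph u (lookup b j)
      , ∈-constraint⁺ u b j {graph u (lookup b j)} (≈ᵍ-refl {graph u (lookup b j)})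
      , λ x i → mk⇔
          (λ xi∈ → let (l , e₁ , e₂) = ∈-graph⁻ u (lookup b j) xi∈ in
            subst (dom (constraint u b)) (sym e₁) (proj₂ (dom-constraint u b) l)
            , trans (cong f e₁) (trans (sym (Vecₚ.lookup-map l f u)) (trans (cong (λ w → lookup w l) (sym e)) (sym e₂))))
          (λ { (D , fx) → let (l , e₁) = proj₁ (dom-constraint u b) D in
               subst (_∈ᵍ graph u (lookup b j))
                 (cong₂ _,_ (sym e₁) (trans (cong (λ w → lookup w l) e) (trans (Vecₚ.lookup-map l f u) (trans (cong f (sym e₁)) fx))))
                 (∈-graph⁺ u (lookup b j) l) })

  points : List Graph → List X
  points []      = []
  points (φ ∷ B) = List.map proj₁ φ ++ points B

  ∈-points : ∀ {x i φ B} → (x , i) ∈ᵍ φ → φ ∈ᶜ B → Any (x ≡_) (points B)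
  ∈-points {B = ψ ∷ B} e (here (f , _)) = Anyₚ.++⁺ˡ (Anyₚ.map⁺ (Any.map (cong proj₁) (f e)))
  ∈-points {φ = φ} {B = ψ ∷ B} e (there p) = Anyₚ.++⁺ʳ (List.map proj₁ ψ) (∈-points {φ = φ} e p)

  dom-points : ∀ B x → dom B x → Any (x ≡_) (points B)
  dom-points B x (φ , φ∈B , i , e) = ∈-points {φ = φ} e φ∈B

  dom-cardinality : ∀ B → ∃[ n ] HasCardinality (setoid X) (dom B) n
  dom-cardinality B = XL.cardinality (λ { refl D → D }) (points B) (dom-points B)

  constraint-cardinality : ∀ B → ∃[ m ] HasCardinality Graphs (_∈ᶜ B) m
  constraint-cardinality B = GL.cardinality
    (λ {φ} {ψ} e → Any.map λ {χ} → ≈ᵍ-trans {ψ} {φ} {χ} (≈ᵍ-sym {φ} {ψ} e)) B (λ _ e → e)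

  value : Fin q → Graph → X → Fin q
  value i₀ φ x with em {P = ∃[ i ] (x , i) ∈ᵍ φ}
  ... | yes (i , _) = i
  ... | no _        = i₀

  value-∈ : ∀ {i₀ φ x i} → (x , i) ∈ᵍ φ → (x , value i₀ φ x) ∈ᵍ φ
  value-∈ {φ = φ} {x} {i} e with em {P = ∃[ i ] (x , i) ∈ᵍ φ}
  ... | yes (_ , e′) = e′
  ... | no none      = contradiction (i , e) none

  record Coded (B : Constraint) : Set where
    field
      {arity size} : ℕ
      vars         : Vec X arity
      words        : Vec (Word arity) (suc size)
      vars-distinct  : XL.Distinct vars
      words-distinct : WL.Distinct arity words
      coded        : constraint vars words ≈ᶜ B

  -- The point `x` of the domain provides a member `φ₀`, so the list of words is nonempty, and a
  -- colour `i₀` as default for `value`. Since members share their domain, each is recovered from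
  -- its word.
  code-constraint : ∀ B → IsConstraint B → ∀ {x} → dom B x → Coded B
  code-constraint B (functional , common) {x} x∈dom@(φ₀ , φ₀∈B , i₀ , _) =
    build (proj₁ ws) (proj₁ (proj₂ ws)) (proj₁ (proj₂ (proj₂ ws))) (proj₂ (proj₂ (proj₂ ws)))
    where
    enum : ∃[ ys ] Unique.Unique (setoid X) ys × (∀ x → dom B x → Any (x ≡_) ys) × (∀ x → Any (x ≡_) ys → dom B x)
    enum = XL.enumerate (λ { refl D → D }) (points B) (dom-points B)
    k : ℕ
    k = length (proj₁ enum)
    u : Vec X k
    u = Vec.fromList (proj₁ enum)
    u-distinct : XL.Distinct u
    u-distinct = XL.unique⇒distinct u (subst (Unique.Unique (setoid X)) (sym (Vecₚ.toList∘fromList (proj₁ enum))) (proj₁ (proj₂ enum)))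
    u-dom : ∀ j → dom B (lookup u j)
    u-dom j = proj₂ (proj₂ (proj₂ enum)) _ (subst (Any (lookup u j ≡_)) (Vecₚ.toList∘fromList (proj₁ enum)) (XL.∈-toList⁺ u j refl))
    dom-u : ∀ {x} → dom B x → ∃[ j ] x ≡ lookup u j
    dom-u D = XL.∈-toList⁻ u (subst (Any (_ ≡_)) (sym (Vecₚ.toList∘fromList (proj₁ enum))) (proj₁ (proj₂ (proj₂ enum)) _ D))
    word : Graph → Word k
    word φ = Vec.map (value i₀ φ) u
    graph-word : ∀ {φ} → φ ∈ᶜ B → graph u (word φ) ≈ᵍ φ
    graph-word {φ} φ∈B = to , from
      where
      φ-dom : ∀ {x} → dom B x → domain φ x
      φ-dom (ψ , ψ∈B , D) = proj₁ (common ψ φ ψ∈B φ∈B) D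
      val : ∀ j → (lookup u j , lookup (word φ) j) ∈ᵍ φ
      val j = subst (λ i → (lookup u j , i) ∈ᵍ φ) (sym (Vecₚ.lookup-map j (value i₀ φ) u))
                (value-∈ {φ = φ} (proj₂ (φ-dom (u-dom j))))
      to : ∀ {p} → p ∈ᵍ graph u (word φ) → p ∈ᵍ φ
      to e = let (j , e₁ , e₂) = ∈-graph⁻ u (word φ) e in subst (_∈ᵍ φ) (sym (cong₂ _,_ e₁ e₂)) (val j)
      from : ∀ {p} → p ∈ᵍ φ → p ∈ᵍ graph u (word φ)
      from {y , i} e = let (j , y≡) = dom-u (φ , φ∈B , i , e) in
        subst (_∈ᵍ graph u (word φ))
          (cong₂ _,_ (sym y≡) (functional φ φ∈B (lookup u j) (lookup (word φ) j) i (val j) (subst (λ z → (z , i) ∈ᵍ φ) y≡ e)))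
          (∈-graph⁺ u (word φ) j)
    IsWord : Pred (Word k) 0ℓ
    IsWord w = ∃[ φ ] φ ∈ᶜ B × w ≡ word φ
    word-list : ∀ w → IsWord w → Any (w ≡_) (List.map word B)
    word-list w (φ , φ∈B , refl) = Anyₚ.map⁺ (go B φ∈B id)
      where
      go : ∀ C → φ ∈ᶜ C → (∀ {ψ} → ψ ∈ᶜ C → ψ ∈ᶜ B) → Any (λ ψ → word φ ≡ word ψ) C
      go (ψ ∷ C) (here φ≈ψ) sub = here (graph-injective u u-distinct
        (≈ᵍ-trans {graph u (word φ)} {φ} {graph u (word ψ)} (graph-word φ∈B)
          (≈ᵍ-trans {φ} {ψ} {graph u (word ψ)} φ≈ψ
            (≈ᵍ-sym {graph u (word ψ)} {ψ} (graph-word {ψ} (sub (here (≈ᵍ-refl {ψ}))))))))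
      go (ψ ∷ C) (there p) sub = there (go C p λ {χ} e → sub {χ} (there e))
    ws : ∃[ ys ] Unique.Unique (setoid (Word k)) ys × (∀ w → IsWord w → Any (w ≡_) ys) × (∀ w → Any (w ≡_) ys → IsWord w)
    ws = WL.enumerate k (λ { refl D → D }) (List.map word B) word-list
    build : ∀ ys → Unique.Unique (setoid (Word k)) ys → (∀ w → IsWord w → Any (w ≡_) ys) → (∀ w → Any (w ≡_) ys → IsWord w) → Coded B
    build [] _ f _ = case f (word φ₀) (φ₀ , φ₀∈B , refl) of λ ()
    build ys@(y ∷ ys′) uniq f g = record
      { vars = u ; words = b ; vars-distinct = u-distinct
      ; words-distinct = WL.unique⇒distinct k b (subst (Unique.Unique (setoid (Word k))) (sym (Vecₚ.toList∘fromList ys)) uniq)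
      ; coded = (λ {φ} → to {φ}) , λ {φ} → from {φ} }
      where
      b : Vec (Word k) (suc (length ys′))
      b = Vec.fromList ys
      to : ∀ {φ} → φ ∈ᶜ constraint u b → φ ∈ᶜ B
      to {φ} e with ∈-constraint⁻ u b {φ} e
      ... | j , φ≈ with g (lookup b j) (subst (Any (lookup b j ≡_)) (Vecₚ.toList∘fromList ys) (WL.∈-toList⁺ k b j refl))
      ...   | ψ , ψ∈B , e′ = Any.map (λ {χ} → ≈ᵍ-trans {φ} {ψ} {χ}
                (≈ᵍ-trans {φ} {graph u (lookup b j)} {ψ} φ≈ (subst (λ w → graph u w ≈ᵍ ψ) (sym e′) (graph-word ψ∈B)))) ψ∈B
      from : ∀ {φ} → φ ∈ᶜ B → φ ∈ᶜ constraint u b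
      from {φ} φ∈B with WL.∈-toList⁻ k b (subst (Any (word φ ≡_)) (sym (Vecₚ.toList∘fromList ys)) (f (word φ) (φ , φ∈B , refl)))
      ... | j , e = ∈-constraint⁺ u b j {φ} (subst (λ w → φ ≈ᵍ graph u w) e (≈ᵍ-sym {graph u (word φ)} {φ} (graph-word φ∈B)))

-- Definability of the constraint graph.

module BorelCSP (em : ∀ {ℓ} → ExcludedMiddle ℓ) (ext : ∀ {a b} → Extensionality a b)
                (X : Set) (q : ℕ) .{{_ : NonZero q}} (𝓤 : Uniform X) (𝔅 : σ-Algebra (setoid X))
                (borel : ∀ A → Measurable 𝔅 A → ∀ i → Descriptive.Δ em ext X 𝓤 (λ v → A (v i)))
                (ℬ : Pred (CSP.Constraint X q) 0ℓ) (isBorelCSP : CSP.IsBorelCSP X q 𝔅 ℬ) where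
  open Classical em
  open FiniteSets em
  open Countability
  open Descriptive em ext X 𝓤 hiding (Coded)
  open CSP X q
  open IsCSP (proj₁ isBorelCSP)
  open Coding em X q
  open Stages em ext X q ℬ using (G; G-sym; dom-resp)
  open Components X G G-sym
  open Setoid GraphSets using () renaming (_≈_ to _≈ᶜ_; sym to ≈ᶜ-sym)

  infixr 5 _++ₑ_
  _++ₑ_ : ∀ {k} → Vec X k → Env → Env
  []      ++ₑ v = v
  (x ∷ u) ++ₑ v = x ∷ₑ (u ++ₑ v)

  take : ∀ k → Env → Vec X k
  take zero    v = []
  take (suc k) v = v 0 ∷ take k (v ∘ suc)

  lookup-take : ∀ k v i → lookup (take k v) i ≡ v (toℕ i)
  lookup-take (suc k) v Fin.zero    = refl
  lookup-take (suc k) v (Fin.suc i) = lookup-take k (v ∘ suc) i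

  take-++ : ∀ {k} (u : Vec X k) v → take k (u ++ₑ v) ≡ u
  take-++ []      v = refl
  take-++ (x ∷ u) v = cong (x ∷_) (take-++ u v)

  ++-toℕ : ∀ {k} (u : Vec X k) v i → (u ++ₑ v) (toℕ i) ≡ lookup u i
  ++-toℕ u v i = trans (sym (lookup-take _ (u ++ₑ v) i)) (cong (λ w → lookup w i) (take-++ u v))

  ++-+ : ∀ {k} (u : Vec X k) v i → (u ++ₑ v) (k ℕ.+ i) ≡ v i
  ++-+ []      v i = refl
  ++-+ (x ∷ u) v i = ++-+ u v i

  Δ-const : ∀ (P : Set) → Δ (λ _ → P)
  Δ-const P with lem P
  ... | inj₁ p  = Δ-resp ((λ _ → p) , λ _ → tt) (Δ-opn 0 {U} λ _ _ → 0 , λ _ _ → tt)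
  ... | inj₂ ¬p = Δ-resp ((λ ()) , λ p → contradiction p ¬p) (Δ-opn 0 {∅} λ _ ())

  Δ-∀Fin : ∀ n {P : Fin n → Pred Env 0ℓ} → (∀ i → Δ (P i)) → Δ (λ v → ∀ i → P i v)
  Δ-∀Fin zero    δ = Δ-resp ((λ { _ () }) , λ _ → tt) (Δ-const ⊤)
  Δ-∀Fin (suc n) δ = Δ-resp ((λ { (p , f) Fin.zero → p ; (p , f) (Fin.suc i) → f i }) , λ f → f Fin.zero , f ∘ Fin.suc)
    (Δ-∩ (δ Fin.zero) (Δ-∀Fin n (δ ∘ Fin.suc)))

  Δ-distinct : ∀ k → Δ (λ v → XL.Distinct (take k v))
  Δ-distinct k = Δ-resp
    ( (λ {v} f i j e → Sum.[ id , (λ ne → contradiction (trans (sym (lookup-take k v i)) (trans e (lookup-take k v j))) ne) ]′ (f i j))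
    , (λ {v} d i j → Sum.[ (λ e → inj₁ (d i j (trans (lookup-take k v i) (trans e (sym (lookup-take k v j)))))) , inj₂ ]′ (lem (v (toℕ i) ≡ v (toℕ j)))))
    (Δ-∀Fin k λ i → Δ-∀Fin k λ j → Δ-∪ (Δ-const (i ≡ j)) (Δ-∁ (Δ-≡ (toℕ i) (toℕ j))))

  Δ-coloured-point : ∀ {A} → Measurable (𝔅 ×σ q) A → ∀ i c → Δ (λ v → A (v i , c))
  Δ-coloured-point (gen (A′ , I , m , f , g)) i c = Δ-resp (g , f) (Δ-∩ (borel A′ m i) (Δ-const (I c)))
  Δ-coloured-point gen-∅ i c          = Δ-const ⊥
  Δ-coloured-point (gen-∁ d) i c      = Δ-∁ (Δ-coloured-point d i c)
  Δ-coloured-point (gen-⋃ A d) i c    = Δ-⋃ (λ n v → A n (v i , c)) λ n → Δ-coloured-point (d n) i c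
  Δ-coloured-point (resp (f , g) d) i c = Δ-resp (f , g) (Δ-coloured-point d i c)

  Δ-tuple : ∀ {k M} → Powerσ (𝔅 ×σ q) k M → ∀ w → Δ (λ v → M (Vec.zip (take k v) w))
  Δ-tuple {k} (gen (i , A , m , f , g)) w = Δ-resp
    ( (λ {v} a → g (subst A (sym (at v)) a)) , (λ {v} p → subst A (at v) (f p)))
    (Δ-coloured-point m (toℕ i) (lookup w i))
    where
    at : ∀ v → lookup (Vec.zip (take k v) w) i ≡ (v (toℕ i) , lookup w i)
    at v = trans (Vecₚ.lookup-zip i (take k v) w) (cong (_, lookup w i) (lookup-take k v i))
  Δ-tuple gen-∅ w          = Δ-const ⊥
  Δ-tuple (gen-∁ d) w      = Δ-∁ (Δ-tuple d w)
  Δ-tuple {k} (gen-⋃ A d) w = Δ-⋃ (λ n v → A n (Vec.zip (take k v) w)) λ n → Δ-tuple (d n) w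
  Δ-tuple (resp (f , g) d) w = Δ-resp (f , g) (Δ-tuple d w)

  -- Measurability on a space of finite sets is tested only on distinct tuples. The conjunct
  -- `Distinct` therefore accompanies every set up to the level of constraints, where it is part of
  -- `Instance`.
  Δ-graph : ∀ {A} → Measurable (FinSetsσ (𝔅 ×σ q)) A → ∀ {k} w → Δ (λ v → XL.Distinct (take k v) × A (graph (take k v) w))
  Δ-graph (_ , trace) {k} w = let (M , m , h) = trace k in Δ-resp
    ( (λ {v} (d , x) → d , Equivalence.to (h (Vec.zip (take k v) w) (graph-unique (take k v) w d)) x)
    , (λ {v} (d , a) → d , Equivalence.from (h (Vec.zip (take k v) w) (graph-unique (take k v) w d)) a))
    (Δ-∩ (Δ-distinct k) (Δ-tuple m w))

  Δ-graphs : ∀ {n M} → Powerσ (FinSetsσ (𝔅 ×σ q)) n M → ∀ {k} (b : Vec (Word k) n) →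
             Δ (λ v → XL.Distinct (take k v) × M (Vec.map (graph (take k v)) b))
  Δ-graphs (gen (i , A , m , f , g)) {k} b = Δ-resp
    ( (λ {v} (d , a) → d , g (subst A (sym (Vecₚ.lookup-map i (graph (take k v)) b)) a))
    , (λ {v} (d , p) → d , subst A (Vecₚ.lookup-map i (graph (take k v)) b) (f p)))
    (Δ-graph m (lookup b i))
  Δ-graphs gen-∅ b = Δ-resp ((λ ()) , λ ()) (Δ-const ⊥)
  Δ-graphs (gen-∁ e) {k} b = Δ-resp
    ( (λ (d , ¬p) → d , λ m → ¬p (d , m))
    , (λ (d , ¬m) → d , λ (_ , m) → ¬m m))
    (Δ-∩ (Δ-distinct k) (Δ-∁ (Δ-graphs e b)))
  Δ-graphs (gen-⋃ A e) {k} b = Δ-resp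
    ( (λ (n , d , a) → d , n , a) , (λ (d , n , a) → n , d , a))
    (Δ-⋃ (λ n v → XL.Distinct (take k v) × A n (Vec.map (graph (take k v)) b)) λ n → Δ-graphs (e n) b)
  Δ-graphs (resp (f , g) e) b = Δ-resp
    ((λ (d , a) → d , f a) , λ (d , a) → d , g a) (Δ-graphs e b)

  Code : Set
  Code = Σ[ k ∈ ℕ ] Σ[ n ∈ ℕ ] Vec (Word k) (suc n)

  countable-Word : ∀ k → Countable (Word k)
  countable-Word = countable-Vec (countable-Fin q)

  countable-Code : Countable Code
  countable-Code = countable-Σ countable-ℕ λ k → countable-Σ countable-ℕ λ n → countable-Vec (countable-Word k) (suc n)

  record Instance (c : Code) (u : Vec X (proj₁ c)) : Set where
    constructor inst
    field
      words-distinct : WL.Distinct (proj₁ c) (proj₂ (proj₂ c))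
      vars-distinct  : XL.Distinct u
      member         : constraint u (proj₂ (proj₂ c)) ∈ ℬ

  Δ-instance : ∀ c → Δ (λ v → Instance c (take (proj₁ c) v))
  Δ-instance c@(k , n , b) with lem (WL.Distinct k b)
  ... | inj₂ ¬d = Δ-resp ((λ ()) , λ i → contradiction (Instance.words-distinct i) ¬d) (Δ-const ⊥)
  ... | inj₁ d′ = let (M , m , h) = proj₂ (proj₂ isBorelCSP) (suc n) in Δ-resp
    ( (λ {v} (d , x) → inst d′ d (Equivalence.to (h (Vec.map (graph (take k v)) b) (constraint-unique (take k v) b d d′)) x))
    , (λ {v} (inst _ d x) → d , Equivalence.from (h (Vec.map (graph (take k v)) b) (constraint-unique (take k v) b d d′)) x))
    (Δ-graphs m b)

  record InstanceOf (B : Constraint) : Set where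
    field
      code  : Code
      vars  : Vec X (proj₁ code)
      isInstance : Instance code vars
      same  : constraint vars (proj₂ (proj₂ code)) ≈ᶜ B
      index : ∀ {x} → dom B x → ∃[ j ] x ≡ lookup vars j
      inDom : ∀ j → dom B (lookup vars j)

  instance-of : ∀ {B} → B ∈ ℬ → ∀ {x} → dom B x → InstanceOf B
  instance-of {B} B∈ℬ D = record
    { code = _ , _ , words ; vars = vars
    ; isInstance = inst words-distinct vars-distinct (respects (≈ᶜ-sym {constraint vars words} {B} coded) B∈ℬ)
    ; same  = (λ {φ} → proj₁ coded {φ}) , λ {φ} → proj₂ coded {φ}
    ; index = λ D′ → proj₁ (dom-constraint vars words) (dom-resp {B} {constraint vars words} (≈ᶜ-sym {constraint vars words} {B} coded) D′)
    ; inDom = λ j → dom-resp {constraint vars words} {B} coded (proj₂ (dom-constraint vars words) j) }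
    where open Coded (code-constraint B (constraints B∈ℬ) D)

  An₂ : (X → X → Set) → Set₁
  An₂ R = ∀ i j → Analytic (λ v → R (v i) (v j))

  D₁ : Pred X 0ℓ → Set₁
  D₁ P = ∀ i → 𝒟 (λ v → P (v i))

  D₂ : (X → X → Set) → Set₁
  D₂ R = ∀ i j → 𝒟 (λ v → R (v i) (v j))

  analytic-∃Vec : ∀ k {Φ : Pred Env 0ℓ} → Analytic Φ → Analytic (λ v → Σ[ u ∈ Vec X k ] Φ (u ++ₑ v))
  analytic-∃Vec zero    a = analytic-resp ((λ x → [] , x) , λ { ([] , x) → x }) a
  analytic-∃Vec (suc k) a = analytic-resp
    ((λ { (u , z , x) → z ∷ u , x }) , λ { (z ∷ u , x) → u , z , x }) (analytic-∃Vec k (analytic-∃ a))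

  -- A countable union over codes and pairs of positions. The remaining variables range over X and
  -- are projected away, which leaves the Borel sets for the analytic ones.
  G-analytic : An₂ G
  G-analytic i j = analytic-∪ (proj₁ (Δ-≡ i j)) (analytic-resp ((λ {v} → to {v}) , λ {v} → from {v})
    (analytic-⋃ᶜ countable-index Q Q-analytic))
    where
    Index : Set
    Index = Σ[ c ∈ Code ] (Fin (proj₁ c) × Fin (proj₁ c))
    countable-index : Countable Index
    countable-index = countable-Σ countable-Code λ c → countable-Σ (countable-Fin _) λ _ → countable-Fin _
    Ψ : Index → Pred Env 0ℓ
    Ψ (c , l , l′) w = Instance c (take (proj₁ c) w) × w (toℕ l) ≡ w (proj₁ c ℕ.+ i) × w (toℕ l′) ≡ w (proj₁ c ℕ.+ j)
    Q : Index → Pred Env 0ℓ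
    Q s v = Σ[ u ∈ Vec X (proj₁ (proj₁ s)) ] Ψ s (u ++ₑ v)
    Q-analytic : ∀ s → Analytic (Q s)
    Q-analytic (c , l , l′) = analytic-∃Vec (proj₁ c)
      (proj₁ (Δ-∩ (Δ-instance c) (Δ-∩ (Δ-≡ (toℕ l) (proj₁ c ℕ.+ i)) (Δ-≡ (toℕ l′) (proj₁ c ℕ.+ j)))))
    Linked : Pred Env 0ℓ
    Linked v = ∃[ B ] B ∈ ℬ × dom B (v i) × dom B (v j)
    to : ⋃ Index Q ⊆ Linked
    to {v} (((k , n , b) , l , l′) , u , ι , e , e′) =
      constraint u b , subst (λ u → constraint u b ∈ ℬ) (take-++ u v) (Instance.member ι)
      , subst (dom (constraint u b)) (trans (sym (++-toℕ u v l)) (trans e (++-+ u v i))) (proj₂ (dom-constraint u b) l)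
      , subst (dom (constraint u b)) (trans (sym (++-toℕ u v l′)) (trans e′ (++-+ u v j))) (proj₂ (dom-constraint u b) l′)
    from : Linked ⊆ ⋃ Index Q
    from {v} (B , B∈ℬ , D , D′) = let (l , e) = index D ; (l′ , e′) = index D′ in
      (code , l , l′) , vars , subst (Instance code) (sym (take-++ vars v)) isInstance
      , trans (++-toℕ vars v l) (trans (sym e) (sym (++-+ vars v i)))
      , trans (++-toℕ vars v l′) (trans (sym e′) (sym (++-+ vars v j)))
      where open InstanceOf (instance-of B∈ℬ D)

  ball-analytic : ∀ k → An₂ (Path U k)
  ball-analytic zero    i j = analytic-resp ((λ e → e , tt) , proj₁) (proj₁ (Δ-≡ i j))
  ball-analytic (suc k) i j = analytic-resp
    ((λ (z , p , g) → z , p , g , tt) , λ (z , p , g , _) → z , p , g)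
    (analytic-∃ {P = λ w → Path U k (w (suc i)) (w 0) × G (w 0) (w (suc j))}
      (analytic-∩ (ball-analytic k (suc i) 0) (G-analytic 0 (suc j))))

  Orb : X → X → Set
  Orb = Conn U

  module Locality (G-finite : ∀ x → Finite (G x)) where
    open Decomposition em ext X G (inj₁ refl) G-sym G-finite hiding (Orb)

    -- An orbit is a countable union of balls, each an analytic relation with finite sections.
    𝒟-∃orb : ∀ i {Φ} → 𝒟 Φ → 𝒟 (λ v → ∃[ z ] Orb (v i) z × Φ (z ∷ₑ v))
    𝒟-∃orb i {Φ} d = resp
      ((λ (k , z , b , φ) → z , (k , b) , φ) , λ (z , (k , b) , φ) → k , z , b , φ)
      (gen-⋃ (λ k v → ∃[ z ] Ball k (v i) z × Φ (z ∷ₑ v)) λ k →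
        𝒟-∃ {R = λ w → Path U k (w (suc i)) (w 0)} (ball-analytic k (suc i) 0) (λ v → ball-finite k (v i)) d)

    -- `𝒟-∃` wants an analytic relation, but R is only known to lie in the σ-algebra. So the
    -- quantifier runs over the orbit, and R joins the quantified condition.
    𝒟-∃rel : ∀ {R} → D₂ R → (∀ {x y} → R x y → Orb x y) → ∀ i {Φ} → 𝒟 Φ → 𝒟 (λ v → ∃[ z ] R (v i) z × Φ (z ∷ₑ v))
    𝒟-∃rel dR R⊆Orb i d = resp
      ((λ (z , _ , r , φ) → z , r , φ) , λ (z , r , φ) → z , R⊆Orb r , r , φ)
      (𝒟-∃orb i (𝒟-∩ (dR (suc i) 0) d))

    -- The variables of a constraint lie in one orbit, so confining the tuple to the orbit of one
    -- point loses nothing and makes the quantifier admissible.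
    𝒟-∃Vec : ∀ k i {Φ} → 𝒟 Φ → 𝒟 (λ v → Σ[ u ∈ Vec X k ] (∀ j → Orb (v i) (lookup u j)) × Φ (u ++ₑ v))
    𝒟-∃Vec zero    i d = resp ((λ x → [] , (λ ()) , x) , λ { ([] , _ , x) → x }) d
    𝒟-∃Vec (suc k) i d = resp
      ( (λ { {v} (u , f , z , o , x) → z ∷ u , (λ { Fin.zero → subst (λ y → Orb y z) (++-+ u v i) o ; (Fin.suc j) → f j }) , x })
      , (λ { {v} (z ∷ u , f , x) → u , f ∘ Fin.suc , z , subst (λ y → Orb y z) (sym (++-+ u v i)) (f Fin.zero) , x }))
      (𝒟-∃Vec k i (𝒟-∃orb (k ℕ.+ i) d))

    G-𝒟 : D₂ G
    G-𝒟 i j = gen (G-analytic i j)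

    G⊆Orb : ∀ {x y} → G x y → Orb x y
    G⊆Orb g = conn-step (conn-refl tt) g tt

    conn⊆Orb : ∀ {Y x y} → Conn Y x y → Orb x y
    conn⊆Orb (zero , e , _) = 0 , e , tt
    conn⊆Orb (suc k , z , p , g , _) = conn-step (conn⊆Orb (k , p)) g tt

    path-𝒟 : ∀ {Y} → D₁ Y → ∀ k → D₂ (Path Y k)
    path-𝒟 dY zero    i j = 𝒟-∩ (𝒟-Δ (Δ-≡ i j)) (dY i)
    path-𝒟 {Y} dY (suc k) i j = 𝒟-∃rel (path-𝒟 dY k) (λ p → conn⊆Orb (k , p)) i {λ w → G (w 0) (w (suc j)) × Y (w (suc j))}
        (𝒟-∩ (G-𝒟 0 (suc j)) (dY (suc j)))

    conn-𝒟 : ∀ {Y} → D₁ Y → D₂ (Conn Y)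
    conn-𝒟 {Y} dY i j = gen-⋃ (λ k v → Path Y k (v i) (v j)) λ k → path-𝒟 dY k i j

    Meas : ∀ {n} → (X → Fin n) → Set₁
    Meas h = ∀ c → D₁ (λ x → h x ≡ c)

    -- Θ decides A from the pattern of colours and sides on the variables of a
    -- constraint, and there are only countably many patterns.
    event-𝒟 : ∀ {m} {h : X → Fin q} {side : X → Fin m} → Meas h → Meas side → (A : Constraint → Set) →
              (∀ {B B′} → B ≈ᶜ B′ → A B → A B′) →
              (Θ : (c : Code) → Word (proj₁ c) → Vec (Fin m) (proj₁ c) → Set) →
              (∀ c u → XL.Distinct u → (A (constraint u (proj₂ (proj₂ c))) → Θ c (Vec.map h u) (Vec.map side u)) ×
                                       (Θ c (Vec.map h u) (Vec.map side u) → A (constraint u (proj₂ (proj₂ c))))) →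
              D₁ (λ y → ∃[ B ] B ∈ ℬ × dom B y × A B)
    event-𝒟 {m} {h} {side} dh ds A A-resp Θ Θ⇔ i = resp (to , from) (𝒟-⋃ countable-index Q Q-𝒟)
      where
      Index : Set
      Index = Σ[ c ∈ Code ] (Fin (proj₁ c) × Word (proj₁ c) × Vec (Fin m) (proj₁ c))
      countable-index : Countable Index
      countable-index = countable-Σ countable-Code λ c → countable-Σ (countable-Fin _) λ _ →
        countable-Σ (countable-Word _) λ _ → countable-Vec (countable-Fin m) _
      Ψ : Index → Pred Env 0ℓ
      Ψ (c , j , w , s) e = Instance c (take (proj₁ c) e) × e (toℕ j) ≡ e (proj₁ c ℕ.+ i) ×
        (∀ l → h (e (toℕ l)) ≡ lookup w l) × (∀ l → side (e (toℕ l)) ≡ lookup s l)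
      Q : Index → Pred Env 0ℓ
      Q s@(c , j , w , t) v = Θ c w t × (Σ[ u ∈ Vec X (proj₁ c) ] (∀ j → Orb (v i) (lookup u j)) × Ψ s (u ++ₑ v))
      Q-𝒟 : ∀ s → 𝒟 (Q s)
      Q-𝒟 s@(c , j , w , t) = 𝒟-∩ (𝒟-const (Θ c w t)) (𝒟-∃Vec (proj₁ c) i {Ψ s}
        (𝒟-∩ (𝒟-Δ (Δ-instance c)) (𝒟-∩ (𝒟-Δ (Δ-≡ (toℕ j) (proj₁ c ℕ.+ i)))
          (𝒟-∩ (𝒟-⋂ (countable-Fin _) _ λ l → dh (lookup w l) (toℕ l)) (𝒟-⋂ (countable-Fin _) _ λ l → ds (lookup t l) (toℕ l))))))
      map-≡ : ∀ {n k} {g : X → Fin n} (u : Vec X k) v w → (∀ l → g ((u ++ₑ v) (toℕ l)) ≡ lookup w l) → w ≡ Vec.map g u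
      map-≡ {g = g} u v w f = trans (sym (Vecₚ.tabulate∘lookup w)) (trans (Vecₚ.tabulate-cong λ l →
        trans (sym (f l)) (trans (cong g (++-toℕ u v l)) (sym (Vecₚ.lookup-map l g u)))) (Vecₚ.tabulate∘lookup (Vec.map g u)))
      to : ⋃ Index Q ⊆ (λ v → ∃[ B ] B ∈ ℬ × dom B (v i) × A B)
      to {v} ((c@(k , n , b) , j , w , s) , θ , u , _ , ι , e , fw , fs) =
        constraint u b , Instance.member ι′
        , subst (dom (constraint u b)) (trans (sym (++-toℕ u v j)) (trans e (++-+ u v i))) (proj₂ (dom-constraint u b) j)
        , proj₂ (Θ⇔ c u (Instance.vars-distinct ι′))
            (subst (λ w → Θ c w (Vec.map side u)) (map-≡ u v w fw) (subst (Θ c w) (map-≡ u v s fs) θ))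
        where
        ι′ : Instance c u
        ι′ = subst (Instance c) (take-++ u v) ι
      from : (λ v → ∃[ B ] B ∈ ℬ × dom B (v i) × A B) ⊆ ⋃ Index Q
      from {v} (B , B∈ℬ , D , a) = let (j , e) = index D in
          (code , j , Vec.map h vars , Vec.map side vars)
        , proj₁ (Θ⇔ code vars (Instance.vars-distinct isInstance))
            (A-resp {B} {constraint vars (proj₂ (proj₂ code))} (≈ᶜ-sym {constraint vars (proj₂ (proj₂ code))} {B} same) a)
        , vars , (λ j → G⊆Orb (inj₂ (B , B∈ℬ , D , inDom j)))
        , subst (Instance code) (sym (take-++ vars v)) isInstance
        , trans (++-toℕ vars v j) (trans (sym e) (sym (++-+ vars v i)))
        , (λ l → trans (cong h (++-toℕ vars v l)) (sym (Vecₚ.lookup-map l h vars)))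
        , (λ l → trans (cong side (++-toℕ vars v l)) (sym (Vecₚ.lookup-map l side vars)))
        where open InstanceOf (instance-of B∈ℬ D)

-- Measurability of toasts and of the two stages.

module MeasurableSolution (em : ∀ {ℓ} → ExcludedMiddle ℓ) (ext : ∀ {a b} → Extensionality a b)
    (X : Set) (q : ℕ) .{{_ : NonZero q}} (𝓤 : Uniform X) (𝔅 : σ-Algebra (setoid X))
    (borel : ∀ A → Measurable 𝔅 A → ∀ i → Descriptive.Δ em ext X 𝓤 (λ v → A (v i)))
    (ℬ : Pred (CSP.Constraint X q) 0ℓ) (isBorelCSP : CSP.IsBorelCSP X q 𝔅 ℬ)
    (G-finite : ∀ x → FiniteSets.Finite em (Stages.G em ext X q ℬ x)) where
  open Classical em
  open FiniteSets em
  open ℚ-Order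
  open Countability
  open Uniform 𝓤 using (Basic; basic-opn)
  open Descriptive em ext X 𝓤 hiding (Coded)
  open CSP X q
  open Coding em X q
  module S = Stages em ext X q ℬ
  open S using (G; G-sym; violates-resp; Codes)
  open Components X G G-sym
  open BorelCSP em ext X q 𝓤 𝔅 borel ℬ isBorelCSP
  open Locality G-finite
  open Decomposition em ext X G (inj₁ refl) G-sym G-finite hiding (Orb)
  open import Data.List.Membership.Propositional using (find) renaming (_∈_ to _∈ₗ_)
  open import Data.Rational.Base using (_<_)

  module ToastMeasurable (choose : ℕ → (X → X → Set) → ℕ) where
    open Toast Basic choose

    reach-𝒟 : ∀ {R} → FiniteEquivalence R → D₂ R → ∀ k → D₂ (Reach R k)
    reach-𝒟 fe dR zero    = dR
    reach-𝒟 {R} fe dR (suc k) i j =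
      𝒟-∃rel (reach-𝒟 fe dR k) (FiniteEquivalence.reach-orb fe k) i {λ e → ∃[ w ] G (e 0) w × R w (e (suc j))}
        (𝒟-∃rel G-𝒟 G⊆Orb 0 {λ e → R (e 0) (e (2 ℕ.+ j))} (dR 0 (2 ℕ.+ j)))

    basic-𝒟 : ∀ m → D₁ (Basic m)
    basic-𝒟 m i = 𝒟-Δ (Δ-opn i (basic-opn m))

    isolated-𝒟 : ∀ {R} → FiniteEquivalence R → D₂ R → ∀ n j → D₁ (Isolated Basic R n j)
    isolated-𝒟 fe dR n j i = 𝒟-∩ (basic-𝒟 j i) (gen-∁
      (𝒟-∃rel (reach-𝒟 fe dR (scale n)) (FiniteEquivalence.reach-orb fe (scale n)) i {λ e → Basic j (e 0) × ¬ e 0 ≡ e (suc i)}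
        (𝒟-∩ (basic-𝒟 j 0) (gen-∁ (𝒟-Δ (Δ-≡ 0 (suc i)))))))

    -- Each stage uses a single natural number as its chosen index, so even a nonconstructive choice
    -- costs no measurability.
    E-𝒟 : ∀ n → D₂ (E n)
    centre-𝒟 : ∀ n → D₁ (Centre n)
    E-𝒟 zero    i j = 𝒟-Δ (Δ-≡ i j)
    E-𝒟 (suc n) i j = 𝒟-∪ (E-𝒟 n i j)
      (𝒟-∃rel (reach-𝒟 (E-equivalence n) (E-𝒟 n) (3 ℕ.+ n)) (Eq.reach-orb n (3 ℕ.+ n)) i
        {λ e → Centre n (e 0) × Reach (E n) (3 ℕ.+ n) (e 0) (e (suc j))}
        (𝒟-∩ (centre-𝒟 n 0) (reach-𝒟 (E-equivalence n) (E-𝒟 n) (3 ℕ.+ n) 0 (suc j))))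
    centre-𝒟 n = isolated-𝒟 (E-equivalence n) (E-𝒟 n) n (choose n (E n))

    ring-𝒟 : D₁ Ring
    ring-𝒟 i = gen-⋃ (λ n v → ∃[ a ] Centre n a × RingAt n a (v i)) λ n →
      resp ((λ (a , _ , c , r) → a , c , r)
           , λ (a , c , r) → a , conn-sym (Eq.reach-orb n (1 ℕ.+ n) (proj₁ r)) , c , r)
        (𝒟-∃orb i {λ e → Centre n (e 0) × RingAt n (e 0) (e (suc i))}
          (𝒟-∩ (centre-𝒟 n 0) (𝒟-∩ (reach n 0 (suc i))
            (𝒟-∃rel G-𝒟 G⊆Orb (suc i) {λ e → ¬ Reach (E n) (1 ℕ.+ n) (e 1) (e 0)} (gen-∁ (reach n 1 0))))))
      where
      reach : ∀ n → D₂ (Reach (E n) (1 ℕ.+ n))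
      reach n = reach-𝒟 (E-equivalence n) (E-𝒟 n) (1 ℕ.+ n)

  meas-const : ∀ {n} (c : Fin n) → Meas (λ _ → c)
  meas-const c c′ i = 𝒟-const (c ≡ c′)

  module StageMeasurable (codes : Codes) (code-meas : ∀ c → Meas (Codes.code codes c))
                         {Y : Pred X 0ℓ} (Y-𝒟 : D₁ Y) {f₀ : X → Fin q} (f₀-meas : Meas f₀)
                         (A : Constraint → (X → Fin q) → Set) where
    open Codes codes
    open S.Stage codes Y f₀ A

    merge-meas : ∀ {f} → Meas f → Meas (merge f)
    merge-meas {f} df c i = resp ((λ {v} → to {v}) , λ {v} → from {v}) (𝒟-∪ (𝒟-∩ (Y-𝒟 i) (df c i)) (𝒟-∩ (gen-∁ (Y-𝒟 i)) (f₀-meas c i)))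
      where
      to : ∀ {v : Env} → (Y (v i) × f (v i) ≡ c) ⊎ (¬ Y (v i) × f₀ (v i) ≡ c) → merge f (v i) ≡ c
      to (inj₁ (y , e))  = trans (merge-∈ f y) e
      to (inj₂ (¬y , e)) = trans (merge-∉ f ¬y) e
      from : ∀ {v : Env} → merge f (v i) ≡ c → (Y (v i) × f (v i) ≡ c) ⊎ (¬ Y (v i) × f₀ (v i) ≡ c)
      from {v} e = Sum.map (λ y → y , trans (sym (merge-∈ f y)) e) (λ ¬y → ¬y , trans (sym (merge-∉ f ¬y)) e) (lem (Y (v i)))

    module _ (bad-𝒟 : ∀ c → D₁ (Bad c)) where
      good-𝒟 : ∀ c → D₁ (Good c)
      good-𝒟 c i = resp ((λ none y p b → none (y , p , b)) , λ g (y , p , b) → g y p b)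
        (gen-∁ (𝒟-∃rel (conn-𝒟 Y-𝒟) conn⊆Orb i {λ e → Bad c (e 0)} (bad-𝒟 c 0)))

      least-𝒟 : ∀ c → D₁ (Least c)
      least-𝒟 c i = 𝒟-∩ (good-𝒟 c i) (resp
        ( (λ f c′ lt g → Sum.[ (λ ¬lt → ¬lt lt) , (λ ¬g → ¬g g) ]′ (f c′))
        , (λ f c′ → Sum.[ (λ lt → inj₂ (f c′ lt)) , inj₁ ]′ (lem (c′ ℕ.< c))))
        (𝒟-⋂ countable-ℕ (λ c′ v → ¬ c′ ℕ.< c ⊎ ¬ Good c′ (v i)) λ c′ → 𝒟-∪ (𝒟-const _) (gen-∁ (good-𝒟 c′ i))))

      result-meas : Meas result
      result-meas k i = resp ((λ {v} → to {v}) , λ {v} → from {v})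
        (𝒟-∪ (gen-⋃ (λ c v → Y (v i) × Least c (v i) × code c (v i) ≡ k) λ c →
                 𝒟-∩ (Y-𝒟 i) (𝒟-∩ (least-𝒟 c i) (code-meas c k i)))
             (𝒟-∩ (𝒟-∪ (gen-∁ (Y-𝒟 i)) (gen-∁ (gen-⋃ (λ c v → Good c (v i)) λ c → good-𝒟 c i))) (f₀-meas k i)))
        where
        P : Env → Set
        P v = (∃[ c ] Y (v i) × Least c (v i) × code c (v i) ≡ k) ⊎ ((¬ Y (v i) ⊎ ¬ (∃[ c ] Good c (v i))) × f₀ (v i) ≡ k)
        to : ∀ {v} → P v → result (v i) ≡ k
        to (inj₁ (c , y , l , e))   = trans (result-∈ y l) e
        to (inj₂ (inj₁ ¬y , e))   = trans (result-∉ ¬y) e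
        to (inj₂ (inj₂ none , e)) = trans (result-default none) e
        from : ∀ {v} → result (v i) ≡ k → P v
        from {v} e = cases (lem (Y (v i))) (lem (∃[ c ] Good c (v i)))
          where
          cases : Y (v i) ⊎ ¬ Y (v i) → (∃[ c ] Good c (v i)) ⊎ ¬ (∃[ c ] Good c (v i)) → P v
          cases (inj₂ ¬y) _           = inj₂ (inj₁ ¬y , trans (sym (result-∉ ¬y)) e)
          cases (inj₁ _) (inj₂ none)  = inj₂ (inj₂ none , trans (sym (result-default none)) e)
          cases (inj₁ y) (inj₁ g)     = let (c , l) = least (λ c → Good c (v i)) g in
                                        inj₁ (c , y , l , trans (sym (result-∈ y l)) e)

  -- Decision lists over basic open sets: countably many, each measurable, and enough to realise
  -- every colouring of a finite set.
  paint : Fin q → List (ℕ × Fin q) → X → Fin q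
  paint c₀ []            x = c₀
  paint c₀ ((m , c) ∷ s) x with lem (Basic m x)
  ... | inj₁ _ = c
  ... | inj₂ _ = paint c₀ s x

  paint-here : ∀ {c₀ m c s x} → Basic m x → paint c₀ ((m , c) ∷ s) x ≡ c
  paint-here {m = m} {x = x} b with lem (Basic m x)
  ... | inj₁ _  = refl
  ... | inj₂ ¬b = contradiction b ¬b

  paint-there : ∀ {c₀ m c s x} → ¬ Basic m x → paint c₀ ((m , c) ∷ s) x ≡ paint c₀ s x
  paint-there {m = m} {x = x} ¬b with lem (Basic m x)
  ... | inj₁ b = contradiction b ¬b
  ... | inj₂ _ = refl

  paint-meas : ∀ c₀ s → Meas (paint c₀ s)
  paint-meas c₀ []            = meas-const c₀
  paint-meas c₀ ((m , c) ∷ s) k i = resp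
    ( (λ { (inj₁ (b , e)) → trans (paint-here b) e ; (inj₂ (¬b , e)) → trans (paint-there ¬b) e })
    , (λ { {v} e → Sum.map (λ b → b , trans (sym (paint-here b)) e) (λ ¬b → ¬b , trans (sym (paint-there ¬b)) e) (lem (Basic m (v i))) }))
    (𝒟-∪ (𝒟-∩ basic (𝒟-const (c ≡ k))) (𝒟-∩ (gen-∁ basic) (paint-meas c₀ s k i)))
    where
    basic : 𝒟 (λ v → Basic m (v i))
    basic = 𝒟-Δ (Δ-opn i (basic-opn m))

  -- The rule for `x` goes in front, on a basic set that contains no later point except repetitions
  -- of `x`, whose colour is the same.
  paint-realise : ∀ c₀ xs (f : X → Fin q) → ∃[ s ] ∀ x → x ∈ₗ xs → paint c₀ s x ≡ f x
  paint-realise c₀ []       f = [] , λ _ ()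
  paint-realise c₀ (x ∷ xs) f =
    let (s , g) = paint-realise c₀ xs f ; (m , b , only) = isolate x xs in
    (m , f x) ∷ s , λ
      { _ (here refl) → paint-here b
      ; y (there e) → Sum.[ (λ b′ → trans (paint-here b′) (cong f (sym (only y e b′))))
                          , (λ ¬b′ → trans (paint-there ¬b′) (g y e)) ]′ (lem (Basic m y)) }

  module Painted (c₀ : Fin q) where
    private
      countable-paint : Countable (List (ℕ × Fin q))
      countable-paint = countable-List (countable-Σ countable-ℕ λ _ → countable-Fin q)

      decode : Maybe (List (ℕ × Fin q)) → X → Fin q
      decode (just s) = paint c₀ s
      decode nothing  = λ _ → c₀

      decode-meas : ∀ s → Meas (decode s)
      decode-meas (just s) = paint-meas c₀ s
      decode-meas nothing  = meas-const c₀

    codes : Codes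
    codes = record
      { code    = λ n → decode (proj₁ countable-paint n)
      ; realise = λ xs f → let (s , g) = paint-realise c₀ xs f ; (n , e) = proj₂ countable-paint s in
                  n , λ x x∈ → trans (cong (λ t → decode t x) e) (g x x∈) }

    codes-meas : ∀ c → Meas (Codes.code codes c)
    codes-meas c = decode-meas (proj₁ countable-paint c)

  module SolutionMeasurable {d : ℕ} (sparse : S.Sparse d) {r : ℚ} (0<r : 0ℚ < r) (r<1 : r < 1ℚ)
           (unlikely : ∀ B → B ∈ ℬ → ∀ xs → (∀ x → dom B x → x ∈ₗ xs) → ∀ f →
              Averaging.E em ext X q xs (λ f → 𝟙 (Violates f B)) f ℚ.≤ (r ℚ.* pow (1ℚ ℚ.- r) d) ℚ.* (r ℚ.* pow (1ℚ ℚ.- r) d))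
           (c₀ : Fin q) where
    open Painted c₀
    open S.TwoStages sparse 0<r r<1 unlikely codes (λ _ → c₀)
    module AvX = Averaging em ext X q

    Matches : ∀ {k n} → Vec (Word k) n → (Fin k → Fin q) → Set
    Matches b g = ∃[ j ] lookup b j ≡ tabulate g

    module _ {k : ℕ} (u : Vec X k) (u-distinct : XL.Distinct u) where
      module AvK = Averaging em ext (Fin k) q

      restrict : (X → Fin q) → Fin k → Fin q
      restrict f i = f (lookup u i)

      update-restrict : ∀ f j c → restrict (AvX.update f (lookup u j) c) ≡ AvK.update (restrict f) j c
      update-restrict f j c = ext go
        where
        go : ∀ i → restrict (AvX.update f (lookup u j) c) i ≡ AvK.update (restrict f) j c i
        go i with lem (i ≡ j)
        ... | inj₁ refl = trans (AvX.update-≡ f (lookup u j) c) (sym (AvK.update-≡ (restrict f) j c))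
        ... | inj₂ i≢j  = trans (AvX.update-≢ f c (λ e → i≢j (u-distinct i j e))) (sym (AvK.update-≢ (restrict f) c i≢j))

      -- Random colours of points become random colours of positions, so a conditional probability
      -- depends on a finite pattern only. Distinctness of the points lets one position be updated
      -- without another.
      E-restrict : ∀ js (F : (Fin k → Fin q) → ℚ) f →
                   AvX.E (List.map (lookup u) js) (F ∘ restrict) f ≡ AvK.E js F (restrict f)
      E-restrict []       F f = refl
      E-restrict (j ∷ js) F f = AvX.avg-cong λ c →
        trans (E-restrict js F (AvX.update f (lookup u j) c)) (cong (AvK.E js F) (update-restrict f j c))

      viol-restrict : ∀ {n} (b : Vec (Word k) (suc n)) f → viol (constraint u b) f ≡ 𝟙 (Matches b (restrict f))
      viol-restrict b f = 𝟙-cong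
        (λ v → let (j , e) = proj₁ (violates-constraint u b u-distinct f) v in j , trans e tabulate-restrict)
        (λ (j , e) → proj₂ (violates-constraint u b u-distinct f) (j , trans e (sym tabulate-restrict)))
        where
        tabulate-restrict : Vec.map f u ≡ tabulate (restrict f)
        tabulate-restrict = trans (sym (Vecₚ.tabulate∘lookup (Vec.map f u))) (Vecₚ.tabulate-cong λ l → Vecₚ.lookup-map l f u)

    module _ {X₀ : Pred X 0ℓ} (X₀-𝒟 : D₁ X₀) where
      side : X → Fin 2
      side x with lem (X₀ x)
      ... | inj₁ _ = Fin.zero
      ... | inj₂ _ = Fin.suc Fin.zero

      side-∈ : ∀ {x} → X₀ x → side x ≡ Fin.zero
      side-∈ {x} X₀x with lem (X₀ x)
      ... | inj₁ _  = refl
      ... | inj₂ ¬p = contradiction X₀x ¬p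

      side-∉ : ∀ {x} → ¬ X₀ x → side x ≡ Fin.suc Fin.zero
      side-∉ {x} ¬p with lem (X₀ x)
      ... | inj₁ p = contradiction p ¬p
      ... | inj₂ _ = refl

      side-meas : Meas side
      side-meas k i = resp
        ( (λ { (inj₁ (p , e)) → trans (side-∈ p) e ; (inj₂ (¬p , e)) → trans (side-∉ ¬p) e })
        , (λ { {v} e → Sum.map (λ p → p , trans (sym (side-∈ p)) e) (λ ¬p → ¬p , trans (sym (side-∉ ¬p)) e) (lem (X₀ (v i))) }))
        (𝒟-∪ (𝒟-∩ (X₀-𝒟 i) (𝒟-const (Fin.zero ≡ k))) (𝒟-∩ (gen-∁ (X₀-𝒟 i)) (𝒟-const (Fin.suc Fin.zero ≡ k))))

      free : ∀ {k} → Vec (Fin 2) k → List (Fin k)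
      free s = proj₁ (exact {P = λ l → lookup s l ≡ Fin.suc Fin.zero} (List.allFin _ , λ l _ → Anyₚ.tabulate⁺ {f = id} l refl))

      free-∈ : ∀ {k} (s : Vec (Fin 2) k) →
               (∀ l → lookup s l ≡ Fin.suc Fin.zero → l ∈ₗ free s) × (∀ l → l ∈ₗ free s → lookup s l ≡ Fin.suc Fin.zero)
      free-∈ s = proj₂ (exact {P = λ l → lookup s l ≡ Fin.suc Fin.zero} (List.allFin _ , λ l _ → Anyₚ.tabulate⁺ {f = id} l refl))

      -- `Risky` computed on positions: those outside `X₀` are averaged over, and `w` supplies the
      -- colours of the others.
      RiskyCode : (c : Code) → Word (proj₁ c) → Vec (Fin 2) (proj₁ c) → Set
      RiskyCode (k , n , b) w s = L < Averaging.E em ext (Fin k) q (free s) (λ g → 𝟙 (Matches b g)) (lookup w)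

      risky-code : ∀ h c u → XL.Distinct u →
        (Risky X₀ (constraint u (proj₂ (proj₂ c))) h → RiskyCode c (Vec.map h u) (Vec.map side u)) ×
        (RiskyCode c (Vec.map h u) (Vec.map side u) → Risky X₀ (constraint u (proj₂ (proj₂ c))) h)
      risky-code h (k , n , b) u u-distinct =
          (λ (ys , s , c , L<E) → subst (L <_) (trans (AvX.E-absorb {ys} {zs} {viol B}
                (λ x e → uncurry (c x) (zs-sound x e)) (λ x e → inj₁ (uncurry (zs-complete x) (s x e))) h) E-zs) L<E)
        , (λ L<E → zs , zs-sound , zs-complete , subst (L <_) (sym E-zs) L<E)
        where
        B : Constraint
        B = constraint u b
        s : Vec (Fin 2) k
        s = Vec.map side u
        zs : List X
        zs = List.map (lookup u) (free s)
        side-free : ∀ l → lookup s l ≡ side (lookup u l)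
        side-free l = Vecₚ.lookup-map l side u
        zs-sound : ∀ x → x ∈ₗ zs → dom B x × ¬ X₀ x
        zs-sound x e = let (l , l∈ , x≡) = ∈-map e in
            subst (dom B) (sym x≡) (proj₂ (dom-constraint u b) l)
          , λ X₀x → case trans (sym (side-∈ (subst X₀ x≡ X₀x))) (trans (sym (side-free l)) (proj₂ (free-∈ s) l l∈)) of λ ()
          where
          ∈-map : ∀ {x} → x ∈ₗ zs → ∃[ l ] l ∈ₗ free s × x ≡ lookup u l
          ∈-map e = find (Anyₚ.map⁻ e)
        zs-complete : ∀ x → dom B x → ¬ X₀ x → x ∈ₗ zs
        zs-complete x D ¬X₀x = let (l , x≡) = proj₁ (dom-constraint u b) D in
          Anyₚ.map⁺ (Any.map (λ { refl → x≡ })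
            (proj₁ (free-∈ s) l (trans (side-free l) (side-∉ (λ p → ¬X₀x (subst X₀ (sym x≡) p))))))
        E-zs : AvX.E zs (viol B) h ≡ Averaging.E em ext (Fin k) q (free s) (λ g → 𝟙 (Matches b g)) (lookup (Vec.map h u))
        E-zs = trans (AvX.E-cong zs (viol-restrict u u-distinct b) h)
          (trans (E-restrict u u-distinct (free s) (λ g → 𝟙 (Matches b g)) h)
            (cong (Averaging.E em ext (Fin k) q (free s) (λ g → 𝟙 (Matches b g))) (ext λ l → sym (Vecₚ.lookup-map l h u))))

      module M₁ = StageMeasurable codes codes-meas {X₀} X₀-𝒟 (meas-const c₀) (Risky X₀)

      first-meas : Meas (S₁.result X₀)
      first-meas = M₁.result-meas λ c → event-𝒟 (M₁.merge-meas (codes-meas c)) side-meas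
        (λ B → Risky X₀ B (S₁.merge X₀ (Codes.code codes c))) (risky-resp X₀)
        RiskyCode (risky-code (S₁.merge X₀ (Codes.code codes c)))

      module M₂ = StageMeasurable codes codes-meas {∁ X₀} (λ i → gen-∁ (X₀-𝒟 i)) {S₁.result X₀} first-meas (λ B f → Violates f B)

      solution-meas : Meas (solution X₀)
      -- Violation depends on colours alone, so the side map is constant with a single value.
      solution-meas = M₂.result-meas λ c → event-𝒟 (M₂.merge-meas (codes-meas c)) (meas-const {1} Fin.zero)
        (λ B → Violates (S₂.merge X₀ (Codes.code codes c)) B) violates-resp
        (λ (k , n , b) w _ → ∃[ j ] lookup b j ≡ w)
        (λ (k , n , b) u d → violates-constraint u b d (S₂.merge X₀ (Codes.code codes c)))

-- The number e and the choice of the threshold.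

module Threshold where
  open ℚ-Order
  open Archimedean
  open import Data.Rational.Base using (_≤_; _<_; _+_; _*_; _-_)
  open import Data.Nat.Base using (_!)

  inv : ℕ → ℚ
  inv k = + 1 ℚ./ suc k

  0≤inv : ∀ k → 0ℚ ≤ inv k
  0≤inv k = ℚₚ.nonNegative⁻¹ (inv k) {{ℚₚ.normalize-nonNeg 1 (suc k)}}

  0<inv : ∀ k → 0ℚ < inv k
  0<inv k = ℚₚ.positive⁻¹ (inv k) {{ℚₚ.normalize-pos 1 (suc k)}}

  inv-* : ∀ k → inv k * fromℕℚ (suc k) ≡ 1ℚ
  inv-* k = 1/n*n≡1 (suc k)

  1/m*1/n : ∀ m n .{{_ : NonZero m}} .{{_ : NonZero n}} .{{_ : NonZero (m ℕ.* n)}} →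
            (+ 1 ℚ./ m) * (+ 1 ℚ./ n) ≡ + 1 ℚ./ (m ℕ.* n)
  1/m*1/n m@(suc _) n@(suc _) = ℚₚ.toℚᵘ-injective (begin
    ℚ.toℚᵘ ((+ 1 ℚ./ m) * (+ 1 ℚ./ n))                 ≈⟨ ℚₚ.toℚᵘ-homo-* (+ 1 ℚ./ m) (+ 1 ℚ./ n) ⟩
    ℚ.toℚᵘ (+ 1 ℚ./ m) ℚᵘ.* ℚ.toℚᵘ (+ 1 ℚ./ n)         ≈⟨ ℚᵘₚ.*-cong (toℚᵘ-/ 1 m) (toℚᵘ-/ 1 n) ⟩
    (+ 1 ℚᵘ./ m) ℚᵘ.* (+ 1 ℚᵘ./ n)                     ≈⟨ ℚᵘ.*≡* refl ⟩
    + 1 ℚᵘ./ (m ℕ.* n)                                 ≈⟨ toℚᵘ-/ 1 (m ℕ.* n) ⟨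
    ℚ.toℚᵘ (+ 1 ℚ./ (m ℕ.* n))                         ∎)
    where open ℚᵘₚ.≃-Reasoning

  pow-inverse : ∀ q n .{{_ : NonZero q}} → pow (+ 1 ℚ./ q) n ≡ (+ 1 ℚ./ (q ℕ.^ n)) {{ℕₚ.m^n≢0 q n}}
  pow-inverse q zero    = refl
  pow-inverse q (suc n) {{q≢0}} = trans (cong ((+ 1 ℚ./ q) *_) (pow-inverse q n))
    (1/m*1/n q (q ℕ.^ n) {{q≢0}} {{ℕₚ.m^n≢0 q n}} {{ℕₚ.m^n≢0 q (suc n)}})

  pow-* : ∀ x y n → pow x n * pow y n ≡ pow (x * y) n
  pow-* x y zero    = refl
  pow-* x y (suc n) = trans
    (solve 4 (λ x y a b → (x :* a) :* (y :* b) := (x :* y) :* (a :* b)) refl x y (pow x n) (pow y n))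
    (cong (x * y *_) (pow-* x y n))
    where open ℚ-Solver.+-*-Solver

  pow-1 : ∀ n → pow 1ℚ n ≡ 1ℚ
  pow-1 zero    = refl
  pow-1 (suc n) = trans (ℚₚ.*-identityˡ _) (pow-1 n)

  -- term a k = a ^ k / k!
  term : ℚ → ℕ → ℚ
  term a zero    = 1ℚ
  term a (suc k) = term a k * a * inv k

  exp≤ : ℚ → ℕ → ℚ
  exp≤ a zero    = 1ℚ
  exp≤ a (suc n) = exp≤ a n + term a (suc n)

  0≤term : ∀ {a} k → 0ℚ ≤ a → 0ℚ ≤ term a k
  0≤term zero    0≤a = 0≤1
  0≤term (suc k) 0≤a = 0≤* (0≤* (0≤term k 0≤a) 0≤a) (0≤inv k)

  -- The left side consists of two terms in the binomial expansion of (a+y)^(k+1)/(k+1)!; the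
  -- induction drops a term in y^2.
  term-shift : ∀ {a y} k → 0ℚ ≤ a → 0ℚ ≤ y → term a (suc k) + y * term a k ≤ term (a + y) (suc k)
  term-shift {a} {y} zero    0≤a 0≤y = ℚₚ.≤-reflexive
    (solve 2 (λ a y → con 1ℚ :* a :* con 1ℚ :+ y :* con 1ℚ := con 1ℚ :* (a :+ y) :* con 1ℚ) refl a y)
    where open ℚ-Solver.+-*-Solver
  term-shift {a} {y} (suc k) 0≤a 0≤y = begin
    t′ * a * i + y * t′                                    ≡⟨ cong (λ z → t′ * a * i + y * z) unit ⟩
    t′ * a * i + y * (t′ * (i * (1ℚ + (1ℚ + n))))          ≡⟨ solve 5 (λ t′ a i y n → t′ :* a :* i :+ y :* (t′ :* (i :* (con 1ℚ :+ (con 1ℚ :+ n))))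
                                                                := (t′ :* a :+ t′ :* y :+ y :* (t′ :* (con 1ℚ :+ n))) :* i) refl t′ a i y n ⟩
    (t′ * a + t′ * y + y * (t′ * (1ℚ + n))) * i            ≡⟨ cong (λ z → (t′ * a + t′ * y + y * z) * i) back ⟩
    (t′ * a + t′ * y + y * (t * a)) * i                    ≤⟨ *-monoʳ (0≤inv (suc k)) drop ⟩
    (t′ + y * t) * (a + y) * i                             ≤⟨ *-monoʳ (0≤inv (suc k)) (*-monoʳ (ℚₚ.+-mono-≤ 0≤a 0≤y) (term-shift k 0≤a 0≤y)) ⟩
    term (a + y) (suc k) * (a + y) * i                     ∎
    where
    open ℚₚ.≤-Reasoning
    open ℚ-Solver.+-*-Solver
    t t′ i n : ℚ
    t  = term a k
    t′ = term a (suc k)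
    i  = inv (suc k)
    n  = fromℕℚ k
    unit : t′ ≡ t′ * (i * (1ℚ + (1ℚ + n)))
    unit = sym (trans (cong (t′ *_) (trans (cong (i *_) (sym (trans (fromℕℚ-suc (suc k)) (cong (λ z → 1ℚ + z) (fromℕℚ-suc k))))) (inv-* (suc k))))
                      (ℚₚ.*-identityʳ t′))
    back : t′ * (1ℚ + n) ≡ t * a
    back = trans (cong (t′ *_) (sym (fromℕℚ-suc k))) (trans (ℚₚ.*-assoc (t * a) (inv k) (fromℕℚ (suc k)))
             (trans (cong (t * a *_) (inv-* k)) (ℚₚ.*-identityʳ (t * a))))
    drop : t′ * a + t′ * y + y * (t * a) ≤ (t′ + y * t) * (a + y)
    drop = subst (_≤ (t′ + y * t) * (a + y)) (ℚₚ.+-identityʳ _) (ℚₚ.≤-trans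
      (ℚₚ.+-monoʳ-≤ (t′ * a + t′ * y + y * (t * a)) (0≤* (0≤* 0≤y (0≤term k 0≤a)) 0≤y))
      (ℚₚ.≤-reflexive (solve 4 (λ t′ t a y → t′ :* a :+ t′ :* y :+ y :* (t :* a) :+ y :* t :* y := (t′ :+ y :* t) :* (a :+ y)) refl t′ t a y)))

  -- A truncated form of (1 + y) e^a ≤ e^(a+y): multiplication by y raises the degree, so that part
  -- stops one term earlier.
  exp-shift : ∀ {a y} n → 0ℚ ≤ a → 0ℚ ≤ y → exp≤ a (suc n) + y * exp≤ a n ≤ exp≤ (a + y) (suc n)
  exp-shift {a} {y} zero    0≤a 0≤y = ℚₚ.≤-trans (ℚₚ.≤-reflexive (ℚₚ.+-assoc 1ℚ (term a 1) (y * 1ℚ)))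
    (ℚₚ.+-monoʳ-≤ 1ℚ (term-shift 0 0≤a 0≤y))
  exp-shift {a} {y} (suc n) 0≤a 0≤y = ℚₚ.≤-trans
    (ℚₚ.≤-reflexive (solve 5 (λ e t e′ t′ y → (e :+ t) :+ y :* (e′ :+ t′) := (e :+ y :* e′) :+ (t :+ y :* t′)) refl
      (exp≤ a (suc n)) (term a (2 ℕ.+ n)) (exp≤ a n) (term a (suc n)) y))
    (ℚₚ.+-mono-≤ (exp-shift n 0≤a 0≤y) (term-shift (suc n) 0≤a 0≤y))
    where open ℚ-Solver.+-*-Solver

  -- Stands in for (1 + y)^m ≤ e^(my) within the rationals; for y = 1/m it compares (1 + 1/m)^m with
  -- a partial sum of e.
  pow≤exp : ∀ {y} m → 0ℚ ≤ y → pow (1ℚ + y) m ≤ exp≤ (fromℕℚ m * y) m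
  pow≤exp zero    0≤y = ℚₚ.≤-refl
  pow≤exp {y} (suc m) 0≤y = begin
    (1ℚ + y) * pow (1ℚ + y) m          ≤⟨ *-monoˡ (ℚₚ.+-mono-≤ 0≤1 0≤y) (pow≤exp m 0≤y) ⟩
    (1ℚ + y) * exp≤ a m                ≡⟨ solve 2 (λ y e → (con 1ℚ :+ y) :* e := e :+ y :* e) refl y (exp≤ a m) ⟩
    exp≤ a m + y * exp≤ a m            ≤⟨ ℚₚ.+-monoˡ-≤ (y * exp≤ a m) (subst (_≤ exp≤ a (suc m)) (ℚₚ.+-identityʳ (exp≤ a m)) (ℚₚ.+-monoʳ-≤ (exp≤ a m) (0≤term (suc m) 0≤a))) ⟩
    exp≤ a (suc m) + y * exp≤ a m      ≤⟨ exp-shift m 0≤a 0≤y ⟩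
    exp≤ (a + y) (suc m)               ≡⟨ cong (λ z → exp≤ z (suc m)) (trans (solve 2 (λ n y → n :* y :+ y := (con 1ℚ :+ n) :* y) refl (fromℕℚ m) y) (cong (_* y) (sym (fromℕℚ-suc m)))) ⟩
    exp≤ (fromℕℚ (suc m) * y) (suc m)  ∎
    where
    open ℚₚ.≤-Reasoning
    open ℚ-Solver.+-*-Solver
    a : ℚ
    a = fromℕℚ m * y
    0≤a : 0ℚ ≤ a
    0≤a = 0≤* (0≤fromℕℚ m) 0≤y

  term-1 : ∀ k → term 1ℚ k ≡ (+ 1 ℚ./ (k !)) {{ℕₚ._!≢0 k}}
  term-1 zero    = refl
  term-1 (suc k) = begin
    term 1ℚ k * 1ℚ * inv k                              ≡⟨ cong (_* inv k) (trans (ℚₚ.*-identityʳ _) (term-1 k)) ⟩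
    (+ 1 ℚ./ (k !)) {{ℕₚ._!≢0 k}} * inv k               ≡⟨ ℚₚ.*-comm _ (inv k) ⟩
    inv k * (+ 1 ℚ./ (k !)) {{ℕₚ._!≢0 k}}               ≡⟨ 1/m*1/n (suc k) (k !) {{_}} {{ℕₚ._!≢0 k}} {{ℕₚ._!≢0 (suc k)}} ⟩
    (+ 1 ℚ./ (suc k !)) {{ℕₚ._!≢0 (suc k)}}             ∎
    where open ≡-Reasoning

  exp≤-1 : ∀ n → exp≤ 1ℚ n ≡ eSum n
  exp≤-1 zero    = refl
  exp≤-1 (suc n) = cong₂ _+_ (exp≤-1 n) (term-1 (suc n))

  eSum-suc : ∀ n → eSum n < eSum (suc n)
  eSum-suc n = subst (_< eSum (suc n)) (ℚₚ.+-identityʳ (eSum n))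
    (ℚₚ.+-monoʳ-< (eSum n) (ℚₚ.positive⁻¹ _ {{ℚₚ.normalize-pos 1 (suc n !) {{ℕₚ._!≢0 (suc n)}}}}))

  e⁻¹< : ∀ {s} n → 1ℚ < s * eSum n → e⁻¹ <ℚ s
  e⁻¹< {s} n 1<sE = n , ℚₚ.*-cancelʳ-<-nonNeg (eSum n) {{ℚₚ.pos⇒nonNeg (eSum n) {{eSum-pos n}}}}
    (subst (_< s * eSum n) (sym (ℚₚ.*-inverseˡ (eSum n) {{ℚₚ.pos⇒nonZero (eSum n) {{eSum-pos n}}}})) 1<sE)

  -- x = 1/(d+1) maximises x(1-x)^d; for d = 0 this would be x = 1, and any
  -- x with 1/e < x < 1 will do.
  threshold : ∀ d → ∃[ x ] 0ℚ < x × x < 1ℚ × e⁻¹ <ℚ fromℕℚ (suc d) * (x * pow (1ℚ - x) d)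
  threshold zero = ½ , ℚₚ.positive⁻¹ ½ , toWitness {a? = ½ ℚₚ.<? 1ℚ} tt
    , e⁻¹< 2 (toWitness {a? = 1ℚ ℚₚ.<? (fromℕℚ 1 * (½ * 1ℚ)) * eSum 2} tt)
  threshold d@(suc d′) = x , 0<inv d , x<1 , e⁻¹< (suc d) (begin-strict
    -- With a = 1/d one has (1 - x)(1 + a) = 1, and (d+1)x = 1 reduces the claim to (1 - x)^d > 1/e.
    -- One further term of the series makes the inequality strict.
    1ℚ                                     ≡⟨ inverse ⟨
    pow (1ℚ - x) d * pow (1ℚ + a) d        ≤⟨ *-monoˡ (ℚₚ.<⇒≤ (0<pow d 0<1-x)) (pow≤exp d (0≤inv d′)) ⟩
    pow (1ℚ - x) d * exp≤ (fromℕℚ d * a) d ≡⟨ cong (λ z → pow (1ℚ - x) d * exp≤ z d) (trans (ℚₚ.*-comm (fromℕℚ d) a) (inv-* d′)) ⟩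
    pow (1ℚ - x) d * exp≤ 1ℚ d             ≡⟨ cong (pow (1ℚ - x) d *_) (exp≤-1 d) ⟩
    pow (1ℚ - x) d * eSum d                <⟨ ℚₚ.*-monoʳ-<-pos (pow (1ℚ - x) d) {{ℚ.positive (0<pow d 0<1-x)}} (eSum-suc d) ⟩
    pow (1ℚ - x) d * eSum (suc d)          ≡⟨ cong (_* eSum (suc d)) scaled ⟨
    (fromℕℚ (suc d) * (x * pow (1ℚ - x) d)) * eSum (suc d) ∎)
    where
    open ℚₚ.≤-Reasoning
    open ℚ-Solver.+-*-Solver
    x a n : ℚ
    x = inv d
    a = inv d′
    n = fromℕℚ d
    x*[1+n] : x * (1ℚ + n) ≡ 1ℚ
    x*[1+n] = trans (cong (x *_) (sym (fromℕℚ-suc d))) (inv-* d)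
    1-x : 1ℚ - x ≡ x * n
    1-x = trans (cong (_- x) (sym x*[1+n])) (solve 2 (λ x n → x :* (con 1ℚ :+ n) :- x := x :* n) refl x n)
    0<1-x : 0ℚ < 1ℚ - x
    0<1-x = subst (0ℚ <_) (sym 1-x) (0<* (0<inv d) (0<fromℕℚ-suc d′))
    x<1 : x < 1ℚ
    x<1 = subst (x <_) (solve 1 (λ x → x :+ (con 1ℚ :- x) := con 1ℚ) refl x)
      (subst (_< x + (1ℚ - x)) (ℚₚ.+-identityʳ x) (ℚₚ.+-monoʳ-< x 0<1-x))
    inverse : pow (1ℚ - x) d * pow (1ℚ + a) d ≡ 1ℚ
    inverse = trans (pow-* (1ℚ - x) (1ℚ + a) d) (trans (cong (λ z → pow z d)
      (trans (cong (_* (1ℚ + a)) 1-x) (trans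
        (solve 3 (λ x n a → x :* n :* (con 1ℚ :+ a) := x :* (n :+ a :* n)) refl x n a)
        (trans (cong (λ z → x * (n + z)) (inv-* d′)) (trans (cong (x *_) (ℚₚ.+-comm n 1ℚ)) x*[1+n]))))) (pow-1 d))
    scaled : fromℕℚ (suc d) * (x * pow (1ℚ - x) d) ≡ pow (1ℚ - x) d
    scaled = trans (sym (ℚₚ.*-assoc (fromℕℚ (suc d)) x _))
      (trans (cong (_* pow (1ℚ - x) d) (trans (ℚₚ.*-comm (fromℕℚ (suc d)) x) (inv-* d))) (ℚₚ.*-identityˡ _))

  -- As (d+1)L exceeds 1/e, its square lies in the upper cut of e^-2, and by hypothesis in that of
  -- p(d+1)^2. This cut yields a rational above p and rationals above d+1 whose product is at most
  -- ((d+1)L)^2, and (d+1)^2 cancels.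
  square-bound : ∀ (p : ℝ≥0) d → p *ᵣ fromℕ (suc d) ^ᵣ 2 ≤ᵣ e⁻¹ ^ᵣ 2 →
                 ∀ {L} → e⁻¹ <ℚ fromℕℚ (suc d) * L →
                 ∀ {ρ} → 0ℚ ≤ ρ → (∀ {b} → p <ℚ b → ρ < b) → ρ ≤ L * L
  square-bound p d hyp {L} e<λ {ρ} 0≤ρ ρ<p = conclude (hyp λ²)
    where
    D λ₀ : ℚ
    D = fromℕℚ (suc d)
    λ₀ = D * L
    0<D : 0ℚ < D
    0<D = 0<fromℕℚ-suc d
    -- The power ends in a factor 1, for which a rational strictly above 1 is required; an r between
    -- 1/e and λ₀ leaves room for λ₀/r.
    near : Above (e⁻¹ *ᵣ fromℕ 1) λ₀
    near = r , λ₀ * s , e<r , (0 , 1<λs) , ℚₚ.≤-reflexive (trans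
            (solve 3 (λ r l s → r :* (l :* s) := l :* (s :* r)) refl r λ₀ s)
            (trans (cong (λ₀ *_) s*r) (ℚₚ.*-identityʳ λ₀)))
      where
      open ℚ-Solver.+-*-Solver
      between : ∃[ r ] r < λ₀ × e⁻¹ <ℚ r
      between = ℝ≥0.open′ e⁻¹ e<λ
      r : ℚ
      r = proj₁ between
      r<λ : r < λ₀
      r<λ = proj₁ (proj₂ between)
      e<r : e⁻¹ <ℚ r
      e<r = proj₂ (proj₂ between)
      0<r : 0ℚ < r
      0<r = ℝ≥0.positive e⁻¹ e<r
      s : ℚ
      s = (ℚ.1/ r) {{ℚₚ.pos⇒nonZero r {{ℚ.positive 0<r}}}}
      s*r : s * r ≡ 1ℚ
      s*r = ℚₚ.*-inverseˡ r {{ℚₚ.pos⇒nonZero r {{ℚ.positive 0<r}}}}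
      1<λs : 1ℚ < λ₀ * s
      1<λs = subst (_< λ₀ * s) (trans (ℚₚ.*-comm r s) s*r)
        (ℚₚ.*-monoˡ-<-pos s {{ℚₚ.1/pos⇒pos r {{ℚ.positive 0<r}}}} r<λ)
    λ² : Above (e⁻¹ ^ᵣ 2) (λ₀ * λ₀)
    λ² = λ₀ , λ₀ , e<λ , near , ℚₚ.≤-refl
    conclude : Above (p *ᵣ fromℕ (suc d) ^ᵣ 2) (λ₀ * λ₀) → ρ ≤ L * L
    conclude (b , c , p<b , (c₁ , c₂ , (_ , D<c₁) , (c₃ , o , (_ , D<c₃) , (_ , 1<o) , c₃o≤c₂) , c₁c₂≤c) , bc≤λ²) =
      ℚₚ.*-cancelʳ-≤-pos (D * D) {{ℚ.positive (0<* 0<D 0<D)}} (begin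
        ρ * (D * D)      ≤⟨ *-mono 0≤ρ (ℚₚ.<⇒≤ (ρ<p p<b)) (0≤* 0≤D 0≤D) (*-mono 0≤D (ℚₚ.<⇒≤ D<c₁) 0≤D D≤c₂) ⟩
        b * (c₁ * c₂)    ≤⟨ *-monoˡ (ℚₚ.≤-trans 0≤ρ (ℚₚ.<⇒≤ (ρ<p p<b))) c₁c₂≤c ⟩
        b * c            ≤⟨ bc≤λ² ⟩
        (D * L) * (D * L) ≡⟨ solve 2 (λ D L → (D :* L) :* (D :* L) := (L :* L) :* (D :* D)) refl D L ⟩
        L * L * (D * D)  ∎)
      where
      open ℚₚ.≤-Reasoning
      open ℚ-Solver.+-*-Solver
      0≤D : 0ℚ ≤ D
      0≤D = ℚₚ.<⇒≤ 0<D
      D≤c₂ : D ≤ c₂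
      D≤c₂ = begin
        D        ≡⟨ ℚₚ.*-identityʳ D ⟨
        D * 1ℚ   ≤⟨ *-mono 0≤D (ℚₚ.<⇒≤ D<c₃) 0≤1 (ℚₚ.<⇒≤ 1<o) ⟩
        c₃ * o   ≤⟨ c₃o≤c₂ ⟩
        c₂       ∎

-- Consequences of the bounds on probability and degree.

module SparseCSP (em : ∀ {ℓ} → ExcludedMiddle ℓ) (ext : ∀ {a b} → Extensionality a b)
                 (X : Set) (q : ℕ) .{{_ : NonZero q}} (ℬ : Pred (CSP.Constraint X q) 0ℓ) where
  open Classical em
  open FiniteSets em
  open ℚ-Order
  open Threshold
  open Averaging em ext X q
  open CSP X q
  open Coding em X q
  open Stages em ext X q ℬ using (Sparse; G; dom-resp; module Sparse)
  open Setoid Graphs using () renaming (_≈_ to _≈ᵍ_)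
  open Setoid GraphSets using () renaming (_≈_ to _≈ᶜ_; sym to ≈ᶜ-sym; trans to ≈ᶜ-trans)
  open Membership Graphs using () renaming (_∈_ to _∈ᶜ_)
  open Membership GraphSets using () renaming (_∈_ to _∈ₗᶜ_)
  open import Data.List.Membership.Propositional renaming (_∈_ to _∈ₗ_)
  open import Data.Rational.Base using (_≤_; _*_)
  module CL = SetoidLists em GraphSets

  unique-length : ∀ {xs ys : List Constraint} → AllPairs (λ B B′ → ¬ B ≈ᶜ B′) xs →
                  (∀ B → B ∈ₗᶜ xs → B ∈ₗᶜ ys) → length xs ℕ.≤ length ys
  unique-length {xs} {ys} uniq sub = Finₚ.injective⇒≤ {f = index} λ {i} {j} e →
    CL.unique⇒distinct v (subst (AllPairs (λ B B′ → ¬ B ≈ᶜ B′)) (sym (Vecₚ.toList∘fromList xs)) uniq) i j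
      (≈ᶜ-trans {lookup v i} {List.lookup ys (index i)} {lookup v j} (hit i)
        (subst (λ k → List.lookup ys k ≈ᶜ lookup v j) (sym e) (≈ᶜ-sym {lookup v j} {List.lookup ys (index j)} (hit j))))
    where
    v : Vec Constraint (length xs)
    v = Vec.fromList xs
    member : ∀ i → lookup v i ∈ₗᶜ ys
    member i = sub (lookup v i) (subst (lookup v i ∈ₗᶜ_) (Vecₚ.toList∘fromList xs)
      (CL.∈-toList⁺ v i {lookup v i} ((λ {φ} e → e) , λ {φ} e → e)))
    index : Fin (length xs) → Fin (length ys)
    index i = Any.index (member i)
    hit : ∀ i → lookup v i ≈ᶜ List.lookup ys (index i)
    hit i = Anyₚ.lookup-index (member i)

  -- The constraints at a point are all neighbours of any one of them or equal to it, so finite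
  -- degree leaves finitely many at each point.
  sparse : ℬ Respects _≈ᶜ_ → ∀ {d} → Is𝖽 ℬ d → Sparse d
  sparse ℬ-resp {d} (finite , bound , _) = record
    { dom-finite   = λ B _ → points B , dom-points B
    ; incident     = incident
    ; degree-bound = λ { B Bs B∈ℬ Bs⊆ℬ (B≉ ∷ pairs) adj →
        let (n , ys , uniq , len , ys⇔) = finite B B∈ℬ in
        ℕₚ.≤-trans (unique-length pairs λ B′ B′∈ → Equivalence.to (ys⇔ B′) (neighbour B B≉ Bs⊆ℬ adj B′ B′∈))
          (ℕₚ.≤-trans (ℕₚ.≤-reflexive len) (bound n (B , B∈ℬ , ys , uniq , len , ys⇔))) }
    }
    where
    incident : ∀ x → ∃[ Bs ] ∀ B → B ∈ ℬ → dom B x → Any (B ≈ᶜ_) Bs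
    incident x with lem (∃[ B ] B ∈ ℬ × dom B x)
    ... | inj₂ none = [] , λ B b D → contradiction (B , b , D) none
    ... | inj₁ (B₀ , b₀ , D₀) = let (n , ys , _ , _ , ys⇔) = finite B₀ b₀ in
          B₀ ∷ ys , λ B b D → Sum.[ here , (λ B≉ → there (Equivalence.to (ys⇔ B) (b , B≉ , x , D , D₀))) ]′ (lem (B ≈ᶜ B₀))
    neighbour : ∀ B {Bs} → All (λ B′ → ¬ B ≈ᶜ B′) Bs → All ℬ Bs → All (λ B′ → dom B′ ≬ dom B) Bs →
                ∀ B′ → B′ ∈ₗᶜ Bs → Neighbours ℬ B B′
    neighbour B {C ∷ _} (B≉C ∷ _) (c ∷ _) ((x , Cx , Bx) ∷ _) B′ (here B′≈C) =
        ℬ-resp (≈ᶜ-sym {B′} {C} B′≈C) c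
      , (λ B′≈B → B≉C (≈ᶜ-trans {B} {B′} {C} (≈ᶜ-sym {B′} {B} B′≈B) B′≈C))
      , x , dom-resp {C} {B′} (≈ᶜ-sym {B′} {C} B′≈C) Cx , Bx
    neighbour B (_ ∷ B≉) (_ ∷ Bs⊆ℬ) (_ ∷ adj) B′ (there B′∈) = neighbour B B≉ Bs⊆ℬ adj B′ B′∈

  G-finite : ∀ {d} → Sparse d → ∀ x → Finite (G x)
  G-finite sp x = let (Bs , cover) = Sparse.incident sp x in
    x ∷ all-points Bs , λ
      { y (inj₁ refl) → here refl
      ; y (inj₂ (B , b , D , D′)) → there (inside Bs (cover B b D) D′) }
    where
    all-points : List Constraint → List X
    all-points []       = []
    all-points (B ∷ Bs) = points B ++ all-points Bs
    inside : ∀ {B y} Bs → Any (B ≈ᶜ_) Bs → dom B y → y ∈ₗ all-points Bs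
    inside {B} {y} (B′ ∷ Bs) (here B≈B′) D = Anyₚ.++⁺ˡ (dom-points B′ y (dom-resp {B} {B′} B≈B′ D))
    inside {B} {y} (B′ ∷ Bs) (there a) D = Anyₚ.++⁺ʳ (points B′) (inside {B} Bs a D)

  probability-bound : ∀ p d → Is𝗉 ℬ p → p *ᵣ fromℕ (suc d) ^ᵣ 2 ≤ᵣ e⁻¹ ^ᵣ 2 → ∀ L → e⁻¹ <ℚ fromℕℚ (suc d) * L →
    ∀ B → B ∈ ℬ → ∀ m n → HasCardinality Graphs (_∈ᶜ B) m → HasCardinality (setoid X) (dom B) n →
    fromℕℚ m * pow weight n ≤ L * L
  probability-bound p d (p-bound , _) hyp L e<DL B B∈ℬ m n cardᵐ cardⁿ = subst (_≤ L * L) ρ≡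
    (square-bound p d hyp {L} e<DL {ρ} 0≤ρ λ p<b → proj₂ (p-bound r (B , B∈ℬ , m , n , cardᵐ , cardⁿ , r≃r) p<b))
    where
    ρ : ℚ
    ρ = (+ m ℚ./ (q ℕ.^ n)) {{ℕₚ.m^n≢0 q n}}
    r : ℝ≥0
    r = (m /ᵣ (q ℕ.^ n)) {{ℕₚ.m^n≢0 q n}}
    r≃r : r ≃ᵣ r
    r≃r = (λ a → a) , λ a → a
    0≤ρ : 0ℚ ≤ ρ
    0≤ρ = ℚₚ.nonNegative⁻¹ ρ {{ℚₚ.normalize-nonNeg m (q ℕ.^ n) {{ℕₚ.m^n≢0 q n}}}}
    ρ≡ : ρ ≡ fromℕℚ m * pow weight n
    ρ≡ = trans (m/n≡m*1/n m (q ℕ.^ n) {{ℕₚ.m^n≢0 q n}}) (cong (fromℕℚ m *_) (sym (pow-inverse q n)))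

  -- A violating colouring restricts on the domain to one of the m members of B, so m cylinders
  -- cover. `value` makes the members total, as cylinders are given by total colourings.
  violation-bound : ∀ B {m n} → HasCardinality Graphs (_∈ᶜ B) m → HasCardinality (setoid X) (dom B) n →
                    ∀ xs → (∀ x → dom B x → x ∈ₗ xs) → ∀ f → E xs (λ f → 𝟙 (Violates f B)) f ≤ fromℕℚ m * pow weight n
  violation-bound B (φs , _ , refl , φs⇔) (ys , ys-unique , refl , ys⇔) xs cover f =
    subst (λ l → E xs (λ f → 𝟙 (Violates f B)) f ≤ fromℕℚ l * pow weight (length ys)) (Listₚ.length-map (value i₀) φs)
      (E-union-bound {xs} {ys} (λ f → Violates f B) (List.map (value i₀) φs) ys-unique
        (All.tabulate λ {x} e → cover x (Equivalence.from (ys⇔ x) e)) violated f)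
    where
    i₀ : Fin q
    i₀ = Fin.fromℕ< (ℕ.>-nonZero⁻¹ q)
    violated : ∀ f → Violates f B → Any (λ w → All (λ x → f x ≡ w x) ys) (List.map (value i₀) φs)
    violated f (φ , φ∈B , restriction) = Anyₚ.map⁺ (Any.map (λ {ψ} → agree {ψ}) (Equivalence.to (φs⇔ φ) φ∈B))
      where
      agree : ∀ {ψ} → φ ≈ᵍ ψ → All (λ x → f x ≡ value i₀ ψ x) ys
      agree {ψ} (φ⊆ψ , ψ⊆φ) = All.tabulate λ {x} e →
        proj₂ (Equivalence.to (restriction x (value i₀ ψ x))
          (ψ⊆φ (value-∈ {φ = ψ} (φ⊆ψ (Equivalence.from (restriction x (f x)) (Equivalence.from (ys⇔ x) e , refl))))))

  unlikely : ∀ p d → Is𝗉 ℬ p → p *ᵣ fromℕ (suc d) ^ᵣ 2 ≤ᵣ e⁻¹ ^ᵣ 2 → ∀ L → e⁻¹ <ℚ fromℕℚ (suc d) * L →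
             ∀ B → B ∈ ℬ → ∀ xs → (∀ x → dom B x → x ∈ₗ xs) → ∀ f → E xs (λ f → 𝟙 (Violates f B)) f ≤ L * L
  unlikely p d isp hyp L e<DL B B∈ℬ xs cover f =
    let (m , cardᵐ) = constraint-cardinality B ; (n , cardⁿ) = dom-cardinality B in
    ℚₚ.≤-trans (violation-bound B cardᵐ cardⁿ xs cover f) (probability-bound p d isp hyp L e<DL B B∈ℬ m n cardᵐ cardⁿ)

-- A generic toast.

module Generic (em : ∀ {ℓ} → ExcludedMiddle ℓ) (ext : ∀ {a b} → Extensionality a b)
    (X : Set) (q : ℕ) .{{_ : NonZero q}} (τ : Topology X) (𝓤 : Uniform X)
    (open⇔ : ∀ A → Topology.Open τ A ⇔ Uniform.Opn 𝓤 A)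
    (𝔅 : σ-Algebra (setoid X))
    (borel : ∀ A → Measurable 𝔅 A → ∀ i → Descriptive.Δ em ext X 𝓤 (λ v → A (v i)))
    (ℬ : Pred (CSP.Constraint X q) 0ℓ) (isBorelCSP : CSP.IsBorelCSP X q 𝔅 ℬ)
    (G-finite : ∀ x → FiniteSets.Finite em (Stages.G em ext X q ℬ x)) where
  open Classical em
  open Pairing
  open Uniform 𝓤
  open Descriptive em ext X 𝓤 using (isolate; 𝒟-⋂; 𝒟-const; 𝒟-∪)
  open Countability using (countable-ℕ)
  open Category em ext X τ 𝓤 open⇔
  open Stages em ext X q ℬ using (G; G-sym)
  open Decomposition em ext X G (inj₁ refl) G-sym G-finite
  open MeasurableSolution em ext X q 𝓤 𝔅 borel ℬ isBorelCSP G-finite using (module ToastMeasurable)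

  target : ℕ → Pred X 0ℓ
  target n = Basic (proj₁ (unpair n))

  -- Every point is isolated by some Basic j, so one of these sets is nonmeager
  -- in the target unless the target is meager.
  NonMeagerAt : ℕ → (X → X → Set) → ℕ → Set₁
  NonMeagerAt n R j = ¬ Meager τ (Isolated Basic R n j ∩ target n)

  index : ∀ {P : ℕ → Set₁} → ∃ P ⊎ ¬ ∃ P → ℕ
  index (inj₁ (j , _)) = j
  index (inj₂ _)       = 0

  index-spec : ∀ {P : ℕ → Set₁} (s : ∃ P ⊎ ¬ ∃ P) {j} → P j → P (index s)
  index-spec (inj₁ (_ , p)) _ = p
  index-spec (inj₂ none)    p = contradiction (_ , p) none

  -- The relation is an argument because the toast is built by recursion: the choice at stage n
  -- depends on the classes formed by the earlier ones.
  choose : ℕ → (X → X → Set) → ℕ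
  choose n R = index (lem (∃ (NonMeagerAt n R)))

  choose-spec : ∀ n R {j} → NonMeagerAt n R j → NonMeagerAt n R (choose n R)
  choose-spec n R {j} = index-spec {NonMeagerAt n R} (lem (∃ (NonMeagerAt n R))) {j}

  open Toast Basic choose public
  open ToastMeasurable choose public

  Missed : ℕ → Pred X 0ℓ
  Missed n₀ a = ∀ n → n₀ ℕ.≤ n → ¬ Centre n a

  missed-BP : ∀ n₀ → BP (Missed n₀)
  missed-BP n₀ = BP-resp
    ( (λ f n le c → Sum.[ (λ ¬le → ¬le le) , (λ ¬c → ¬c c) ]′ (f n))
    , (λ f n → Sum.[ (λ le → inj₂ (f n le)) , inj₁ ]′ (lem (n₀ ℕ.≤ n))))
    (BP-𝒟 (𝒟-⋂ countable-ℕ (λ n v → ¬ n₀ ℕ.≤ n ⊎ ¬ Centre n (v 0)) λ n → 𝒟-∪ (𝒟-const _) (gen-∁ (centre-𝒟 n 0))))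

  -- Reach sets are finite, so each point of the target is isolated by some basic set. If the chosen
  -- index gave a meager set, all of them would, and the target would be a countable union of meager
  -- sets.
  centre-nonmeager : ∀ n → ¬ Meager τ (target n) → ¬ Meager τ (Centre n ∩ target n)
  centre-nonmeager n nm m = nm (meager-⊆ cover (meager-⋃ _ λ j → dne λ nmⱼ → choose-spec n (E n) {j} nmⱼ m))
    where
    cover : target n ⊆ ⋃ ℕ (λ j → Isolated Basic (E n) n j ∩ target n)
    cover {a} t = let (xs , f) = Eq.reach-finite n (scale n) a ; (j , b , only) = isolate a xs in
      j , (b , λ (a′ , r , b′ , ne) → ne (only a′ (f a′ r) b′)) , t

  -- The centres of a late stage n that targets `Basic m` are not missed, so in `Basic m` they
  -- belong to the meager difference of V and `Missed n₀`; but they are nonmeager unless `Basic m`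
  -- is meager.
  missed-nonmeager : ∀ {m n n₀ V} → proj₁ (unpair n) ≡ m → n₀ ℕ.≤ n → (∀ y → Basic m y → V y) →
                     Meager τ ((Missed n₀ ∖ V) ∪ (V ∖ Missed n₀)) → ¬ ¬ Meager τ (Basic m)
  missed-nonmeager {n = n} refl n₀≤n sub mΔ nm = centre-nonmeager n nm
    (meager-⊆ (λ {a} (c , t) → inj₂ (sub a t , λ q → q n n₀≤n c)) mΔ)

  missed-meager : ∀ n₀ → Meager τ (Missed n₀)
  missed-meager n₀ = meager-unless-inside (missed-BP n₀) λ m sub →
    let (n , m≡ , n₀≤n) = unpair-late m n₀ in dne (missed-nonmeager m≡ n₀≤n sub (proj₂ (proj₂ (missed-BP n₀))))

  recurrent-comeager : Meager τ (∁ Recurrent)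
  recurrent-comeager = meager-⊆
    (λ {a} ¬rec → let (n₀ , none) = ¬∀⇒∃¬ ¬rec in n₀ , λ n le c → none (n , le , c))
    (meager-⋃ Missed missed-meager)

-- Gluing the solutions on typical and atypical orbits.

module Glue (em : ∀ {ℓ} → ExcludedMiddle ℓ) {X C : Set} (P : Pred X 0ℓ) (g h : X → C) where
  open Classical em

  glue : X → C
  glue x with lem (P x)
  ... | inj₁ _ = g x
  ... | inj₂ _ = h x

  glue-∈ : ∀ {x} → P x → g x ≡ glue x
  glue-∈ {x} p with lem (P x)
  ... | inj₁ _  = refl
  ... | inj₂ ¬p = contradiction p ¬p

  glue-∉ : ∀ {x} → ¬ P x → h x ≡ glue x
  glue-∉ {x} ¬p with lem (P x)
  ... | inj₁ p = contradiction p ¬p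
  ... | inj₂ _ = refl

module Assembly (em : ∀ {ℓ} → ExcludedMiddle ℓ) (ext : ∀ {a b} → Extensionality a b)
    (X : Set) (q : ℕ) .{{_ : NonZero q}} (τ : Topology X) (𝓤 : Uniform X)
    (open⇔ : ∀ A → Topology.Open τ A ⇔ Uniform.Opn 𝓤 A)
    (𝔅 : σ-Algebra (setoid X))
    (borel : ∀ A → Measurable 𝔅 A → ∀ i → Descriptive.Δ em ext X 𝓤 (λ v → A (v i)))
    (ℬ : Pred (CSP.Constraint X q) 0ℓ) (isBorelCSP : CSP.IsBorelCSP X q 𝔅 ℬ)
    (G-finite : ∀ x → FiniteSets.Finite em (Stages.G em ext X q ℬ x))
    {d : ℕ} (sparse : Stages.Sparse em ext X q ℬ d) {r : ℚ} (0<r : 0ℚ ℚ.< r) (r<1 : r ℚ.< 1ℚ)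
    (unlikely : ∀ B → B ∈ ℬ → ∀ xs → (∀ x → CSP.dom X q B x → Any (x ≡_) xs) → ∀ f →
       Averaging.E em ext X q xs (λ f → Classical.𝟙 em (CSP.Violates X q f B)) f
         ℚ.≤ (r ℚ.* ℚ-Order.pow (1ℚ ℚ.- r) d) ℚ.* (r ℚ.* ℚ-Order.pow (1ℚ ℚ.- r) d))
    (c₀ : Fin q) where
  open Classical em
  open CSP X q
  open Category em ext X τ 𝓤 open⇔ using (meager-⊆; BP-modulo; BP-𝒟)
  open Stages em ext X q ℬ using (G; G-sym; violates-dep)
  open Components X G G-sym using (conn-refl)
  open Decomposition em ext X G (inj₁ refl) G-sym G-finite using (Orb; orb-step; module Parity)
  open Parity using (Even; even-finite; odd-finite)
  open Generic em ext X q τ 𝓤 open⇔ 𝔅 borel ℬ isBorelCSP G-finite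
    using (Ring; ring-finite; off-ring-finite; ring-𝒟; Recurrent; recurrent-comeager)
  module Measurability = MeasurableSolution em ext X q 𝓤 𝔅 borel ℬ isBorelCSP G-finite
  open Measurability.SolutionMeasurable sparse 0<r r<1 unlikely c₀ using (solution-meas)
  open Stages.TwoStages em ext X q ℬ sparse 0<r r<1 unlikely (Measurability.Painted.codes c₀) (λ _ → c₀)
    using (solution; satisfied; no-empty-violation)

  -- Saturated under orbits, so that no constraint meets both sides of the gluing.
  Typical : Pred X 0ℓ
  Typical y = ∃[ a ] Recurrent a × Orb a y

  typical-closed : ∀ {y z} → Typical y → G y z → Typical z
  typical-closed (a , r , o) g = a , r , orb-step o g

  recurrent⇒typical : ∀ {y} → Recurrent y → Typical y
  recurrent⇒typical r = _ , r , conn-refl tt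

  open Glue em Typical (solution Ring) (solution Even) public

  glue-solves : Solution ℬ glue
  glue-solves B B∈ℬ = Sum.[ nonempty , (λ none → no-empty-violation B B∈ℬ (λ y D → none (y , D)) glue) ]′ (lem (∃[ y ] dom B y))
    where
    typical : ∀ {y} → dom B y → Typical y → Satisfies glue B
    typical {y} D t v = satisfied Ring Typical typical-closed (λ z _ → ring-finite z)
      (λ z (a , r , o) → off-ring-finite r o) B B∈ℬ {y} D t
      (violates-dep {B} {glue} {solution Ring} (λ z D′ → sym (glue-∈ (typical-closed {y} {z} t (inj₂ (B , B∈ℬ , D , D′))))) v)
    atypical : ∀ {y} → dom B y → ¬ Typical y → Satisfies glue B
    atypical {y} D ¬t v = satisfied Even (∁ Typical) (λ {y} {z} ¬t g t → ¬t (typical-closed {z} {y} t (G-sym g)))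
      (λ z _ → even-finite z) (λ z _ → odd-finite z) B B∈ℬ {y} D ¬t
      (violates-dep {B} {glue} {solution Even} (λ z D′ → sym (glue-∉ λ t → ¬t (typical-closed {z} {y} t (inj₂ (B , B∈ℬ , D′ , D))))) v)
    nonempty : ∃[ y ] dom B y → Satisfies glue B
    nonempty (y , D) = Sum.[ typical D , atypical D ]′ (lem (Typical y))

  -- The glued colouring differs from the toast solution only at points that are not recurrent. They
  -- form a meager set, so the parity solution may be as irregular as it likes.
  glue-measurable : BaireMeasurable τ glue
  glue-measurable c = BP-modulo {glueᶜ} {ringᶜ}
    (meager-⊆ {glueᶜ ∖ ringᶜ} {∁ Recurrent} (λ { {y} (e , ne) r → ne (trans (glue-∈ {y} (recurrent⇒typical r)) e) }) recurrent-comeager)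
    (meager-⊆ {ringᶜ ∖ glueᶜ} {∁ Recurrent} (λ { {y} (e , ne) r → ne (trans (sym (glue-∈ {y} (recurrent⇒typical r))) e) }) recurrent-comeager)
    (BP-𝒟 {λ v → solution Ring (v 0) ≡ c} (solution-meas {Ring} ring-𝒟 c 0))
    where
    glueᶜ ringᶜ : Pred X 0ℓ
    glueᶜ y = glue y ≡ c
    ringᶜ y = solution Ring y ≡ c

corollary1p33 : (∀ {ℓ} → ExcludedMiddle ℓ) →
    (∀ {a b} → Extensionality a b) →
    (q : ℕ) .{{_ : NonZero q}}
    (X : Set) (𝔅 : σ-Algebra (setoid X)) → IsStandardBorel 𝔅 →
    (ℬ : Pred (CSP.Constraint X q) 0ℓ) → CSP.IsBorelCSP X q 𝔅 ℬ →
    (p : ℝ≥0) → CSP.Is𝗉 X q ℬ p →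
    (d : ℕ) → CSP.Is𝖽 X q ℬ d →
    p *ᵣ fromℕ (suc d) ^ᵣ 2 ≤ᵣ e⁻¹ ^ᵣ 2 →
    (τ : Topology X) → Polish τ → Compatible τ 𝔅 →
    Σ[ f ∈ (X → Fin q) ] CSP.Solution X q ℬ f × BaireMeasurable τ f
corollary1p33 em ext q X 𝔅 _ ℬ isBorelCSP p isp d isd hyp τ polish compatible =
  glue , glue-solves , glue-measurable
  where
  -- Analytic sets and category are taken with respect to τ itself; compatibility then places every
  -- 𝔅-measurable set in `Δ`.
  open Metrization τ polish using (uniform; open⇔)
  open SparseCSP em ext X q ℬ using (sparse; G-finite; unlikely)

  isSparse : Stages.Sparse em ext X q ℬ d
  isSparse = sparse (CSP.IsCSP.respects (proj₁ isBorelCSP)) isd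

  x : ℚ
  x = proj₁ (Threshold.threshold d)

  open Assembly em ext X q τ uniform open⇔ 𝔅
    (λ A m i → Descriptive.Δ-borel em ext X uniform i (λ O → Equivalence.to (open⇔ O)) (Equivalence.to (compatible A) m))
    ℬ isBorelCSP (G-finite isSparse) isSparse {x}
    (proj₁ (proj₂ (Threshold.threshold d))) (proj₁ (proj₂ (proj₂ (Threshold.threshold d))))
    (unlikely p d isp hyp (x ℚ.* ℚ-Order.pow (1ℚ ℚ.- x) d) (proj₂ (proj₂ (proj₂ (Threshold.threshold d)))))
    (Fin.fromℕ< (ℕ.>-nonZero⁻¹ q))
    using (glue; glue-solves; glue-measurable)
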